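{- Let $B$ be an abelian complex C*-algebra with a computable presentation. Let $A$ be the subset of self-adjoint elements of $B$. Then $A$ is a real C*-algebra, and any computable presentation of $A$ induces a computable presentation of $B$ (namely, if $(A,(x_n)_{n\in\mathbb{N}})$ is a computable presentation of the real C*-algebra $A$, then $(B,(x_n)_{n\in\mathbb{N}})$ is a computable presentation of the complex C*-algebra $B$). Furthermore, the following are equivalent: (a) $B$ is computably categorical as a complex C*-algebra; (b) $A$ is computably categorical as a real C*-algebra; (c) $A$ is computably categorical as a real Banach algebra.
   Context: Let $\mathbb{K}\in\{\mathbb{R},\mathbb{C}\}$. A C*-algebra over $\mathbb{K}$ is a Banach *-algebra over $\mathbb{K}$ (not necessarily unital) that is isometrically *-isomorphic to a norm-closed *-subalgebra of the bounded operators on a Hilbert space over $\mathbb{K}$; "real" and "complex" C*-algebra mean over $\mathbb{R}$ and over $\mathbb{C}$. *-homomorphisms are $\mathbb{K}$-linear. $A$ carries the operations and norm induced from $B$. A presentation $A^\dagger=(A,\overline{a})$ of a separable C*-algebra $A$ over $\mathbb{K}$ consists of $A$ and a countable (finite or infinite) sequence $\overline{a}$ of elements (the special points) generating $A$ as a C*-algebra over $\mathbb{K}$. A polynomial is rational if its coefficients lie in $\mathbb{Q}$ (when $\mathbb{K}=\mathbb{R}$) or $\mathbb{Q}(i)$ (when $\mathbb{K}=\mathbb{C}$). A rational point of $A^\dagger$ is an element $p(a_{i_1},\ldots,a_{i_n})$ with $p$ a rational noncommutative *-polynomial with no constant term (as input to an algorithm it is given by $p$ and the indices). $A^\dagger$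 is computable if there is an effective procedure which, given a rational point $r$ and $k\in\mathbb{N}$, returns $q\in\mathbb{Q}$ with $|\|r\|-q|<2^{ -k}$. For computable presentations $A^\dagger$, $B^\dagger$ of $A$, $B$, a *-homomorphism $\varphi:A\to B$ is computable from $A^\dagger$ to $B^\dagger$ if there is an effective procedure which, given a rational point $r$ of $A^\dagger$ and $k\in\mathbb{N}$, returns a rational point $s$ of $B^\dagger$ with $\|\varphi(r)-s\|<2^{ -k}$. A computable isomorphism is a bijective computable *-homomorphism. $A$ is computably categorical (as a C*-algebra over $\mathbb{K}$) if for all computable presentations $A^\dagger$, $A^+$ of $A$ there is a computable isomorphism from $A^\dagger$ to $A^+$. The corresponding notions for real Banach algebras are obtained by dropping the involution: special points generate $A$ as a real Banach algebra, rational points are given by rational polynomials (without *) with no constant term, and isomorphisms are isometric real algebra isomorphisms. -}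

module Defs where

open import Level using (0ℓ)
open import Algebra.Bundles using (CommutativeRing; Group)
open import Algebra.Structures using (IsCommutativeRing)
open import Algebra.Module.Bundles.Raw using (RawLeftModule)
open import Algebra.Module.Structures using (IsLeftModule)
open import Algebra.Module.Morphism.Structures using (module LeftModuleMorphisms)
open import Data.Bool.Base using (Bool; true; false; if_then_else_)
open import Data.Fin.Base using (Fin; toℕ)
open import Data.Integer.Base as ℤ using (ℤ; -[1+_])
import Data.Integer.Properties as ℤ
open import Data.List.Base as List using (List; []; _∷_)
open import Data.List.NonEmpty.Base as List⁺ using (List⁺)
open import Data.Nat.Base as ℕ using (ℕ; zero; suc; _⊔_)
import Data.Nat.Properties as ℕ
open import Data.Product.Base using (Σ; ∃-syntax; _×_; _,_; proj₁; proj₂)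
open import Data.Sum.Base using (inj₁; inj₂)
import Data.Rational.Base as ℚ
import Data.Rational.Properties as ℚ
open import Data.Rational.Unnormalised.Base using (ℚᵘ; mkℚᵘ)
import Data.Rational.Unnormalised.Base as ℚᵘ using (*≤*)
import Data.Rational.Unnormalised.Properties as ℚᵘ
open import Function.Base using (_∘_)
open import Function.Definitions using (Bijective)
open import Data.Rational.Base using (fromℚᵘ)
open import Relation.Nullary.Decidable.Core using (from-yes)
open import Relation.Binary.Structures using (IsEquivalence)
import Algebra.Definitions as AlgebraDefinitions
import Algebra.Properties.Group as GroupProperties
import Algebra.Properties.AbelianGroup as AbelianGroupProperties
import Algebra.Properties.CommutativeSemigroup as SemigroupProperties
import Algebra.Properties.Ring as RingProperties
import Relation.Binary.Reasoning.Setoid as SetoidReasoning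

module RingIdentities (R : CommutativeRing 0ℓ 0ℓ) where
  open CommutativeRing R
  open RingProperties ring
    using (x[y-z]≈xy-xz; [y-z]x≈yx-zx; //-rightDividesˡ; //-rightDividesʳ)
  open AbelianGroupProperties +-abelianGroup using (⁻¹-∙-comm; ⁻¹-anti-homo‿-)
  open SemigroupProperties +-commutativeSemigroup using (interchange)
  open SemigroupProperties *-commutativeSemigroup using () renaming (x∙yz≈y∙xz to x*yz≈y*xz)
  open SetoidReasoning setoid

  restore : ∀ a b → a ≈ (a - b) + b
  restore a b = sym (//-rightDividesˡ b a)

  cancel : ∀ a b → (a + b) - b ≈ a
  cancel a b = //-rightDividesʳ b a

  flip-difference : ∀ a b → a - b ≈ - (b - a)
  flip-difference a b = sym (⁻¹-anti-homo‿- b a)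

  split-difference : ∀ a b c → a - c ≈ (a - b) + (b - c)
  split-difference a b c = trans (+-congʳ (restore a b)) (+-assoc (a - b) b (- c))

  sum-difference : ∀ a b c d → (a + b) - (c + d) ≈ (a - c) + (b - d)
  sum-difference a b c d = begin
    (a + b) - (c + d)      ≈⟨ +-congˡ (⁻¹-∙-comm c d) ⟨
    (a + b) + (- c + - d)  ≈⟨ interchange a b (- c) (- d) ⟩
    (a - c) + (b - d)      ∎

  negation-difference : ∀ a b → (- a) - (- b) ≈ - (a - b)
  negation-difference a b = ⁻¹-∙-comm a (- b)

  product-difference : ∀ a b c d → a * b - c * d ≈ a * (b - d) + d * (a - c)
  product-difference a b c d = begin
    a * b - c * d                      ≈⟨ split-difference (a * b) (a * d) (c * d) ⟩
    (a * b - a * d) + (a * d - c * d)  ≈⟨ +-cong (x[y-z]≈xy-xz a b d) ([y-z]x≈yx-zx d a c) ⟨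
    a * (b - d) + (a - c) * d          ≈⟨ +-congˡ (*-comm (a - c) d) ⟩
    a * (b - d) + d * (a - c)          ∎

  expand-successor : ∀ h x p → (1# + x) * (h * p) ≈ h * p + h * (x * p)
  expand-successor h x p = begin
    (1# + x) * (h * p)            ≈⟨ distribʳ (h * p) 1# x ⟩
    1# * (h * p) + x * (h * p)    ≈⟨ +-cong (*-identityˡ (h * p)) (x*yz≈y*xz x h p) ⟩
    h * p + h * (x * p)           ∎

module ComplexIdentities (R : CommutativeRing 0ℓ 0ℓ) where
  open CommutativeRing R
  open RingIdentities R
  open RingProperties ring using (x[y-z]≈xy-xz; [y-z]x≈yx-zx)
  open AbelianGroupProperties +-abelianGroup using (⁻¹-∙-comm)
  open SemigroupProperties +-commutativeSemigroup using (interchange)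
  open SetoidReasoning setoid

  assoc-re : ∀ a b c d e f →
    (a * c - b * d) * e - (a * d + b * c) * f ≈ a * (c * e - d * f) - b * (c * f + d * e)
  assoc-re a b c d e f = begin
    (a * c - b * d) * e - (a * d + b * c) * f
      ≈⟨ +-cong ([y-z]x≈yx-zx e (a * c) (b * d)) (-‿cong (distribʳ f (a * d) (b * c))) ⟩
    (a * c * e - b * d * e) - (a * d * f + b * c * f)
      ≈⟨ sum-difference (a * c * e) (- (b * d * e)) (a * d * f) (b * c * f) ⟩
    (a * c * e - a * d * f) + (- (b * d * e) - b * c * f)
      ≈⟨ +-cong (+-cong (*-assoc a c e) (-‿cong (*-assoc a d f)))
           (trans (+-cong (-‿cong (*-assoc b d e)) (-‿cong (*-assoc b c f)))
             (trans (+-comm (- (b * (d * e))) (- (b * (c * f)))) (⁻¹-∙-comm (b * (c * f)) (b * (d * e))))) ⟩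
    (a * (c * e) - a * (d * f)) - (b * (c * f) + b * (d * e))
      ≈⟨ +-cong (x[y-z]≈xy-xz a (c * e) (d * f)) (-‿cong (distribˡ b (c * f) (d * e))) ⟨
    a * (c * e - d * f) - b * (c * f + d * e) ∎

  assoc-im : ∀ a b c d e f →
    (a * c - b * d) * f + (a * d + b * c) * e ≈ a * (c * f + d * e) + b * (c * e - d * f)
  assoc-im a b c d e f = begin
    (a * c - b * d) * f + (a * d + b * c) * e
      ≈⟨ +-cong ([y-z]x≈yx-zx f (a * c) (b * d)) (distribʳ e (a * d) (b * c)) ⟩
    (a * c * f - b * d * f) + (a * d * e + b * c * e)
      ≈⟨ interchange (a * c * f) (- (b * d * f)) (a * d * e) (b * c * e) ⟩
    (a * c * f + a * d * e) + (- (b * d * f) + b * c * e)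
      ≈⟨ +-cong (+-cong (*-assoc a c f) (*-assoc a d e))
           (trans (+-cong (-‿cong (*-assoc b d f)) (*-assoc b c e))
             (+-comm (- (b * (d * f))) (b * (c * e)))) ⟩
    (a * (c * f) + a * (d * e)) + (b * (c * e) - b * (d * f))
      ≈⟨ +-cong (distribˡ a (c * f) (d * e)) (x[y-z]≈xy-xz b (c * e) (d * f)) ⟨
    a * (c * f + d * e) + b * (c * e - d * f) ∎

  distribˡ-re : ∀ a b c d e f →
    a * (c + e) - b * (d + f) ≈ (a * c - b * d) + (a * e - b * f)
  distribˡ-re a b c d e f = trans
    (+-cong (distribˡ a c e) (-‿cong (distribˡ b d f)))
    (sum-difference (a * c) (a * e) (b * d) (b * f))

  distribˡ-im : ∀ a b c d e f →
    a * (d + f) + b * (c + e) ≈ (a * d + b * c) + (a * f + b * e)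
  distribˡ-im a b c d e f = trans
    (+-cong (distribˡ a d f) (distribˡ b c e))
    (interchange (a * d) (a * f) (b * c) (b * e))

  comm-im : ∀ a b c d → a * d + b * c ≈ c * b + d * a
  comm-im a b c d = trans (+-comm (a * d) (b * c)) (+-cong (*-comm b c) (*-comm a d))

  identityˡ-re : ∀ a b → 1# * a - 0# * b ≈ a
  identityˡ-re a b = begin
    1# * a - 0# * b  ≈⟨ +-cong (*-identityˡ a) (-‿cong (zeroˡ b)) ⟩
    a - 0#           ≈⟨ +-congʳ (+-identityʳ a) ⟨
    (a + 0#) - 0#    ≈⟨ cancel a 0# ⟩
    a                ∎

  identityˡ-im : ∀ a b → 1# * b + 0# * a ≈ b
  identityˡ-im a b = trans (+-cong (*-identityˡ b) (zeroˡ a)) (+-identityʳ b)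

-- ℝ is the setoid of Cauchy sequences of rationals up to null sequences.
module Reals where

  open import Relation.Binary.PropositionalEquality
    using (_≡_; refl; sym; trans; cong; subst)
  open import Data.Rational.Base
    using (ℚ; 0ℚ; 1ℚ; ½; _+_; _*_; -_; _-_; ∣_∣; _≤_; fromℚᵘ)
  open import Data.Rational.Properties using (module ≤-Reasoning)

  2^-_ : ℕ → ℚ
  2^- zero  = 1ℚ
  2^- suc k = ½ * 2^- k

  record ℝ : Set where
    no-eta-equality
    constructor mkℝ
    field
      term   : ℕ → ℚ
      cauchy : ∀ k → ∃[ N ] ∀ m n → N ℕ.≤ m → N ℕ.≤ n → ∣ term m - term n ∣ ≤ 2^- k

  open ℝ public

  infix 4 _≈ℝ_ _≤ℝ_ _<ℝ_

  record _≈ℝ_ (x y : ℝ) : Set where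
    constructor mk≈
    field
      agree : ∀ k → ∃[ N ] ∀ n → N ℕ.≤ n → ∣ term x n - term y n ∣ ≤ 2^- k

  record _≤ℝ_ (x y : ℝ) : Set where
    constructor mk≤
    field
      below : ∀ k → ∃[ N ] ∀ n → N ℕ.≤ n → term x n ≤ term y n + 2^- k

  record _<ℝ_ (x y : ℝ) : Set where
    constructor mk<
    field
      separated : ∃[ k ] ∃[ N ] ∀ n → N ℕ.≤ n → term x n + 2^- k ≤ term y n

  open _≈ℝ_ public
  open _≤ℝ_ public
  open _<ℝ_ public

  open RingIdentities ℚ.+-*-commutativeRing

  half+half : ∀ p → ½ * p + ½ * p ≡ p
  half+half p = trans (sym (ℚ.*-distribʳ-+ p ½ ½)) (ℚ.*-identityˡ p)

  0≤2^- : ∀ k → 0ℚ ≤ 2^- k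
  0≤2^- zero    = ℚ.nonNegative⁻¹ 1ℚ
  0≤2^- (suc k) = subst (_≤ ½ * 2^- k) (ℚ.*-zeroʳ ½)
    (ℚ.*-monoˡ-≤-nonNeg ½ (0≤2^- k))

  2^-≤1 : ∀ k → 2^- k ≤ 1ℚ
  2^-≤1 zero    = ℚ.≤-refl
  2^-≤1 (suc k) = begin
    ½ * 2^- k             ≤⟨ ℚ.*-monoˡ-≤-nonNeg ½ (2^-≤1 k) ⟩
    ½ * 1ℚ                ≤⟨ from-yes (½ * 1ℚ ℚ.≤? 1ℚ) ⟩
    1ℚ                    ∎
    where open ≤-Reasoning

  2^-+ : ∀ j k → 2^- (j ℕ.+ k) ≡ 2^- j * 2^- k
  2^-+ zero    k = sym (ℚ.*-identityˡ _)
  2^-+ (suc j) k = trans (cong (½ *_) (2^-+ j k)) (sym (ℚ.*-assoc ½ (2^- j) (2^- k)))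

  +-bound : ∀ {a b} k → ∣ a ∣ ≤ 2^- suc k → ∣ b ∣ ≤ 2^- suc k → ∣ a + b ∣ ≤ 2^- k
  +-bound {a} {b} k p q = begin
    ∣ a + b ∣              ≤⟨ ℚ.∣p+q∣≤∣p∣+∣q∣ a b ⟩
    ∣ a ∣ + ∣ b ∣          ≤⟨ ℚ.+-mono-≤ p q ⟩
    2^- suc k + 2^- suc k  ≡⟨ half+half (2^- k) ⟩
    2^- k                  ∎
    where open ≤-Reasoning

  scaled-bound : ∀ {a d} b k → ∣ a ∣ * 2^- b ≤ 1ℚ → ∣ d ∣ ≤ 2^- (b ℕ.+ k) → ∣ a * d ∣ ≤ 2^- k
  scaled-bound {a} {d} b k p q = begin
    ∣ a * d ∣                ≡⟨ ℚ.∣p*q∣≡∣p∣*∣q∣ a d ⟩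
    ∣ a ∣ * ∣ d ∣            ≤⟨ ℚ.*-monoˡ-≤-nonNeg ∣ a ∣ {{ℚ.∣-∣-nonNeg a}} q ⟩
    ∣ a ∣ * 2^- (b ℕ.+ k)    ≡⟨ cong (∣ a ∣ *_) (2^-+ b k) ⟩
    ∣ a ∣ * (2^- b * 2^- k)  ≡⟨ sym (ℚ.*-assoc ∣ a ∣ _ _) ⟩
    ∣ a ∣ * 2^- b * 2^- k    ≤⟨ ℚ.*-monoʳ-≤-nonNeg (2^- k) {{ℚ.nonNegative (0≤2^- k)}} p ⟩
    1ℚ * 2^- k               ≡⟨ ℚ.*-identityˡ _ ⟩
    2^- k                    ∎
    where open ≤-Reasoning

  product-bound : ∀ a b c d r s k → ∣ a ∣ * 2^- r ≤ 1ℚ → ∣ d ∣ * 2^- s ≤ 1ℚ →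
    ∣ b - d ∣ ≤ 2^- (r ℕ.+ suc k) → ∣ a - c ∣ ≤ 2^- (s ℕ.+ suc k) →
    ∣ a * b - c * d ∣ ≤ 2^- k
  product-bound a b c d r s k p q u v = subst (λ z → ∣ z ∣ ≤ 2^- k) (sym (product-difference a b c d))
    (+-bound {a * (b - d)} {d * (a - c)} k
      (scaled-bound {a} r (suc k) p u) (scaled-bound {d} s (suc k) q v))

  natural*2^-≤1 : ∀ n → fromℚᵘ (mkℚᵘ (ℤ.+ n) 0) * 2^- n ≤ 1ℚ
  natural*2^-≤1 zero    = ℚ.≤-trans (ℚ.≤-reflexive (ℚ.*-zeroˡ (2^- 0))) (ℚ.nonNegative⁻¹ 1ℚ)
  natural*2^-≤1 (suc n) = begin
    fromℚᵘ (mkℚᵘ (ℤ.+ suc n) 0) * (½ * 2^- n)  ≡⟨ cong (_* (½ * 2^- n)) step ⟩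
    (1ℚ + x) * (½ * 2^- n)                     ≡⟨ expand-successor ½ x (2^- n) ⟩
    ½ * 2^- n + ½ * (x * 2^- n)                ≤⟨ ℚ.+-mono-≤ (ℚ.*-monoˡ-≤-nonNeg ½ (2^-≤1 n))
                                                    (ℚ.*-monoˡ-≤-nonNeg ½ (natural*2^-≤1 n)) ⟩
    ½ * 1ℚ + ½ * 1ℚ                            ≡⟨⟩
    1ℚ                                         ∎
    where
    open ≤-Reasoning
    x : ℚ
    x = fromℚᵘ (mkℚᵘ (ℤ.+ n) 0)
    step : fromℚᵘ (mkℚᵘ (ℤ.+ suc n) 0) ≡ 1ℚ + x
    step = ℚ.toℚᵘ-injective (ℚᵘ.≃-trans (ℚ.toℚᵘ-fromℚᵘ _)
      (ℚᵘ.≃-sym (ℚᵘ.≃-trans (ℚ.toℚᵘ-homo-+ 1ℚ x)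
        (ℚᵘ.≃-trans (ℚᵘ.+-congʳ (ℚ.toℚᵘ 1ℚ) (ℚ.toℚᵘ-fromℚᵘ (mkℚᵘ (ℤ.+ n) 0)))
          (ℚᵘ.≃-reflexive (cong (λ z → mkℚᵘ (ℤ.1ℤ ℤ.+ z) 0) (ℤ.*-identityʳ (ℤ.+ n))))))))

  ≤natural : ∀ q → q ≤ fromℚᵘ (mkℚᵘ (ℤ.+ ℤ.∣ ℚ.numerator q ∣) 0)
  ≤natural q@(ℚ.mkℚ (ℤ.+ n) d-1 _) = ℚ.toℚᵘ-cancel-≤
    (ℚᵘ.≤-respʳ-≃ (ℚᵘ.≃-sym (ℚ.toℚᵘ-fromℚᵘ (mkℚᵘ (ℤ.+ n) 0)))
      (ℚᵘ.*≤* (ℤ.*-monoˡ-≤-nonNeg (ℤ.+ n) (ℤ.+≤+ (ℕ.s≤s ℕ.z≤n)))))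
  ≤natural q@(ℚ.mkℚ -[1+ n ] d-1 _) = ℚ.toℚᵘ-cancel-≤
    (ℚᵘ.≤-respʳ-≃ (ℚᵘ.≃-sym (ℚ.toℚᵘ-fromℚᵘ (mkℚᵘ (ℤ.+ suc n) 0)))
      (ℚᵘ.*≤* ℤ.-≤+))

  archimedean : ∀ M → ∃[ b ] ∀ a → ∣ a ∣ ≤ M → ∣ a ∣ * 2^- b ≤ 1ℚ
  archimedean M = ℤ.∣ ℚ.numerator M ∣ , λ a a≤M →
    ℚ.≤-trans
      (ℚ.*-monoʳ-≤-nonNeg (2^- ℤ.∣ ℚ.numerator M ∣) {{ℚ.nonNegative (0≤2^- ℤ.∣ ℚ.numerator M ∣)}}
        (ℚ.≤-trans a≤M (≤natural M)))
      (natural*2^-≤1 ℤ.∣ ℚ.numerator M ∣)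

  ∣p∣≤∣p-q∣+∣q∣ : ∀ p q → ∣ p ∣ ≤ ∣ p - q ∣ + ∣ q ∣
  ∣p∣≤∣p-q∣+∣q∣ p q = begin
    ∣ p ∣                ≡⟨ cong ∣_∣ (restore p q) ⟩
    ∣ (p - q) + q ∣      ≤⟨ ℚ.∣p+q∣≤∣p∣+∣q∣ (p - q) q ⟩
    ∣ p - q ∣ + ∣ q ∣    ∎
    where open ≤-Reasoning

  eventually-bounded : ∀ x → ∃[ b ] ∃[ N ] ∀ n → N ℕ.≤ n → ∣ term x n ∣ * 2^- b ≤ 1ℚ
  eventually-bounded x =
    let (N , close) = cauchy x 0
        (b , small) = archimedean (1ℚ + ∣ term x N ∣)
    in b , N , λ n N≤n → small (term x n)
      (ℚ.≤-trans (∣p∣≤∣p-q∣+∣q∣ (term x n) (term x N))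
        (ℚ.+-monoˡ-≤ ∣ term x N ∣ (close n N N≤n ℕ.≤-refl)))

  ∣p-q∣≡∣q-p∣ : ∀ p q → ∣ p - q ∣ ≡ ∣ q - p ∣
  ∣p-q∣≡∣q-p∣ p q = trans (cong ∣_∣ (flip-difference p q)) (ℚ.∣-p∣≡∣p∣ (q - p))

  ∣p∣-∣q∣≤∣p-q∣ : ∀ p q → ∣ p ∣ - ∣ q ∣ ≤ ∣ p - q ∣
  ∣p∣-∣q∣≤∣p-q∣ p q = begin
    ∣ p ∣ - ∣ q ∣                ≤⟨ ℚ.+-monoˡ-≤ (- ∣ q ∣) (∣p∣≤∣p-q∣+∣q∣ p q) ⟩
    (∣ p - q ∣ + ∣ q ∣) - ∣ q ∣  ≡⟨ cancel ∣ p - q ∣ ∣ q ∣ ⟩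
    ∣ p - q ∣                    ∎
    where open ≤-Reasoning

  ∣∣p∣-∣q∣∣≤∣p-q∣ : ∀ p q → ∣ ∣ p ∣ - ∣ q ∣ ∣ ≤ ∣ p - q ∣
  ∣∣p∣-∣q∣∣≤∣p-q∣ p q with ℚ.∣p∣≡p∨∣p∣≡-p (∣ p ∣ - ∣ q ∣)
  ... | inj₁ eq = subst (_≤ ∣ p - q ∣) (sym eq) (∣p∣-∣q∣≤∣p-q∣ p q)
  ... | inj₂ eq = begin
    ∣ ∣ p ∣ - ∣ q ∣ ∣    ≡⟨ eq ⟩
    - (∣ p ∣ - ∣ q ∣)    ≡⟨ sym (flip-difference ∣ q ∣ ∣ p ∣) ⟩
    ∣ q ∣ - ∣ p ∣        ≤⟨ ∣p∣-∣q∣≤∣p-q∣ q p ⟩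
    ∣ q - p ∣            ≡⟨ ∣p-q∣≡∣q-p∣ q p ⟩
    ∣ p - q ∣            ∎
    where open ≤-Reasoning

  pointwise : ∀ x y → (∀ n → term x n ≡ term y n) → x ≈ℝ y
  agree (pointwise x y eq) k = 0 , λ n _ → begin
    ∣ term x n - term y n ∣  ≡⟨ cong (λ z → ∣ z - term y n ∣) (eq n) ⟩
    ∣ term y n - term y n ∣  ≡⟨ cong ∣_∣ (ℚ.+-inverseʳ (term y n)) ⟩
    0ℚ                       ≤⟨ 0≤2^- k ⟩
    2^- k                    ∎
    where open ≤-Reasoning

  abstract
    constant-cauchy : ∀ q k → ∃[ N ] ∀ m n → N ℕ.≤ m → N ℕ.≤ n →
      ∣ q - q ∣ ≤ 2^- k
    constant-cauchy q k =
      0 , λ _ _ _ _ → begin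
      ∣ q - q ∣  ≡⟨ cong ∣_∣ (ℚ.+-inverseʳ q) ⟩
      0ℚ         ≤⟨ 0≤2^- k ⟩
      2^- k      ∎
      where open ≤-Reasoning

  ratℝ : ℚ → ℝ
  ratℝ q = mkℝ (λ _ → q) (constant-cauchy q)

  0ℝ 1ℝ : ℝ
  0ℝ = ratℝ 0ℚ
  1ℝ = ratℝ 1ℚ

  infix  8 -ℝ_
  infixl 7 _*ℝ_
  infixl 6 _+ℝ_ _-ℝ_

  abstract
    +-cauchy : ∀ x y k → ∃[ N ] ∀ m n → N ℕ.≤ m → N ℕ.≤ n →
      ∣ (term x m + term y m) - (term x n + term y n) ∣ ≤ 2^- k
    +-cauchy x y k =
      let (M , x-close) = cauchy x (suc k)
          (N , y-close) = cauchy y (suc k)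
      in M ⊔ N , λ m n p q →
        subst (λ z → ∣ z ∣ ≤ 2^- k) (sym (sum-difference (term x m) (term y m) (term x n) (term y n)))
          (+-bound k
            (x-close m n (ℕ.m⊔n≤o⇒m≤o M N p) (ℕ.m⊔n≤o⇒m≤o M N q))
            (y-close m n (ℕ.m⊔n≤o⇒n≤o M N p) (ℕ.m⊔n≤o⇒n≤o M N q)))

  _+ℝ_ : ℝ → ℝ → ℝ
  x +ℝ y = mkℝ (λ n → term x n + term y n) (+-cauchy x y)

  abstract
    neg-cauchy : ∀ x k → ∃[ N ] ∀ m n → N ℕ.≤ m → N ℕ.≤ n →
      ∣ (- term x m) - (- term x n) ∣ ≤ 2^- k
    neg-cauchy x k =
      let (N , close) = cauchy x k
      in N , λ m n p q → subst (_≤ 2^- k)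
        (sym (trans (cong ∣_∣ (negation-difference (term x m) (term x n)))
          (ℚ.∣-p∣≡∣p∣ (term x m - term x n))))
        (close m n p q)

  -ℝ_ : ℝ → ℝ
  -ℝ x = mkℝ (λ n → - term x n) (neg-cauchy x)

  _-ℝ_ : ℝ → ℝ → ℝ
  x -ℝ y = x +ℝ (-ℝ y)

  abstract
    *-cauchy : ∀ x y k → ∃[ N ] ∀ m n → N ℕ.≤ m → N ℕ.≤ n →
      ∣ term x m * term y m - term x n * term y n ∣ ≤ 2^- k
    *-cauchy x y k =
      let (r , M₁ , x-small) = eventually-bounded x
          (s , N₁ , y-small) = eventually-bounded y
          (M₂ , x-close)     = cauchy x (s ℕ.+ suc k)
          (N₂ , y-close)     = cauchy y (r ℕ.+ suc k)
      in (M₁ ⊔ N₁) ⊔ (M₂ ⊔ N₂) , λ m n p q →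
        product-bound (term x m) (term y m) (term x n) (term y n) r s k
          (x-small m (ℕ.m⊔n≤o⇒m≤o M₁ N₁ (ℕ.m⊔n≤o⇒m≤o (M₁ ⊔ N₁) (M₂ ⊔ N₂) p)))
          (y-small n (ℕ.m⊔n≤o⇒n≤o M₁ N₁ (ℕ.m⊔n≤o⇒m≤o (M₁ ⊔ N₁) (M₂ ⊔ N₂) q)))
          (y-close m n (ℕ.m⊔n≤o⇒n≤o M₂ N₂ (ℕ.m⊔n≤o⇒n≤o (M₁ ⊔ N₁) (M₂ ⊔ N₂) p))
                       (ℕ.m⊔n≤o⇒n≤o M₂ N₂ (ℕ.m⊔n≤o⇒n≤o (M₁ ⊔ N₁) (M₂ ⊔ N₂) q)))
          (x-close m n (ℕ.m⊔n≤o⇒m≤o M₂ N₂ (ℕ.m⊔n≤o⇒n≤o (M₁ ⊔ N₁) (M₂ ⊔ N₂) p))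
                       (ℕ.m⊔n≤o⇒m≤o M₂ N₂ (ℕ.m⊔n≤o⇒n≤o (M₁ ⊔ N₁) (M₂ ⊔ N₂) q)))

  _*ℝ_ : ℝ → ℝ → ℝ
  x *ℝ y = mkℝ (λ n → term x n * term y n) (*-cauchy x y)

  abstract
    abs-cauchy : ∀ x k → ∃[ N ] ∀ m n → N ℕ.≤ m → N ℕ.≤ n →
      ∣ ∣ term x m ∣ - ∣ term x n ∣ ∣ ≤ 2^- k
    abs-cauchy x k =
      let (N , close) = cauchy x k
      in N , λ m n p q → ℚ.≤-trans (∣∣p∣-∣q∣∣≤∣p-q∣ (term x m) (term x n)) (close m n p q)

  ∣_∣ℝ : ℝ → ℝ
  ∣ x ∣ℝ = mkℝ (λ n → ∣ term x n ∣) (abs-cauchy x)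

  ≈ℝ-refl : ∀ {x} → x ≈ℝ x
  ≈ℝ-refl {x} = pointwise x x (λ _ → refl)

  ≈ℝ-sym : ∀ {x y} → x ≈ℝ y → y ≈ℝ x
  agree (≈ℝ-sym {x} {y} x≈y) k =
    let (N , close) = agree x≈y k
    in N , λ n p → subst (_≤ 2^- k) (∣p-q∣≡∣q-p∣ (term x n) (term y n)) (close n p)

  ≈ℝ-trans : ∀ {x y z} → x ≈ℝ y → y ≈ℝ z → x ≈ℝ z
  agree (≈ℝ-trans {x} {y} {z} x≈y y≈z) k =
    let (M , xy) = agree x≈y (suc k)
        (N , yz) = agree y≈z (suc k)
    in M ⊔ N , λ n p →
      subst (λ w → ∣ w ∣ ≤ 2^- k) (sym (split-difference (term x n) (term y n) (term z n)))
        (+-bound k (xy n (ℕ.m⊔n≤o⇒m≤o M N p)) (yz n (ℕ.m⊔n≤o⇒n≤o M N p)))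

  ≈ℝ-isEquivalence : IsEquivalence _≈ℝ_
  ≈ℝ-isEquivalence = record
    { refl  = ≈ℝ-refl
    ; sym   = ≈ℝ-sym
    ; trans = ≈ℝ-trans
    }

  +ℝ-cong : ∀ {x y u v} → x ≈ℝ y → u ≈ℝ v → x +ℝ u ≈ℝ y +ℝ v
  agree (+ℝ-cong {x} {y} {u} {v} x≈y u≈v) k =
    let (M , xy) = agree x≈y (suc k)
        (N , uv) = agree u≈v (suc k)
    in M ⊔ N , λ n p →
      subst (λ w → ∣ w ∣ ≤ 2^- k) (sym (sum-difference (term x n) (term u n) (term y n) (term v n)))
        (+-bound k (xy n (ℕ.m⊔n≤o⇒m≤o M N p)) (uv n (ℕ.m⊔n≤o⇒n≤o M N p)))

  -ℝ-cong : ∀ {x y} → x ≈ℝ y → -ℝ x ≈ℝ -ℝ y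
  agree (-ℝ-cong {x} {y} x≈y) k =
    let (N , close) = agree x≈y k
    in N , λ n p → subst (_≤ 2^- k)
      (sym (trans (cong ∣_∣ (negation-difference (term x n) (term y n)))
        (ℚ.∣-p∣≡∣p∣ (term x n - term y n))))
      (close n p)

  *ℝ-cong : ∀ {x y u v} → x ≈ℝ y → u ≈ℝ v → x *ℝ u ≈ℝ y *ℝ v
  agree (*ℝ-cong {x} {y} {u} {v} x≈y u≈v) k =
    let (r , M₁ , x-small) = eventually-bounded x
        (s , N₁ , v-small) = eventually-bounded v
        (M₂ , xy)          = agree x≈y (s ℕ.+ suc k)
        (N₂ , uv)          = agree u≈v (r ℕ.+ suc k)
    in (M₁ ⊔ N₁) ⊔ (M₂ ⊔ N₂) , λ n p →
      product-bound (term x n) (term u n) (term y n) (term v n) r s k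
        (x-small n (ℕ.m⊔n≤o⇒m≤o M₁ N₁ (ℕ.m⊔n≤o⇒m≤o (M₁ ⊔ N₁) (M₂ ⊔ N₂) p)))
        (v-small n (ℕ.m⊔n≤o⇒n≤o M₁ N₁ (ℕ.m⊔n≤o⇒m≤o (M₁ ⊔ N₁) (M₂ ⊔ N₂) p)))
        (uv n (ℕ.m⊔n≤o⇒n≤o M₂ N₂ (ℕ.m⊔n≤o⇒n≤o (M₁ ⊔ N₁) (M₂ ⊔ N₂) p)))
        (xy n (ℕ.m⊔n≤o⇒m≤o M₂ N₂ (ℕ.m⊔n≤o⇒n≤o (M₁ ⊔ N₁) (M₂ ⊔ N₂) p)))

  ℝ-isCommutativeRing : IsCommutativeRing _≈ℝ_ _+ℝ_ _*ℝ_ -ℝ_ 0ℝ 1ℝ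
  ℝ-isCommutativeRing = record
    { isRing = record
      { +-isAbelianGroup = record
        { isGroup = record
          { isMonoid = record
            { isSemigroup = record
              { isMagma = record
                { isEquivalence = ≈ℝ-isEquivalence
                ; ∙-cong = +ℝ-cong
                }
              ; assoc = λ x y z → pointwise ((x +ℝ y) +ℝ z) (x +ℝ (y +ℝ z))
                  (λ n → ℚ.+-assoc (term x n) (term y n) (term z n))
              }
            ; identity = (λ x → pointwise (0ℝ +ℝ x) x (λ n → ℚ.+-identityˡ (term x n)))
                       , (λ x → pointwise (x +ℝ 0ℝ) x (λ n → ℚ.+-identityʳ (term x n)))
            }
          ; inverse = (λ x → pointwise ((-ℝ x) +ℝ x) 0ℝ (λ n → ℚ.+-inverseˡ (term x n)))
                    , (λ x → pointwise (x +ℝ (-ℝ x)) 0ℝ (λ n → ℚ.+-inverseʳ (term x n)))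
          ; ⁻¹-cong = -ℝ-cong
          }
        ; comm = λ x y → pointwise (x +ℝ y) (y +ℝ x) (λ n → ℚ.+-comm (term x n) (term y n))
        }
      ; *-cong = *ℝ-cong
      ; *-assoc = λ x y z → pointwise ((x *ℝ y) *ℝ z) (x *ℝ (y *ℝ z))
          (λ n → ℚ.*-assoc (term x n) (term y n) (term z n))
      ; *-identity = (λ x → pointwise (1ℝ *ℝ x) x (λ n → ℚ.*-identityˡ (term x n)))
                   , (λ x → pointwise (x *ℝ 1ℝ) x (λ n → ℚ.*-identityʳ (term x n)))
      ; distrib = (λ x y z → pointwise (x *ℝ (y +ℝ z)) (x *ℝ y +ℝ x *ℝ z)
                    (λ n → ℚ.*-distribˡ-+ (term x n) (term y n) (term z n)))
                , (λ x y z → pointwise ((y +ℝ z) *ℝ x) (y *ℝ x +ℝ z *ℝ x)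
                    (λ n → ℚ.*-distribʳ-+ (term x n) (term y n) (term z n)))
      }
    ; *-comm = λ x y → pointwise (x *ℝ y) (y *ℝ x) (λ n → ℚ.*-comm (term x n) (term y n))
    }

  ℝ-commutativeRing : CommutativeRing 0ℓ 0ℓ
  ℝ-commutativeRing = record { isCommutativeRing = ℝ-isCommutativeRing }

open Reals public
  using (2^-_; ℝ; _≈ℝ_; _≤ℝ_; _<ℝ_; ratℝ; 0ℝ; 1ℝ; _+ℝ_; _*ℝ_; -ℝ_; _-ℝ_; ∣_∣ℝ; ℝ-commutativeRing)

-- The pair (a , b) is a + b i.
ℂ : Set
ℂ = ℝ × ℝ

complexify : CommutativeRing 0ℓ 0ℓ → CommutativeRing 0ℓ 0ℓ
complexify R = record
  { Carrier = K
  ; _≈_     = _≈²_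
  ; _+_     = _+²_
  ; _*_     = _*²_
  ; -_      = λ (a , b) → R.- a , R.- b
  ; 0#      = R.0# , R.0#
  ; 1#      = 1²
  ; isCommutativeRing = record
    { isRing = record
      { +-isAbelianGroup = record
        { isGroup = record
          { isMonoid = record
            { isSemigroup = record
              { isMagma = record
                { isEquivalence = record
                  { refl  = R.refl , R.refl
                  ; sym   = λ (p , q) → R.sym p , R.sym q
                  ; trans = trans²
                  }
                ; ∙-cong = +-cong²
                }
              ; assoc = λ (a , b) (c , d) (e , f) → R.+-assoc a c e , R.+-assoc b d f
              }
            ; identity = (λ (a , b) → R.+-identityˡ a , R.+-identityˡ b)
                       , (λ (a , b) → R.+-identityʳ a , R.+-identityʳ b)
            }
          ; inverse = (λ (a , b) → R.-‿inverseˡ a , R.-‿inverseˡ b)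
                    , (λ (a , b) → R.-‿inverseʳ a , R.-‿inverseʳ b)
          ; ⁻¹-cong = λ (p , q) → R.-‿cong p , R.-‿cong q
          }
        ; comm = λ (a , b) (c , d) → R.+-comm a c , R.+-comm b d
        }
      ; *-cong = λ (p , q) (r , s) →
            R.+-cong (R.*-cong p r) (R.-‿cong (R.*-cong q s))
          , R.+-cong (R.*-cong p s) (R.*-cong q r)
      ; *-assoc = λ (a , b) (c , d) (e , f) → assoc-re a b c d e f , assoc-im a b c d e f
      ; *-identity = *-identityˡ² , λ z → trans² (*-comm² z 1²) (*-identityˡ² z)
      ; distrib = distribˡ² , λ z w v →
          trans² (*-comm² (w +² v) z)
            (trans² (distribˡ² z w v) (+-cong² (*-comm² z w) (*-comm² z v)))
      }
    ; *-comm = *-comm²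
    }
  }
  where
  module R = CommutativeRing R
  open ComplexIdentities R
  K : Set
  K = R.Carrier × R.Carrier
  _≈²_ : K → K → Set
  (a , b) ≈² (c , d) = (a R.≈ c) × (b R.≈ d)
  _+²_ _*²_ : K → K → K
  (a , b) +² (c , d) = (a R.+ c) , (b R.+ d)
  (a , b) *² (c , d) = ((a R.* c) R.- (b R.* d)) , ((a R.* d) R.+ (b R.* c))
  1² : K
  1² = R.1# , R.0#
  trans² : ∀ {z w v} → z ≈² w → w ≈² v → z ≈² v
  trans² (p , q) (r , s) = R.trans p r , R.trans q s
  +-cong² : ∀ {z w u v} → z ≈² w → u ≈² v → (z +² u) ≈² (w +² v)
  +-cong² (p , q) (r , s) = R.+-cong p r , R.+-cong q s
  *-comm² : ∀ z w → (z *² w) ≈² (w *² z)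
  *-comm² (a , b) (c , d) = R.+-cong (R.*-comm a c) (R.-‿cong (R.*-comm b d)) , comm-im a b c d
  *-identityˡ² : ∀ z → (1² *² z) ≈² z
  *-identityˡ² (a , b) = identityˡ-re a b , identityˡ-im a b
  distribˡ² : ∀ z w v → (z *² (w +² v)) ≈² ((z *² w) +² (z *² v))
  distribˡ² (a , b) (c , d) (e , f) = distribˡ-re a b c d e f , distribˡ-im a b c d e f

ℂ-commutativeRing : CommutativeRing 0ℓ 0ℓ
ℂ-commutativeRing = complexify ℝ-commutativeRing

data BaseField : Set where
  real complex : BaseField

scalarRing : BaseField → CommutativeRing 0ℓ 0ℓ
scalarRing real    = ℝ-commutativeRing
scalarRing complex = ℂ-commutativeRing

Scalar : BaseField → Set
Scalar F = CommutativeRing.Carrier (scalarRing F)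

fromℝ : ∀ F → ℝ → Scalar F
fromℝ real    a = a
fromℝ complex a = a , 0ℝ

conj : ∀ F → Scalar F → Scalar F
conj real    a       = a
conj complex (a , b) = a , -ℝ b

modulus² : ∀ F → Scalar F → ℝ
modulus² real    a       = a *ℝ a
modulus² complex (a , b) = a *ℝ a +ℝ b *ℝ b

-- ℚ or ℚ(i).  Rationals are given by fractions, not necessarily in lowest terms.
RationalScalar : BaseField → Set
RationalScalar real    = ℚᵘ
RationalScalar complex = ℚᵘ × ℚᵘ

fromRational : ∀ F → RationalScalar F → Scalar F
fromRational real    q       = ratℝ (fromℚᵘ q)
fromRational complex (q , r) = ratℝ (fromℚᵘ q) , ratℝ (fromℚᵘ r)

record RawNormedSpace (F : BaseField) : Set₁ where
  field
    rawLeftModule : RawLeftModule (Scalar F) 0ℓ 0ℓ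

  open RawLeftModule rawLeftModule public
    using ()
    renaming (Carrierᴹ to Carrier; _≈ᴹ_ to infix 4 _≈_; _+ᴹ_ to infixl 6 _+_;
              0ᴹ to 0#; -ᴹ_ to infix 8 -_; _*ₗ_ to infixr 7 _•_)

  field
    ‖_‖ : Carrier → ℝ

  infixl 6 _-_

  _-_ : Carrier → Carrier → Carrier
  x - y = x + (- y)

  IsCauchy : (ℕ → Carrier) → Set
  IsCauchy s = ∀ k → ∃[ N ] ∀ m n → N ℕ.≤ m → N ℕ.≤ n → ‖ s m - s n ‖ <ℝ ratℝ (2^- k)

  _ConvergesTo_ : (ℕ → Carrier) → Carrier → Set
  s ConvergesTo x = ∀ k → ∃[ N ] ∀ n → N ℕ.≤ n → ‖ s n - x ‖ <ℝ ratℝ (2^- k)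

record IsBanachSpace {F} (V : RawNormedSpace F) : Set where
  open RawNormedSpace V
  field
    isLeftModule  : IsLeftModule (CommutativeRing.ring (scalarRing F)) _≈_ _+_ 0# -_ _•_
    ‖‖-cong       : ∀ {x y} → x ≈ y → ‖ x ‖ ≈ℝ ‖ y ‖
    ‖‖-nonneg     : ∀ x → 0ℝ ≤ℝ ‖ x ‖
    ‖‖-definite   : ∀ x → ‖ x ‖ ≈ℝ 0ℝ → x ≈ 0#
    -- ‖ c x ‖ = ∣ c ∣ ‖ x ‖, squared to avoid the square root in ∣ c ∣
    ‖‖-homogeneous : ∀ c x → ‖ c • x ‖ *ℝ ‖ c • x ‖ ≈ℝ modulus² F c *ℝ (‖ x ‖ *ℝ ‖ x ‖)
    ‖‖-triangle   : ∀ x y → ‖ x + y ‖ ≤ℝ ‖ x ‖ +ℝ ‖ y ‖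
    complete      : ∀ s → IsCauchy s → ∃[ x ] s ConvergesTo x

record HilbertSpace (F : BaseField) : Set₁ where
  private
    module K = CommutativeRing (scalarRing F)

  field
    rawNormedSpace : RawNormedSpace F
    isBanachSpace  : IsBanachSpace rawNormedSpace

  open RawNormedSpace rawNormedSpace public
  open IsBanachSpace isBanachSpace public

  field
    ⟨_,_⟩   : Carrier → Carrier → Scalar F
    ⟨⟩-cong : ∀ {x y u v} → x ≈ y → u ≈ v → ⟨ x , u ⟩ K.≈ ⟨ y , v ⟩
    ⟨⟩-+    : ∀ x y z → ⟨ x + y , z ⟩ K.≈ ⟨ x , z ⟩ K.+ ⟨ y , z ⟩
    ⟨⟩-•    : ∀ c x y → ⟨ c • x , y ⟩ K.≈ c K.* ⟨ x , y ⟩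
    ⟨⟩-conj : ∀ x y → ⟨ y , x ⟩ K.≈ conj F ⟨ x , y ⟩
    ⟨⟩-‖‖   : ∀ x → ⟨ x , x ⟩ K.≈ fromℝ F (‖ x ‖ *ℝ ‖ x ‖)

module _ {F} (H : HilbertSpace F) where
  open HilbertSpace H
  open LeftModuleMorphisms rawLeftModule rawLeftModule

  _IsBoundOf_ : ℝ → (Carrier → Carrier) → Set
  M IsBoundOf T = 0ℝ ≤ℝ M × (∀ v → ‖ T v ‖ ≤ℝ M *ℝ ‖ v ‖)

  record BoundedOperator : Set where
    field
      apply    : Carrier → Carrier
      isLinear : IsLeftModuleHomomorphism apply
      bounded  : ∃[ M ] M IsBoundOf apply

  IsOperatorNorm : ℝ → (Carrier → Carrier) → Set
  IsOperatorNorm M T = M IsBoundOf T × (∀ M′ → M′ IsBoundOf T → M ≤ℝ M′)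

record RawNormedAlgebra (F : BaseField) : Set₁ where
  field
    rawNormedSpace : RawNormedSpace F

  open RawNormedSpace rawNormedSpace public

  infixl 7 _*_

  field
    _*_ : Carrier → Carrier → Carrier

record IsBanachAlgebra {F} (A : RawNormedAlgebra F) : Set where
  open RawNormedAlgebra A
  open AlgebraDefinitions _≈_ using (Congruent₂; Associative; _DistributesOver_)
  field
    isBanachSpace     : IsBanachSpace rawNormedSpace
    *-cong            : Congruent₂ _*_
    *-assoc           : Associative _*_
    distrib           : _*_ DistributesOver _+_
    •-*-assoc         : ∀ c x y → (c • x) * y ≈ c • (x * y)
    *-•-comm          : ∀ c x y → x * (c • y) ≈ c • (x * y)
    ‖‖-submultiplicative : ∀ x y → ‖ x * y ‖ ≤ℝ ‖ x ‖ *ℝ ‖ y ‖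

  open IsBanachSpace isBanachSpace public

record RawStarAlgebra (F : BaseField) : Set₁ where
  field
    rawNormedAlgebra : RawNormedAlgebra F

  open RawNormedAlgebra rawNormedAlgebra public

  infix 9 _⋆

  field
    _⋆ : Carrier → Carrier

record IsBanachStarAlgebra {F} (A : RawStarAlgebra F) : Set where
  open RawStarAlgebra A
  field
    isBanachAlgebra : IsBanachAlgebra rawNormedAlgebra
    ⋆-cong          : ∀ {x y} → x ≈ y → x ⋆ ≈ y ⋆
    ⋆-+             : ∀ x y → (x + y) ⋆ ≈ x ⋆ + y ⋆
    ⋆-•             : ∀ c x → (c • x) ⋆ ≈ conj F c • x ⋆
    ⋆-*             : ∀ x y → (x * y) ⋆ ≈ y ⋆ * x ⋆
    ⋆-involutive    : ∀ x → x ⋆ ⋆ ≈ x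
    ⋆-isometric     : ∀ x → ‖ x ⋆ ‖ ≈ℝ ‖ x ‖

  open IsBanachAlgebra isBanachAlgebra public

-- An isometric *-isomorphism of A onto a norm-closed *-subalgebra of B(H), that
-- is, an isometric *-homomorphism A → B(H) with norm-closed range.
record Representation {F} (A : RawStarAlgebra F) (H : HilbertSpace F) : Set where
  private
    module A = RawStarAlgebra A
    module K = CommutativeRing (scalarRing F)
  open HilbertSpace H
  open BoundedOperator

  field
    operator : A.Carrier → BoundedOperator H

  π : A.Carrier → Carrier → Carrier
  π a = apply (operator a)

  field
    π-cong      : ∀ {a b} → a A.≈ b → ∀ v → π a v ≈ π b v
    π-+         : ∀ a b v → π (a A.+ b) v ≈ π a v + π b v
    π-•         : ∀ c a v → π (c A.• a) v ≈ c • π a v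
    π-*         : ∀ a b v → π (a A.* b) v ≈ π a (π b v)
    π-⋆         : ∀ a v w → ⟨ π a v , w ⟩ K.≈ ⟨ v , π (a A.⋆) w ⟩
    π-isometric : ∀ a → IsOperatorNorm H A.‖ a ‖ (π a)
    π-closed    : ∀ (T : BoundedOperator H) →
      (∀ k → ∃[ a ] _IsBoundOf_ H (ratℝ (2^- k)) (λ v → apply T v - π a v)) →
      ∃[ a ] ∀ v → π a v ≈ apply T v

record IsCStarAlgebra {F} (A : RawStarAlgebra F) : Set₁ where
  field
    isBanachStarAlgebra : IsBanachStarAlgebra A
    hilbertSpace        : HilbertSpace F
    representation      : Representation A hilbertSpace

  open IsBanachStarAlgebra isBanachStarAlgebra public

record CStarAlgebra (F : BaseField) : Set₁ where
  field
    rawStarAlgebra : RawStarAlgebra F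
    isCStarAlgebra : IsCStarAlgebra rawStarAlgebra

  open RawStarAlgebra rawStarAlgebra public
  open IsCStarAlgebra isCStarAlgebra public

IsAbelian : ∀ {F} → CStarAlgebra F → Set
IsAbelian A = ∀ x y → x * y ≈ y * x
  where open CStarAlgebra A

-- Effective procedures are the partial recursive functions on binary trees;
-- finite data are passed to them as trees.
data Tree : Set where
  leaf : Tree
  _∙_  : Tree → Tree → Tree

infixr 5 _∙_

⌜_⌝ℕ : ℕ → Tree
⌜ zero ⌝ℕ  = leaf
⌜ suc n ⌝ℕ = leaf ∙ ⌜ n ⌝ℕ

data Program : Set where
  identity nil left right : Program
  _after_ pair            : Program → Program → Program
  fold                    : Program → Program → Program
  search                  : Program → Program

infix 4 _$_⇓_

data _$_⇓_ : Program → Tree → Tree → Set where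
  identity⇓  : ∀ {t} → identity $ t ⇓ t
  nil⇓       : ∀ {t} → nil $ t ⇓ leaf
  left⇓      : ∀ {t u} → left $ t ∙ u ⇓ t
  right⇓     : ∀ {t u} → right $ t ∙ u ⇓ u
  after⇓     : ∀ {f g t u v} → g $ t ⇓ u → f $ u ⇓ v → f after g $ t ⇓ v
  pair⇓      : ∀ {f g t u v} → f $ t ⇓ u → g $ t ⇓ v → pair f g $ t ⇓ u ∙ v
  fold-leaf⇓ : ∀ {f g p u} → f $ p ⇓ u → fold f g $ leaf ∙ p ⇓ u
  fold-node⇓ : ∀ {f g l r p u v w} →
    fold f g $ l ∙ p ⇓ u → fold f g $ r ∙ p ⇓ v →
    g $ (l ∙ r) ∙ (u ∙ v) ∙ p ⇓ w → fold f g $ (l ∙ r) ∙ p ⇓ w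
  -- unbounded search for the least n that f answers with a leaf
  search⇓    : ∀ {f t n} → f $ ⌜ n ⌝ℕ ∙ t ⇓ leaf →
    (∀ m → m ℕ.< n → ∃[ u ] ∃[ v ] f $ ⌜ m ⌝ℕ ∙ t ⇓ u ∙ v) →
    search f $ t ⇓ ⌜ n ⌝ℕ

⌜_⌝ℤ : ℤ → Tree
⌜ ℤ.+ n ⌝ℤ    = leaf ∙ ⌜ n ⌝ℕ
⌜ -[1+ n ] ⌝ℤ = (leaf ∙ leaf) ∙ ⌜ n ⌝ℕ

⌜_⌝ℚ : ℚᵘ → Tree
⌜ mkℚᵘ n d-1 ⌝ℚ = ⌜ n ⌝ℤ ∙ ⌜ d-1 ⌝ℕ

⌜_⌝scalar : ∀ {F} → RationalScalar F → Tree
⌜_⌝scalar {real}    q       = ⌜ q ⌝ℚ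
⌜_⌝scalar {complex} (q , r) = ⌜ q ⌝ℚ ∙ ⌜ r ⌝ℚ

⌜_⌝bool : Bool → Tree
⌜ false ⌝bool = leaf
⌜ true ⌝bool  = leaf ∙ leaf

⌜_⌝list : List Tree → Tree
⌜ [] ⌝list     = leaf
⌜ t ∷ ts ⌝list = t ∙ ⌜ ts ⌝list

data Length : Set where
  finite   : ℕ → Length
  infinite : Length

Index : Length → Set
Index (finite n) = Fin n
Index infinite   = ℕ

⌜_⌝index : ∀ {ℓ} → Index ℓ → Tree
⌜_⌝index {finite n} i = ⌜ toℕ i ⌝ℕ
⌜_⌝index {infinite} i = ⌜ i ⌝ℕ

record Points (X : Set) : Set where
  constructor points
  field
    length : Length
    point  : Index length → X

  Ix : Set
  Ix = Index length

mapPoints : ∀ {X Y : Set} → (X → Y) → Points X → Points Y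
mapPoints f (points ℓ a) = points ℓ (f ∘ a)

-- A noncommutative polynomial without constant term in the given letters, as a
-- finite sum of scalar multiples of nonempty words.
Polynomial : BaseField → Set → Set
Polynomial F L = List (RationalScalar F × List⁺ L)

-- The letters of the polynomials naming rational points: the special points,
-- and, in the presence of an involution, also their adjoints.
record Letters {F} (A : RawNormedAlgebra F) : Set₁ where
  open RawNormedAlgebra A
  field
    Letter : Set
    value  : Letter → Carrier
    code   : Letter → Tree

  word : List⁺ Letter → Carrier
  word = List⁺.foldr (λ l w → value l * w) value

  ⟦_⟧ : Polynomial F Letter → Carrier
  ⟦_⟧ = List.foldr (λ (c , w) s → fromRational F c • word w + s) 0#

  ⌜_⌝ : Polynomial F Letter → Tree
  ⌜ p ⌝ = ⌜ List.map (λ (c , w) → ⌜_⌝scalar {F} c ∙ ⌜ List.map code (List⁺.toList w) ⌝list) p ⌝list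

module _ {F} {A : RawNormedAlgebra F} (X : Letters A) where
  open RawNormedAlgebra A
  open Letters X

  NormIsComputable : Set
  NormIsComputable = ∃[ e ] ∀ p k → ∃[ q ]
    (e $ ⌜ p ⌝ ∙ ⌜ k ⌝ℕ ⇓ ⌜ q ⌝ℚ) × (∣ ‖ ⟦ p ⟧ ‖ -ℝ ratℝ (fromℚᵘ q) ∣ℝ <ℝ ratℝ (2^- k))

IsComputableMap : ∀ {F} {A B : RawNormedAlgebra F} → Letters A → Letters B →
  (RawNormedAlgebra.Carrier A → RawNormedAlgebra.Carrier B) → Set
IsComputableMap {B = B} X Y φ = ∃[ e ] ∀ p k → ∃[ s ]
  (e $ X.⌜ p ⌝ ∙ ⌜ k ⌝ℕ ⇓ Y.⌜ s ⌝) × (‖ φ X.⟦ p ⟧ - Y.⟦ s ⟧ ‖ <ℝ ratℝ (2^- k))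
  where
  module X = Letters X
  module Y = Letters Y
  open RawNormedAlgebra B

module CStar {F} (A : RawStarAlgebra F) where
  open RawStarAlgebra A

  -- the least norm-closed *-subalgebra containing the special points
  data Generated (a : Points Carrier) : Carrier → Set where
    special : ∀ i → Generated a (Points.point a i)
    zero    : Generated a 0#
    add     : ∀ {x y} → Generated a x → Generated a y → Generated a (x + y)
    scale   : ∀ c {x} → Generated a x → Generated a (c • x)
    mul     : ∀ {x y} → Generated a x → Generated a y → Generated a (x * y)
    star    : ∀ {x} → Generated a x → Generated a (x ⋆)
    limit   : ∀ {x} → (∀ k → ∃[ y ] Generated a y × ‖ y - x ‖ <ℝ ratℝ (2^- k)) → Generated a x

  letters : Points Carrier → Letters rawNormedAlgebra
  letters a = record
    { Letter = Ix × Bool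
    ; value  = λ (i , starred) → if starred then point i ⋆ else point i
    ; code   = λ (i , starred) → ⌜_⌝index {length} i ∙ ⌜ starred ⌝bool
    }
    where open Points a

  record IsComputablePresentation (a : Points Carrier) : Set where
    field
      generates      : ∀ x → Generated a x
      normComputable : NormIsComputable (letters a)

  HasComputablePresentation : Set
  HasComputablePresentation = ∃[ a ] IsComputablePresentation a

  open LeftModuleMorphisms rawLeftModule rawLeftModule

  record IsStarIsomorphism (φ : Carrier → Carrier) : Set where
    field
      isLinear  : IsLeftModuleHomomorphism φ
      *-homo    : ∀ x y → φ (x * y) ≈ φ x * φ y
      ⋆-homo    : ∀ x → φ (x ⋆) ≈ φ x ⋆
      bijective : Bijective _≈_ _≈_ φ

  ComputablyCategorical : Set
  ComputablyCategorical = ∀ a a⁺ → IsComputablePresentation a → IsComputablePresentation a⁺ →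
    ∃[ φ ] IsStarIsomorphism φ × IsComputableMap (letters a) (letters a⁺) φ

module Banach {F} (A : RawNormedAlgebra F) where
  open RawNormedAlgebra A

  -- the least norm-closed subalgebra containing the special points
  data Generated (a : Points Carrier) : Carrier → Set where
    special : ∀ i → Generated a (Points.point a i)
    zero    : Generated a 0#
    add     : ∀ {x y} → Generated a x → Generated a y → Generated a (x + y)
    scale   : ∀ c {x} → Generated a x → Generated a (c • x)
    mul     : ∀ {x y} → Generated a x → Generated a y → Generated a (x * y)
    limit   : ∀ {x} → (∀ k → ∃[ y ] Generated a y × ‖ y - x ‖ <ℝ ratℝ (2^- k)) → Generated a x

  letters : Points Carrier → Letters A
  letters a = record
    { Letter = Ix
    ; value  = point
    ; code   = ⌜_⌝index {length}
    }
    where open Points a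

  record IsComputablePresentation (a : Points Carrier) : Set where
    field
      generates      : ∀ x → Generated a x
      normComputable : NormIsComputable (letters a)

  open LeftModuleMorphisms rawLeftModule rawLeftModule

  record IsIsometricIsomorphism (φ : Carrier → Carrier) : Set where
    field
      isLinear  : IsLeftModuleHomomorphism φ
      *-homo    : ∀ x y → φ (x * y) ≈ φ x * φ y
      isometric : ∀ x → ‖ φ x ‖ ≈ℝ ‖ x ‖
      bijective : Bijective _≈_ _≈_ φ

  ComputablyCategorical : Set
  ComputablyCategorical = ∀ a a⁺ → IsComputablePresentation a → IsComputablePresentation a⁺ →
    ∃[ φ ] IsIsometricIsomorphism φ × IsComputableMap (letters a) (letters a⁺) φ

module SelfAdjoint (B : CStarAlgebra complex) (abelian : IsAbelian B) where
  open CStarAlgebra B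
  private
    module M = IsLeftModule isLeftModule
    module ℝ-ring = CommutativeRing ℝ-commutativeRing
    module ℂ-ring = CommutativeRing ℂ-commutativeRing

  open M using () renaming (≈ᴹ-trans to ≈-trans; ≈ᴹ-sym to ≈-sym; ≈ᴹ-refl to ≈-refl)

  IsSelfAdjoint : Carrier → Set
  IsSelfAdjoint x = x ⋆ ≈ x

  conj-real : ∀ r → conj complex (r , 0ℝ) ℂ-ring.≈ (r , 0ℝ)
  conj-real r = ℝ-ring.refl , RingProperties.-0#≈0# ℝ-ring.ring

  +-selfAdjoint : ∀ {x y} → IsSelfAdjoint x → IsSelfAdjoint y → IsSelfAdjoint (x + y)
  +-selfAdjoint {x} {y} p q = ≈-trans (⋆-+ x y) (M.+ᴹ-cong p q)

  *-selfAdjoint : ∀ {x y} → IsSelfAdjoint x → IsSelfAdjoint y → IsSelfAdjoint (x * y)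
  *-selfAdjoint {x} {y} p q = ≈-trans (⋆-* x y) (≈-trans (*-cong q p) (abelian y x))

  •-selfAdjoint : ∀ r {x} → IsSelfAdjoint x → IsSelfAdjoint ((r , 0ℝ) • x)
  •-selfAdjoint r {x} p = ≈-trans (⋆-• (r , 0ℝ) x) (M.*ₗ-cong (conj-real r) p)

  0-selfAdjoint : IsSelfAdjoint 0#
  0-selfAdjoint =
    ≈-trans (⋆-cong (≈-sym (M.*ₗ-zeroˡ 0#)))
      (≈-trans (⋆-• ℂ-ring.0# 0#)
        (≈-trans (M.*ₗ-cong (conj-real 0ℝ) ≈-refl) (M.*ₗ-zeroˡ (0# ⋆))))

  neg-selfAdjoint : ∀ {x} → IsSelfAdjoint x → IsSelfAdjoint (- x)
  neg-selfAdjoint {x} p =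
    ≈-trans (inverseˡ-unique ((- x) ⋆) (x ⋆)
        (≈-trans (≈-sym (⋆-+ (- x) x)) (≈-trans (⋆-cong (proj₁ M.-ᴹ‿inverse x)) 0-selfAdjoint)))
      (M.-ᴹ‿cong p)
    where
    additiveGroup : Group 0ℓ 0ℓ
    additiveGroup = record { isGroup = M.+ᴹ-isGroup }
    open GroupProperties additiveGroup using (inverseˡ-unique)

  ⋆-selfAdjoint : ∀ {x} → IsSelfAdjoint x → IsSelfAdjoint (x ⋆)
  ⋆-selfAdjoint p = ⋆-cong p

selfAdjointPart : (B : CStarAlgebra complex) → IsAbelian B → RawStarAlgebra real
selfAdjointPart B abelian = record
  { rawNormedAlgebra = record
    { rawNormedSpace = record
      { rawLeftModule = record
        { Carrierᴹ = Σ Carrier IsSelfAdjoint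
        ; _≈ᴹ_     = λ (x , _) (y , _) → x ≈ y
        ; _+ᴹ_     = λ (x , p) (y , q) → x + y , +-selfAdjoint p q
        ; _*ₗ_     = λ r (x , p) → (r , 0ℝ) • x , •-selfAdjoint r p
        ; 0ᴹ       = 0# , 0-selfAdjoint
        ; -ᴹ_      = λ (x , p) → - x , neg-selfAdjoint p
        }
      ; ‖_‖ = λ (x , _) → ‖ x ‖
      }
    ; _*_ = λ (x , p) (y , q) → x * y , *-selfAdjoint p q
    }
  ; _⋆ = λ (x , p) → x ⋆ , ⋆-selfAdjoint p
  }
  where
  open CStarAlgebra B
  open SelfAdjoint B abelian

-- For self-adjoint x and y, x + i y depends on x and y alone: a real polynomial in
-- special points of A is a complex one, and conversely the coefficients of a
-- complex polynomial in self-adjoint commuting points split into real and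
-- imaginary parts.  Hence ‖z‖² = ‖z⋆ z‖ = ‖x² + y²‖ reduces norms in B to norms in
-- A, a presentation of B yields one of A by the real and imaginary parts of its
-- special points, and isomorphisms pass from A to B by complexification and from
-- B to A by restriction.  A is a real C*-algebra on the Hilbert space of B with its
-- scalars restricted.
--
-- Every element of A is self-adjoint, so A has the same presentations as a real
-- Banach algebra.  That a *-isomorphism φ of A is isometric is seen without
-- spectral theory: for ‖x‖ ≤ 1/2 the equation 2 y - y² = x² has a solution y, and
-- ‖v‖² - ‖φ(x) v‖² = ‖v - φ(y) v‖² ≥ 0 for all vectors v.  So ‖φ(x)‖ ≤ 2 ‖x‖ for
-- all x, and ‖x²‖ = ‖x‖² improves the constant 2 to 1.
module Submission where

open import Defs
open import Algebra.Bundles using (AbelianGroup; CommutativeRing)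
open import Algebra.Module.Morphism.Structures using (module LeftModuleMorphisms)
open import Algebra.Module.Structures using (IsLeftModule)
open import Data.Bool.Base using (Bool; true; false; if_then_else_; not; _xor_)
open import Data.Fin.Base as Fin using (Fin; toℕ; combine; remQuot)
open import Data.List.Base as List using (List; []; _∷_; _++_; concatMap; foldr; map)
open import Data.List.NonEmpty.Base as List⁺ using (List⁺; _∷_; _⁺++⁺_)
open import Data.Nat.Base as ℕ using (ℕ; zero; suc)
open import Data.Product.Base using (∃-syntax; _×_; _,_; proj₁; proj₂)
open import Data.Rational.Base as ℚ using (ℚ; 0ℚ; 1ℚ; ½; fromℚᵘ)
open import Data.Rational.Solver using (module +-*-Solver)
open import Data.Rational.Unnormalised.Base as ℚᵘ using (ℚᵘ; mkℚᵘ; 0ℚᵘ; 1ℚᵘ)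
open import Data.Sum.Base using (_⊎_; inj₁; inj₂)
open import Function.Base using (_$_)
open import Function.Bundles using (_⇔_; mk⇔)
open import Function.Definitions using (Bijective)
open import Level using (0ℓ)
open import Relation.Binary.PropositionalEquality using (_≡_; refl; sym; trans; cong; cong₂; subst; subst₂)
import Algebra.Properties.AbelianGroup as AbelianGroupProperties
import Algebra.Properties.CommutativeSemigroup as SemigroupProperties
import Data.Fin.Properties as Fin
import Data.Integer.Properties as ℤ
import Data.Nat.Properties as ℕ
import Data.Rational.Properties as ℚ
import Data.Rational.Unnormalised.Properties as ℚᵘ
import Relation.Binary.Reasoning.Base.Triple as Triple
import Relation.Binary.Reasoning.Setoid as SetoidReasoning

-- The development is constructive, and this shapes it. The order of `ℝ` is undecidable, but `_≤ℝ_`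
-- is stable under double negation, so norms are compared through their squares, and the only
-- reciprocals taken are those of rationals lying just above a norm. The C*-identity is not an
-- axiom: an algebra comes with an isometric representation, and ‖x‖² ≤ ‖x⋆ x‖ is derived from the
-- inner product and the minimality of the operator norm. The radius 1/2 in the isometry argument is
-- chosen so that y ↦ (x² + y²) / 2 maps the ball of that radius into itself and halves distances
-- there; it is the origin of the constant 2. Effective procedures are explicit programs on trees,
-- so each rewriting of polynomials needs a program as well as a proof about values; `Translation`
-- bundles the two. Passing from ‖z⋆ z‖ to ‖z‖ starts from a rational approximation only, so a
-- square root has to be computed, which is done by an integer search on a dyadic grid.

private
  module ℝᵣ = CommutativeRing ℝ-commutativeRing
  module ℂᵣ = CommutativeRing ℂ-commutativeRing

-- Order, absolute value and squares of Cauchy reals.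

module RealOrder where
  open import Data.Empty using (⊥-elim)
  open import Data.Nat.Base using (_⊔_)
  open import Data.Rational.Base using (_+_; _*_; -_; _-_; ∣_∣; _≤_; _<_)
  open import Relation.Binary.Structures using (IsPreorder)
  open import Relation.Nullary using (¬_; yes; no)
  open Reals
  open +-*-Solver using (solve; _:=_; _:+_; _:*_; _:-_; :-_; con)

  Eventually : (ℕ → Set) → Set
  Eventually P = ∃[ N ] ∀ n → N ℕ.≤ n → P n

  eventually : ∀ {P Q : ℕ → Set} → (∀ n → P n → Q n) → Eventually P → Eventually Q
  eventually f (N , p) = N , λ n N≤n → f n (p n N≤n)

  eventually₂ : ∀ {P Q R : ℕ → Set} → (∀ n → P n → Q n → R n) →
    Eventually P → Eventually Q → Eventually R
  eventually₂ f (M , p) (N , q) = M ⊔ N , λ n M⊔N≤n →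
    f n (p n (ℕ.m⊔n≤o⇒m≤o M N M⊔N≤n)) (q n (ℕ.m⊔n≤o⇒n≤o M N M⊔N≤n))

  0<2^- : ∀ k → 0ℚ < 2^- k
  0<2^- zero    = ℚ.positive⁻¹ 1ℚ
  0<2^- (suc k) = subst (_< ½ * 2^- k) (ℚ.*-zeroʳ ½) (ℚ.*-monoʳ-<-pos ½ (0<2^- k))

  2^-suc<2^- : ∀ k → 2^- suc k < 2^- k
  2^-suc<2^- k = begin-strict
    2^- suc k              ≡⟨ ℚ.+-identityʳ (2^- suc k) ⟨
    2^- suc k + 0ℚ         <⟨ ℚ.+-monoʳ-< (2^- suc k) (0<2^- (suc k)) ⟩
    2^- suc k + 2^- suc k  ≡⟨ half+half (2^- k) ⟩
    2^- k                  ∎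
    where open ℚ.≤-Reasoning

  p≤∣p∣ : ∀ p → p ≤ ∣ p ∣
  p≤∣p∣ p with ℚ.≤-total 0ℚ p
  ... | inj₁ 0≤p = ℚ.≤-reflexive (sym (ℚ.0≤p⇒∣p∣≡p 0≤p))
  ... | inj₂ p≤0 = ℚ.≤-trans p≤0 (ℚ.0≤∣p∣ p)

  ≤-from-∣∣ : ∀ p q {ε} → ∣ p - q ∣ ≤ ε → p ≤ q + ε
  ≤-from-∣∣ p q {ε} h = begin
    p              ≡⟨ solve 2 (λ p q → p := q :+ (p :- q)) refl p q ⟩
    q + (p - q)    ≤⟨ ℚ.+-monoʳ-≤ q (ℚ.≤-trans (p≤∣p∣ (p - q)) h) ⟩
    q + ε          ∎
    where open ℚ.≤-Reasoning

  ∣∣-from-≤ : ∀ {p q ε} → p ≤ q + ε → q ≤ p + ε → ∣ p - q ∣ ≤ ε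
  ∣∣-from-≤ {p} {q} {ε} h₁ h₂ with ℚ.∣p∣≡p∨∣p∣≡-p (p - q)
  ... | inj₁ eq = begin
    ∣ p - q ∣      ≡⟨ eq ⟩
    p - q          ≤⟨ ℚ.+-monoˡ-≤ (- q) h₁ ⟩
    (q + ε) - q    ≡⟨ solve 2 (λ q ε → (q :+ ε) :- q := ε) refl q ε ⟩
    ε              ∎
    where open ℚ.≤-Reasoning
  ... | inj₂ eq = begin
    ∣ p - q ∣      ≡⟨ eq ⟩
    - (p - q)      ≡⟨ solve 2 (λ p q → :- (p :- q) := q :- p) refl p q ⟩
    q - p          ≤⟨ ℚ.+-monoˡ-≤ (- p) h₂ ⟩
    (p + ε) - p    ≡⟨ solve 2 (λ q ε → (q :+ ε) :- q := ε) refl p ε ⟩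
    ε              ∎
    where open ℚ.≤-Reasoning

  +halves : ∀ p k → (p + 2^- suc k) + 2^- suc k ≡ p + 2^- k
  +halves p k = trans (ℚ.+-assoc p _ _) (cong (p +_) (half+half (2^- k)))

  pointwise-≤ : ∀ {x y} → (∀ n → term x n ≤ term y n) → x ≤ℝ y
  below (pointwise-≤ {x} {y} h) k = 0 , λ n _ → begin
    term x n          ≤⟨ h n ⟩
    term y n          ≡⟨ ℚ.+-identityʳ _ ⟨
    term y n + 0ℚ     ≤⟨ ℚ.+-monoʳ-≤ (term y n) (0≤2^- k) ⟩
    term y n + 2^- k  ∎
    where open ℚ.≤-Reasoning

  ≈⇒≤ : ∀ {x y} → x ≈ℝ y → x ≤ℝ y
  below (≈⇒≤ {x} {y} h) k = eventually (λ n → ≤-from-∣∣ (term x n) (term y n)) (agree h k)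

  ≤-trans : ∀ {x y z} → x ≤ℝ y → y ≤ℝ z → x ≤ℝ z
  below (≤-trans {x} {y} {z} h₁ h₂) k = eventually₂ step (below h₁ (suc k)) (below h₂ (suc k))
    where
    open ℚ.≤-Reasoning
    step : ∀ n → term x n ≤ term y n + 2^- suc k → term y n ≤ term z n + 2^- suc k → term x n ≤ term z n + 2^- k
    step n p q = begin
      term x n                             ≤⟨ p ⟩
      term y n + 2^- suc k                 ≤⟨ ℚ.+-monoˡ-≤ (2^- suc k) q ⟩
      (term z n + 2^- suc k) + 2^- suc k   ≡⟨ +halves (term z n) k ⟩
      term z n + 2^- k                     ∎

  ≤-antisym : ∀ {x y} → x ≤ℝ y → y ≤ℝ x → x ≈ℝ y
  agree (≤-antisym h₁ h₂) k = eventually₂ (λ n → ∣∣-from-≤) (below h₁ k) (below h₂ k)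

  ≤-isPreorder : IsPreorder _≈ℝ_ _≤ℝ_
  ≤-isPreorder = record
    { isEquivalence = ≈ℝ-isEquivalence
    ; reflexive     = ≈⇒≤
    ; trans         = ≤-trans
    }

  ≤-refl : ∀ {x} → x ≤ℝ x
  ≤-refl = ≈⇒≤ ≈ℝ-refl

  <⇒≤ : ∀ {x y} → x <ℝ y → x ≤ℝ y
  below (<⇒≤ {x} {y} (mk< (j , h))) k = eventually step h
    where
    open ℚ.≤-Reasoning
    step : ∀ n → term x n + 2^- j ≤ term y n → term x n ≤ term y n + 2^- k
    step n p = begin
      term x n            ≡⟨ ℚ.+-identityʳ _ ⟨
      term x n + 0ℚ       ≤⟨ ℚ.+-monoʳ-≤ (term x n) (0≤2^- j) ⟩
      term x n + 2^- j    ≤⟨ p ⟩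
      term y n            ≡⟨ ℚ.+-identityʳ _ ⟨
      term y n + 0ℚ       ≤⟨ ℚ.+-monoʳ-≤ (term y n) (0≤2^- k) ⟩
      term y n + 2^- k    ∎

  +-cancelʳ-≤ : ∀ {p q} r → p + r ≤ q + r → p ≤ q
  +-cancelʳ-≤ {p} {q} r h = subst₂ _≤_ (cancelled p) (cancelled q) (ℚ.+-monoˡ-≤ (- r) h)
    where
    cancelled : ∀ p → (p + r) - r ≡ p
    cancelled p = solve 2 (λ p r → (p :+ r) :- r := p) refl p r

  -- Half of the gap `2^- j` is spent on the error that `_≤ℝ_` allows, and the other half remains as
  -- the new gap.
  <-≤-trans : ∀ {x y z} → x <ℝ y → y ≤ℝ z → x <ℝ z
  <-≤-trans {x} {y} {z} (mk< (j , h₁)) h₂ = mk< $ suc j , eventually₂ step h₁ (below h₂ (suc j))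
    where
    open ℚ.≤-Reasoning
    step : ∀ n → term x n + 2^- j ≤ term y n → term y n ≤ term z n + 2^- suc j →
      term x n + 2^- suc j ≤ term z n
    step n p q = +-cancelʳ-≤ (2^- suc j) $ begin
      (term x n + 2^- suc j) + 2^- suc j   ≡⟨ +halves (term x n) j ⟩
      term x n + 2^- j                     ≤⟨ p ⟩
      term y n                             ≤⟨ q ⟩
      term z n + 2^- suc j                 ∎

  ≤-<-trans : ∀ {x y z} → x ≤ℝ y → y <ℝ z → x <ℝ z
  ≤-<-trans {x} {y} {z} h₁ (mk< (j , h₂)) = mk< $ suc j , eventually₂ step (below h₁ (suc j)) h₂
    where
    open ℚ.≤-Reasoning
    step : ∀ n → term x n ≤ term y n + 2^- suc j → term y n + 2^- j ≤ term z n →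
      term x n + 2^- suc j ≤ term z n
    step n p q = begin
      term x n + 2^- suc j                 ≤⟨ ℚ.+-monoˡ-≤ (2^- suc j) p ⟩
      (term y n + 2^- suc j) + 2^- suc j   ≡⟨ +halves (term y n) j ⟩
      term y n + 2^- j                     ≤⟨ q ⟩
      term z n                             ∎

  <-trans : ∀ {x y z} → x <ℝ y → y <ℝ z → x <ℝ z
  <-trans h₁ h₂ = <-≤-trans h₁ (<⇒≤ h₂)

  <-irrefl : ∀ {x} → ¬ (x <ℝ x)
  <-irrefl {x} (mk< (j , N , h)) = ℚ.<-irrefl refl (ℚ.<-≤-trans (0<2^- j) (+-cancelʳ-≤ (term x N) (begin
    2^- j + term x N     ≡⟨ ℚ.+-comm (2^- j) (term x N) ⟩
    term x N + 2^- j     ≤⟨ h N ℕ.≤-refl ⟩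
    term x N             ≡⟨ ℚ.+-identityˡ (term x N) ⟨
    0ℚ + term x N        ∎)))
    where open ℚ.≤-Reasoning

  ≤⇒≯ : ∀ {x y} → x ≤ℝ y → ¬ (y <ℝ x)
  ≤⇒≯ h₁ h₂ = <-irrefl (≤-<-trans h₁ h₂)

  -- ≤ is stable because the Cauchy moduli let us decide x ≤ y up to 2^-k.
  ≯⇒≤ : ∀ {x y} → ¬ (y <ℝ x) → x ≤ℝ y
  below (≯⇒≤ {x} {y} h) k with cauchy x (suc (suc (suc k))) | cauchy y (suc (suc (suc k)))
  -- Past `M ⊔ N` the terms move by at most an eighth of `2^- k`. With half of `2^- k` as threshold,
  -- a positive answer costs 1/8 + 1/2 + 1/8 ≤ 1 of it, and a negative one leaves the gap 1/2 - 1/8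
  -- - 1/8 = 1/4.
  ... | M , cx | N , cy with term x (M ⊔ N) ℚ.≤? term y (M ⊔ N) + 2^- suc k
  ... | yes p = M ⊔ N , λ n MN≤n → begin
    term x n
      ≤⟨ ≤-from-∣∣ (term x n) (term x (M ⊔ N)) (cx n (M ⊔ N) (ℕ.m⊔n≤o⇒m≤o M N MN≤n) (ℕ.m≤m⊔n M N)) ⟩
    term x (M ⊔ N) + ε                       ≤⟨ ℚ.+-monoˡ-≤ ε p ⟩
    term y (M ⊔ N) + 2^- suc k + ε           ≤⟨ ℚ.+-monoˡ-≤ ε (ℚ.+-monoˡ-≤ (2^- suc k)
                                                  (≤-from-∣∣ (term y (M ⊔ N)) (term y n) (cy (M ⊔ N) n (ℕ.m≤n⊔m M N) (ℕ.m⊔n≤o⇒n≤o M N MN≤n)))) ⟩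
    term y n + ε + 2^- suc k + ε
      ≡⟨ solve 2 (λ y t → y :+ con ½ :* (con ½ :* (con ½ :* t)) :+ con ½ :* t :+ con ½ :* (con ½ :* (con ½ :* t)) :=
           y :+ con ½ :* t :+ con ½ :* (con ½ :* t)) refl (term y n) (2^- k) ⟩
    term y n + 2^- suc k + 2^- suc (suc k)   ≤⟨ ℚ.+-monoʳ-≤ (term y n + 2^- suc k) (ℚ.<⇒≤ (2^-suc<2^- (suc k))) ⟩
    term y n + 2^- suc k + 2^- suc k         ≡⟨ +halves (term y n) k ⟩
    term y n + 2^- k                         ∎
    where
    open ℚ.≤-Reasoning
    ε : ℚ
    ε = 2^- suc (suc (suc k))
  ... | no p = ⊥-elim (h (mk< (suc (suc k) , M ⊔ N , λ n MN≤n → +-cancelʳ-≤ ε (begin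
    term y n + 2^- suc (suc k) + ε           ≤⟨ ℚ.+-monoˡ-≤ ε (ℚ.+-monoˡ-≤ (2^- suc (suc k))
                                                  (≤-from-∣∣ (term y n) (term y (M ⊔ N)) (cy n (M ⊔ N) (ℕ.m⊔n≤o⇒n≤o M N MN≤n) (ℕ.m≤n⊔m M N)))) ⟩
    term y (M ⊔ N) + ε + 2^- suc (suc k) + ε
      ≡⟨ solve 2 (λ y t → y :+ con ½ :* (con ½ :* (con ½ :* t)) :+ con ½ :* (con ½ :* t) :+ con ½ :* (con ½ :* (con ½ :* t)) :=
           y :+ con ½ :* t) refl (term y (M ⊔ N)) (2^- k) ⟩
    term y (M ⊔ N) + 2^- suc k               ≤⟨ ℚ.<⇒≤ (ℚ.≰⇒> p) ⟩
    term x (M ⊔ N)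
      ≤⟨ ≤-from-∣∣ (term x (M ⊔ N)) (term x n) (cx (M ⊔ N) n (ℕ.m≤m⊔n M N) (ℕ.m⊔n≤o⇒m≤o M N MN≤n)) ⟩
    term x n + ε                             ∎))))
    where
    open ℚ.≤-Reasoning
    ε : ℚ
    ε = 2^- suc (suc (suc k))

  +-mono-≤ : ∀ {x y u v} → x ≤ℝ y → u ≤ℝ v → x +ℝ u ≤ℝ y +ℝ v
  below (+-mono-≤ {x} {y} {u} {v} h₁ h₂) k = eventually₂ step (below h₁ (suc k)) (below h₂ (suc k))
    where
    open ℚ.≤-Reasoning
    step : ∀ n → term x n ≤ term y n + 2^- suc k → term u n ≤ term v n + 2^- suc k →
      term x n + term u n ≤ (term y n + term v n) + 2^- k
    step n p q = begin
      term x n + term u n                                ≤⟨ ℚ.+-mono-≤ p q ⟩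
      (term y n + 2^- suc k) + (term v n + 2^- suc k)
        ≡⟨ solve 3 (λ y v t → (y :+ con ½ :* t) :+ (v :+ con ½ :* t) := (y :+ v) :+ t) refl (term y n) (term v n) (2^- k) ⟩
      (term y n + term v n) + 2^- k                      ∎

  *-pos : ∀ {x y} → 0ℝ <ℝ x → 0ℝ <ℝ y → 0ℝ <ℝ x *ℝ y
  *-pos {x} {y} (mk< (i , h₁)) (mk< (j , h₂)) = mk< (i ℕ.+ j , eventually₂ step h₁ h₂)
    where
    open ℚ.≤-Reasoning
    step : ∀ n → 0ℚ + 2^- i ≤ term x n → 0ℚ + 2^- j ≤ term y n → 0ℚ + 2^- (i ℕ.+ j) ≤ term x n * term y n
    step n p q = begin
      0ℚ + 2^- (i ℕ.+ j)      ≡⟨ ℚ.+-identityˡ _ ⟩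
      2^- (i ℕ.+ j)           ≡⟨ 2^-+ i j ⟩
      2^- i * 2^- j
        ≤⟨ ℚ.*-monoʳ-≤-nonNeg (2^- j) {{ℚ.nonNegative (0≤2^- j)}} (subst (_≤ term x n) (ℚ.+-identityˡ (2^- i)) p) ⟩
      term x n * 2^- j
        ≤⟨ ℚ.*-monoˡ-≤-nonNeg (term x n) {{ℚ.nonNegative (ℚ.≤-trans (0≤2^- i) (subst (_≤ term x n) (ℚ.+-identityˡ (2^- i)) p))}}
             (subst (_≤ term y n) (ℚ.+-identityˡ (2^- j)) q) ⟩
      term x n * term y n     ∎

  -- Divisions by a norm, which may vanish, are replaced by divisions by such a q. A term of
  -- precision `2^- suc (suc k)` is raised by `2^- suc k`, so that it clears x strictly.
  rational-above : ∀ x k → ∃[ q ] x <ℝ ratℝ q × ratℝ q ≤ℝ x +ℝ ratℝ (2^- k)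
  rational-above x k with cauchy x (suc (suc k))
  ... | N , cx = term x N + 2^- suc k
    , mk< (suc (suc k) , N , λ n N≤n → begin
        term x n + 2^- suc (suc k)
          ≤⟨ ℚ.+-monoˡ-≤ (2^- suc (suc k)) (≤-from-∣∣ (term x n) (term x N) (cx n N N≤n ℕ.≤-refl)) ⟩
        (term x N + 2^- suc (suc k)) + 2^- suc (suc k)         ≡⟨ +halves (term x N) (suc k) ⟩
        term x N + 2^- suc k                                   ∎)
    , mk≤ (λ j → N , λ n N≤n → begin
        term x N + 2^- suc k
          ≤⟨ ℚ.+-monoˡ-≤ (2^- suc k) (≤-from-∣∣ (term x N) (term x n) (cx N n ℕ.≤-refl N≤n)) ⟩
        (term x n + 2^- suc (suc k)) + 2^- suc k
          ≤⟨ ℚ.+-monoˡ-≤ (2^- suc k) (ℚ.+-monoʳ-≤ (term x n) (ℚ.<⇒≤ (2^-suc<2^- (suc k)))) ⟩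
        (term x n + 2^- suc k) + 2^- suc k                     ≡⟨ +halves (term x n) k ⟩
        term x n + 2^- k                                       ≡⟨ ℚ.+-identityʳ _ ⟨
        term x n + 2^- k + 0ℚ                                  ≤⟨ ℚ.+-monoʳ-≤ (term x n + 2^- k) (0≤2^- j) ⟩
        term x n + 2^- k + 2^- j                               ∎)
    where open ℚ.≤-Reasoning

  ratℝ-cancel-< : ∀ {p q} → ratℝ p <ℝ ratℝ q → p < q
  ratℝ-cancel-< {p} {q} (mk< (k , N , h)) = begin-strict
    p            ≡⟨ ℚ.+-identityʳ p ⟨
    p + 0ℚ       <⟨ ℚ.+-monoʳ-< p (0<2^- k) ⟩
    p + 2^- k    ≤⟨ h N ℕ.≤-refl ⟩
    q            ∎
    where open ℚ.≤-Reasoning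

  module ≤ℝ-Reasoning where
    open Triple {_≈_ = _≈ℝ_} {_≤_ = _≤ℝ_} {_<_ = _<ℝ_}
      ≤-isPreorder (λ h₁ h₂ → <-irrefl (<-trans h₁ h₂)) <-trans
      ((λ h₁ h₂ → <-≤-trans h₂ (≈⇒≤ h₁)) , (λ h₁ h₂ → ≤-<-trans (≈⇒≤ (≈ℝ-sym h₁)) h₂)) <⇒≤ <-≤-trans ≤-<-trans public

  open ≤ℝ-Reasoning

  +-monoʳ-< : ∀ {x y} z → x <ℝ y → z +ℝ x <ℝ z +ℝ y
  +-monoʳ-< {x} {y} z (mk< (j , h)) = mk< $ j , eventually
    (λ n p → ℚ.≤-trans (ℚ.≤-reflexive (ℚ.+-assoc (term z n) (term x n) (2^- j))) (ℚ.+-monoʳ-≤ (term z n) p)) h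

  +-mono-<-≤ : ∀ {x y u v} → x <ℝ y → u ≤ℝ v → x +ℝ u <ℝ y +ℝ v
  +-mono-<-≤ {x} {y} {u} {v} h₁ h₂ = begin-strict
    x +ℝ u   ≈⟨ ℝᵣ.+-comm x u ⟩
    u +ℝ x   <⟨ +-monoʳ-< u h₁ ⟩
    u +ℝ y   ≤⟨ +-mono-≤ h₂ ≤-refl ⟩
    v +ℝ y   ≈⟨ ℝᵣ.+-comm v y ⟩
    y +ℝ v   ∎

  +-mono-< : ∀ {x y u v} → x <ℝ y → u <ℝ v → x +ℝ u <ℝ y +ℝ v
  +-mono-< h₁ h₂ = +-mono-<-≤ h₁ (<⇒≤ h₂)

  +-monoˡ-≤ : ∀ {x y} z → x ≤ℝ y → x +ℝ z ≤ℝ y +ℝ z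
  +-monoˡ-≤ z h = +-mono-≤ h (≤-refl {z})

  +-monoʳ-≤ : ∀ {x y} z → x ≤ℝ y → z +ℝ x ≤ℝ z +ℝ y
  +-monoʳ-≤ z h = +-mono-≤ (≤-refl {z}) h

  -- The operations of `ℝ` act term by term, so a ring identity reduces to the one in ℚ, where the
  -- solver proves it. Most algebra with reals below is done in this way.
  cancel-add : ∀ x z → (x +ℝ z) -ℝ z ≈ℝ x
  cancel-add x z = pointwise _ _ λ n → solve 2 (λ p r → (p :+ r) :- r := p) refl (term x n) (term z n)

  +-cancelʳ-≤ℝ : ∀ {x y} z → x +ℝ z ≤ℝ y +ℝ z → x ≤ℝ y
  +-cancelʳ-≤ℝ {x} {y} z h = begin
    x              ≈⟨ cancel-add x z ⟨
    x +ℝ z -ℝ z    ≤⟨ +-monoˡ-≤ (-ℝ z) h ⟩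
    y +ℝ z -ℝ z    ≈⟨ cancel-add y z ⟩
    y              ∎

  x≤y⇒0≤y-x : ∀ {x y} → x ≤ℝ y → 0ℝ ≤ℝ y -ℝ x
  x≤y⇒0≤y-x {x} {y} h = begin
    0ℝ        ≈⟨ ℝᵣ.-‿inverseʳ x ⟨
    x -ℝ x    ≤⟨ +-monoˡ-≤ (-ℝ x) h ⟩
    y -ℝ x    ∎

  0≤y-x⇒x≤y : ∀ {x y} → 0ℝ ≤ℝ y -ℝ x → x ≤ℝ y
  0≤y-x⇒x≤y {x} {y} h = begin
    x                ≈⟨ ℝᵣ.+-identityˡ x ⟨
    0ℝ +ℝ x          ≤⟨ +-monoˡ-≤ x h ⟩
    (y -ℝ x) +ℝ x    ≈⟨ pointwise _ _ (λ n → solve 2 (λ y x → (y :- x) :+ x := y) refl (term y n) (term x n)) ⟩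
    y                ∎

  x<y⇒0<y-x : ∀ {x y} → x <ℝ y → 0ℝ <ℝ y -ℝ x
  x<y⇒0<y-x {x} {y} h = begin-strict
    0ℝ          ≈⟨ ℝᵣ.-‿inverseˡ x ⟨
    -ℝ x +ℝ x   <⟨ +-monoʳ-< (-ℝ x) h ⟩
    -ℝ x +ℝ y   ≈⟨ ℝᵣ.+-comm (-ℝ x) y ⟩
    y -ℝ x      ∎

  0<y-x⇒x<y : ∀ {x y} → 0ℝ <ℝ y -ℝ x → x <ℝ y
  0<y-x⇒x<y {x} {y} h = begin-strict
    x                ≈⟨ ℝᵣ.+-identityʳ x ⟨
    x +ℝ 0ℝ          <⟨ +-monoʳ-< x h ⟩
    x +ℝ (y -ℝ x)    ≈⟨ pointwise _ _ (λ n → solve 2 (λ y x → x :+ (y :- x) := y) refl (term y n) (term x n)) ⟩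
    y                ∎

  x≤∣x∣ : ∀ x → x ≤ℝ ∣ x ∣ℝ
  x≤∣x∣ x = pointwise-≤ λ n → p≤∣p∣ (term x n)

  ∣∣-cong : ∀ {x y} → x ≈ℝ y → ∣ x ∣ℝ ≈ℝ ∣ y ∣ℝ
  agree (∣∣-cong {x} {y} h) k = eventually (λ n → ℚ.≤-trans (∣∣p∣-∣q∣∣≤∣p-q∣ (term x n) (term y n))) (agree h k)

  ∣-x∣≈∣x∣ : ∀ x → ∣ -ℝ x ∣ℝ ≈ℝ ∣ x ∣ℝ
  ∣-x∣≈∣x∣ x = pointwise _ _ λ n → ℚ.∣-p∣≡∣p∣ (term x n)

  -x≤∣x∣ : ∀ x → -ℝ x ≤ℝ ∣ x ∣ℝ
  -x≤∣x∣ x = begin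
    -ℝ x         ≤⟨ x≤∣x∣ (-ℝ x) ⟩
    ∣ -ℝ x ∣ℝ    ≈⟨ ∣-x∣≈∣x∣ x ⟩
    ∣ x ∣ℝ       ∎

  ∣∣-≤ : ∀ {x y} → x ≤ℝ y → -ℝ x ≤ℝ y → ∣ x ∣ℝ ≤ℝ y
  below (∣∣-≤ {x} {y} h₁ h₂) k = eventually₂ step (below h₁ k) (below h₂ k)
    where
    step : ∀ n → term x n ≤ term y n + 2^- k → - term x n ≤ term y n + 2^- k → ∣ term x n ∣ ≤ term y n + 2^- k
    step n p q with ℚ.∣p∣≡p∨∣p∣≡-p (term x n)
    ... | inj₁ eq = subst (_≤ term y n + 2^- k) (sym eq) p
    ... | inj₂ eq = subst (_≤ term y n + 2^- k) (sym eq) q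

  0≤x⇒∣x∣≈x : ∀ {x} → 0ℝ ≤ℝ x → ∣ x ∣ℝ ≈ℝ x
  0≤x⇒∣x∣≈x {x} h = ≤-antisym (∣∣-≤ ≤-refl (begin
    -ℝ x          ≈⟨ ℝᵣ.+-identityʳ (-ℝ x) ⟨
    -ℝ x +ℝ 0ℝ    ≤⟨ +-monoʳ-≤ (-ℝ x) h ⟩
    -ℝ x +ℝ x     ≈⟨ ℝᵣ.-‿inverseˡ x ⟩
    0ℝ            ≤⟨ h ⟩
    x             ∎)) (x≤∣x∣ x)

  +-nonneg : ∀ {x y} → 0ℝ ≤ℝ x → 0ℝ ≤ℝ y → 0ℝ ≤ℝ x +ℝ y
  +-nonneg {x} {y} p q = begin
    0ℝ          ≈⟨ ℝᵣ.+-identityʳ 0ℝ ⟨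
    0ℝ +ℝ 0ℝ    ≤⟨ +-mono-≤ p q ⟩
    x +ℝ y      ∎

  -- The terms of a nonnegative real may be negative. Replacing both factors by their absolute
  -- values makes the product nonnegative in every term.
  *-nonneg : ∀ {x y} → 0ℝ ≤ℝ x → 0ℝ ≤ℝ y → 0ℝ ≤ℝ x *ℝ y
  *-nonneg {x} {y} h₁ h₂ = begin
    0ℝ
      ≤⟨ pointwise-≤ (λ n → subst (0ℚ ≤_) (ℚ.∣p*q∣≡∣p∣*∣q∣ (term x n) (term y n)) (ℚ.0≤∣p∣ (term x n * term y n))) ⟩
    ∣ x ∣ℝ *ℝ ∣ y ∣ℝ    ≈⟨ *ℝ-cong (0≤x⇒∣x∣≈x h₁) (0≤x⇒∣x∣≈x h₂) ⟩
    x *ℝ y              ∎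

  *-monoˡ-≤ : ∀ {x y} c → 0ℝ ≤ℝ c → x ≤ℝ y → c *ℝ x ≤ℝ c *ℝ y
  *-monoˡ-≤ {x} {y} c 0≤c h = 0≤y-x⇒x≤y (begin
    0ℝ                   ≤⟨ *-nonneg 0≤c (x≤y⇒0≤y-x h) ⟩
    c *ℝ (y -ℝ x)
      ≈⟨ pointwise _ _ (λ n → solve 3 (λ c y x → c :* (y :- x) := c :* y :- c :* x) refl (term c n) (term y n) (term x n)) ⟩
    c *ℝ y -ℝ c *ℝ x     ∎)

  *-monoʳ-≤ : ∀ {x y} c → 0ℝ ≤ℝ c → x ≤ℝ y → x *ℝ c ≤ℝ y *ℝ c
  *-monoʳ-≤ {x} {y} c 0≤c h = begin
    x *ℝ c    ≈⟨ ℝᵣ.*-comm x c ⟩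
    c *ℝ x    ≤⟨ *-monoˡ-≤ c 0≤c h ⟩
    c *ℝ y    ≈⟨ ℝᵣ.*-comm c y ⟩
    y *ℝ c    ∎

  *-mono-≤ : ∀ {x y u v} → 0ℝ ≤ℝ u → 0ℝ ≤ℝ y → x ≤ℝ y → u ≤ℝ v → x *ℝ u ≤ℝ y *ℝ v
  *-mono-≤ {x} {y} {u} {v} 0≤u 0≤y h₁ h₂ = ≤-trans (*-monoʳ-≤ u 0≤u h₁) (*-monoˡ-≤ y 0≤y h₂)

  0≤x² : ∀ x → 0ℝ ≤ℝ x *ℝ x
  0≤x² x = pointwise-≤ λ n → le (term x n)
    where
    le : ∀ p → 0ℚ ≤ p * p
    le p with ℚ.∣p∣≡p∨∣p∣≡-p p
    ... | inj₁ eq = subst (0ℚ ≤_) (trans (ℚ.∣p*q∣≡∣p∣*∣q∣ p p) (cong (λ z → z * z) eq)) (ℚ.0≤∣p∣ (p * p))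
    ... | inj₂ eq = subst (0ℚ ≤_) (trans (ℚ.∣p*q∣≡∣p∣*∣q∣ p p) (trans (cong (λ z → z * z) eq) (solve 1 (λ p → (:- p) :* (:- p) :=
         p :* p) refl p))) (ℚ.0≤∣p∣ (p * p))

  square-mono-< : ∀ {x y} → 0ℝ ≤ℝ x → x <ℝ y → x *ℝ x <ℝ y *ℝ y
  square-mono-< {x} {y} 0≤x h = 0<y-x⇒x<y (begin-strict
    0ℝ                          <⟨ *-pos (x<y⇒0<y-x h) 0<y+x ⟩
    (y -ℝ x) *ℝ (y +ℝ x)
      ≈⟨ pointwise _ _ (λ n → solve 2 (λ y x → (y :- x) :* (y :+ x) := y :* y :- x :* x) refl (term y n) (term x n)) ⟩
    y *ℝ y -ℝ x *ℝ x            ∎)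
    where
    0<y+x : 0ℝ <ℝ y +ℝ x
    0<y+x = begin-strict
      0ℝ          ≈⟨ ℝᵣ.+-identityʳ 0ℝ ⟨
      0ℝ +ℝ 0ℝ    <⟨ +-mono-<-≤ (≤-<-trans 0≤x h) 0≤x ⟩
      y +ℝ x      ∎

  -- Squaring is strictly monotone, so y < x is absurd, and stability of `_≤ℝ_` turns this into the
  -- inequality. It stands in for taking square roots of reals.
  square-cancel-≤ : ∀ {x y} → 0ℝ ≤ℝ y → x *ℝ x ≤ℝ y *ℝ y → x ≤ℝ y
  square-cancel-≤ 0≤y h = ≯⇒≤ (λ y<x → ≤⇒≯ h (square-mono-< 0≤y y<x))

  square-injective : ∀ {x y} → 0ℝ ≤ℝ x → 0ℝ ≤ℝ y → x *ℝ x ≈ℝ y *ℝ y → x ≈ℝ y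
  square-injective 0≤x 0≤y h = ≤-antisym (square-cancel-≤ 0≤y (≈⇒≤ h)) (square-cancel-≤ 0≤x (≈⇒≤ (≈ℝ-sym h)))

  ratℝ-mono-≤ : ∀ {p q} → p ≤ q → ratℝ p ≤ℝ ratℝ q
  ratℝ-mono-≤ h = pointwise-≤ (λ _ → h)

  ratℝ-cong : ∀ {p q} → p ≡ q → ratℝ p ≈ℝ ratℝ q
  ratℝ-cong refl = ≈ℝ-refl

  0≤1 : 0ℝ ≤ℝ 1ℝ
  0≤1 = ratℝ-mono-≤ (ℚ.nonNegative⁻¹ 1ℚ)

  0≤½ : 0ℝ ≤ℝ ratℝ ½
  0≤½ = ratℝ-mono-≤ (ℚ.nonNegative⁻¹ ½)

  2^-pos : ∀ k → 0ℝ <ℝ ratℝ (2^- k)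
  2^-pos k = mk< (k , 0 , λ _ _ → ℚ.≤-reflexive (ℚ.+-identityˡ (2^- k)))

  2^-nonneg : ∀ k → 0ℝ ≤ℝ ratℝ (2^- k)
  2^-nonneg k = <⇒≤ (2^-pos k)

  2^-suc<ℝ : ∀ k → ratℝ (2^- suc k) <ℝ ratℝ (2^- k)
  2^-suc<ℝ k = mk< (suc k , 0 , λ _ _ → ℚ.≤-reflexive (half+half (2^- k)))

  2^-halves : ∀ k → ratℝ (2^- suc k) +ℝ ratℝ (2^- suc k) ≈ℝ ratℝ (2^- k)
  2^-halves k = pointwise _ _ λ _ → half+half (2^- k)

  +-bound-< : ∀ {x y} k → x <ℝ ratℝ (2^- suc k) → y <ℝ ratℝ (2^- suc k) → x +ℝ y <ℝ ratℝ (2^- k)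
  +-bound-< k h₁ h₂ = <-≤-trans (+-mono-< h₁ h₂) (≈⇒≤ (2^-halves k))

  ≤-from-2^- : ∀ {x y} → (∀ k → x ≤ℝ y +ℝ ratℝ (2^- k)) → x ≤ℝ y
  below (≤-from-2^- {x} {y} h) k = eventually
    (λ n p → ℚ.≤-trans p (ℚ.≤-reflexive (+halves (term y n) k))) (below (h (suc k)) (suc k))

  ≤0-from-2^- : ∀ {x} → (∀ k → x ≤ℝ ratℝ (2^- k)) → x ≤ℝ 0ℝ
  ≤0-from-2^- {x} h = ≤-from-2^- λ k → ≤-trans (h k) (≈⇒≤ (≈ℝ-sym (ℝᵣ.+-identityˡ (ratℝ (2^- k)))))

  -- A real is eventually bounded by some 2^b, which the additional factor `2^- b` absorbs. This
  -- gives a rate to errors that are proportional to a fixed norm.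
  null-multiples : ∀ x → ∃[ b ] ∀ k → ratℝ (2^- (b ℕ.+ k)) *ℝ x ≤ℝ ratℝ (2^- k)
  null-multiples x = let (b , N , small) = eventually-bounded x in b , λ k → begin
    ratℝ (2^- (b ℕ.+ k)) *ℝ x
      ≤⟨ *-monoˡ-≤ (ratℝ (2^- (b ℕ.+ k))) (2^-nonneg (b ℕ.+ k)) (x≤∣x∣ x) ⟩
    ratℝ (2^- (b ℕ.+ k)) *ℝ ∣ x ∣ℝ              ≈⟨ pointwise _ _
                                                     (λ n → trans (cong (_* ∣ term x n ∣) (2^-+ b k))
                                                       (solve 3 (λ b k x → (b :* k) :* x := k :* (x :* b)) refl (2^- b) (2^- k) ∣ term x n ∣)) ⟩
    ratℝ (2^- k) *ℝ (∣ x ∣ℝ *ℝ ratℝ (2^- b))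
      ≤⟨ *-monoˡ-≤ (ratℝ (2^- k)) (2^-nonneg k) (mk≤ λ j → N , λ n N≤n → ℚ.≤-trans (small n N≤n)
         (subst (_≤ 1ℚ + 2^- j) (ℚ.+-identityʳ 1ℚ) (ℚ.+-monoʳ-≤ 1ℚ (0≤2^- j)))) ⟩
    ratℝ (2^- k) *ℝ 1ℝ                          ≈⟨ ℝᵣ.*-identityʳ (ratℝ (2^- k)) ⟩
    ratℝ (2^- k)                                ∎

-- Total programs for arithmetic and lists.

module ComputableFunctions where
  open import Data.Integer.Base as ℤ using (ℤ; -[1+_])
  open import Data.Nat.Base using (pred; _+_; _*_; _∸_)
  open import Data.Sign.Base as Sign using (Sign)
  Total : Program → Set
  Total e = ∀ t → ∃[ u ] e $ t ⇓ u

  -- Programs are required to halt on trees that are no codes as well, since fold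
  -- also descends into the codes of the entries of a list.
  record Computable {X Y : Set} (a : X → Tree) (b : Y → Tree) (f : X → Y) : Set where
    field
      program : Program
      total   : Total program
      correct : ∀ x → program $ a x ⇓ b (f x)

  open Computable

  -- `left` and `right` diverge on a leaf. Here `fold` serves as a case distinction: it answers a
  -- leaf with a leaf and at a node ignores its recursive results, so the projections become total.
  first second : Program
  first  = fold nil (left after left) after pair identity nil
  second = fold nil (right after left) after pair identity nil

  private
    variable
      X Y Z Γ : Set
      a b c γ : X → Tree

    first⇓ : ∀ {l r} → first $ l ∙ r ⇓ l
    second⇓ : ∀ {l r} → second $ l ∙ r ⇓ r

    projection⇓ : ∀ {e} → (∀ {l r} {u : Tree} → e $ (l ∙ r) ∙ u ⇓ l) → ∀ t → ∃[ u ] fold nil e $ t ∙ leaf ⇓ u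
    projection⇓ h leaf    = leaf , fold-leaf⇓ nil⇓
    projection⇓ h (l ∙ r) = l , fold-node⇓ (proj₂ (projection⇓ h l)) (proj₂ (projection⇓ h r)) h

    projection⇓′ : ∀ {e} → (∀ {l r} {u : Tree} → e $ (l ∙ r) ∙ u ⇓ r) → ∀ t → ∃[ u ] fold nil e $ t ∙ leaf ⇓ u
    projection⇓′ h leaf    = leaf , fold-leaf⇓ nil⇓
    projection⇓′ h (l ∙ r) = r , fold-node⇓ (proj₂ (projection⇓′ h l)) (proj₂ (projection⇓′ h r)) h

    first⇓ {l} {r} = after⇓ (pair⇓ identity⇓ nil⇓) (proj₂ (projection⇓ (after⇓ left⇓ left⇓) (l ∙ r)))
    second⇓ {l} {r} = after⇓ (pair⇓ identity⇓ nil⇓) (proj₂ (projection⇓′ (after⇓ left⇓ right⇓) (l ∙ r)))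

    first-total : Total first
    first-total t = let (u , h) = projection⇓ (after⇓ left⇓ left⇓) t in u , after⇓ (pair⇓ identity⇓ nil⇓) h

    second-total : Total second
    second-total t = let (u , h) = projection⇓′ (after⇓ left⇓ right⇓) t in u , after⇓ (pair⇓ identity⇓ nil⇓) h

    fold-total : ∀ {f g} → Total f → Total g → ∀ t p → ∃[ u ] fold f g $ t ∙ p ⇓ u
    fold-total F G leaf    p = let (u , h) = F p in u , fold-leaf⇓ h
    fold-total F G (l ∙ r) p =
      let (u , h) = fold-total F G l p
          (v , k) = fold-total F G r p
          (w , m) = G ((l ∙ r) ∙ (u ∙ v) ∙ p)
      in w , fold-node⇓ h k m

    after-total : ∀ {f g} → Total f → Total g → Total (f after g)
    after-total F G t = let (u , h) = G t ; (v , k) = F u in v , after⇓ h k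

    pair-total : ∀ {f g} → Total f → Total g → Total (pair f g)
    pair-total F G t = let (u , h) = F t ; (v , k) = G t in u ∙ v , pair⇓ h k

  infixr 4 _⊗_
  _⊗_ : (X → Tree) → (Y → Tree) → X × Y → Tree
  (a ⊗ b) (x , y) = a x ∙ b y

  ⌜List⌝ : (X → Tree) → List X → Tree
  ⌜List⌝ a xs = ⌜ map a xs ⌝list

  cast : {f g : X → Y} → (∀ x → f x ≡ g x) → Computable a b f → Computable a b g
  cast {a = a} {b = b} eq F = record
    { program = program F
    ; total   = total F
    ; correct = λ x → subst (λ y → program F $ a x ⇓ b y) (eq x) (correct F x)
    }

  -- Programs see only codes, so a change of representation that leaves the codes of arguments and
  -- values alone keeps the program.
  recode : {f : X → Y} {f′ : Z → Γ} (a : X → Tree) (b : Y → Tree) (c : Z → Tree) (d : Γ → Tree) (g : Z → X) →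
    (∀ z → a (g z) ≡ c z) → (∀ z → b (f (g z)) ≡ d (f′ z)) → Computable a b f → Computable c d f′
  recode a b c d g p q F = record
    { program = program F
    ; total   = total F
    ; correct = λ z → subst₂ (program F $_⇓_) (p z) (q z) (correct F (g z))
    }

  id-computable : Computable a a (λ x → x)
  id-computable = record
    { program = identity
    ; total   = λ t → t , identity⇓
    ; correct = λ _ → identity⇓
    }

  infixr 9 _∘ᶜ_
  _∘ᶜ_ : {g : Y → Z} {f : X → Y} → Computable b c g → Computable a b f → Computable a c (λ x → g (f x))
  _∘ᶜ_ {f = f} G F = record
    { program = program G after program F
    ; total   = after-total (total G) (total F)
    ; correct = λ x → after⇓ (correct F x) (correct G (f x))
    }

  infixr 4 _,ᶜ_
  _,ᶜ_ : {f : Γ → X} {g : Γ → Y} → Computable γ a f → Computable γ b g → Computable γ (a ⊗ b) (λ x → f x , g x)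
  F ,ᶜ G = record
    { program = pair (program F) (program G)
    ; total   = pair-total (total F) (total G)
    ; correct = λ x → pair⇓ (correct F x) (correct G x)
    }

  fst : {f : Γ → X × Y} → Computable γ (a ⊗ b) f → Computable γ a (λ x → proj₁ (f x))
  fst F = record
    { program = first after program F
    ; total   = after-total first-total (total F)
    ; correct = λ x → after⇓ (correct F x) first⇓
    }

  snd : {f : Γ → X × Y} → Computable γ (a ⊗ b) f → Computable γ b (λ x → proj₂ (f x))
  snd F = record
    { program = second after program F
    ; total   = after-total second-total (total F)
    ; correct = λ x → after⇓ (correct F x) second⇓
    }

  const-computable : (y : Y) → Computable γ b (λ _ → y)
  const-computable {b = b} y = record
    { program = constant (b y)
    ; total   = λ t → b y , constant⇓ (b y)
    ; correct = λ _ → constant⇓ (b y)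
    }
    where
    constant : Tree → Program
    constant leaf    = nil
    constant (l ∙ r) = pair (constant l) (constant r)
    constant⇓ : ∀ u {t} → constant u $ t ⇓ u
    constant⇓ leaf    = nil⇓
    constant⇓ (l ∙ r) = pair⇓ (constant⇓ l) (constant⇓ r)

  private
    -- `fold` hands its step both subtrees, both results and the parameter. For a numeral the right
    -- subtree is the predecessor and the right result its value. For a list the left subtree is the
    -- head and the right result belongs to the tail.
    predecessor-arguments head-arguments : Program
    predecessor-arguments = pair (right after left) (pair (right after (left after right)) (right after right))
    head-arguments        = pair (left after left) (pair (right after (left after right)) (right after right))

    predecessor-arguments⇓ : ∀ {l r u v p} → predecessor-arguments $ (l ∙ r) ∙ (u ∙ v) ∙ p ⇓ r ∙ v ∙ p
    predecessor-arguments⇓ = pair⇓ (after⇓ left⇓ right⇓)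
      (pair⇓ (after⇓ (after⇓ right⇓ left⇓) right⇓) (after⇓ right⇓ right⇓))

    head-arguments⇓ : ∀ {l r u v p} → head-arguments $ (l ∙ r) ∙ (u ∙ v) ∙ p ⇓ l ∙ v ∙ p
    head-arguments⇓ = pair⇓ (after⇓ left⇓ left⇓)
      (pair⇓ (after⇓ (after⇓ right⇓ left⇓) right⇓) (after⇓ right⇓ right⇓))

    -- The selector e is built from the partial `left` and `right`, but a step of `fold` always
    -- receives an argument of the displayed shape, so halting there is enough.
    fold-arguments-total : ∀ {f g e} → (∀ {l r u v p} → ∃[ w ] e $ (l ∙ r) ∙ (u ∙ v) ∙ p ⇓ w) →
      Total f → Total g → ∀ t p → ∃[ u ] fold f (g after e) $ t ∙ p ⇓ u
    fold-arguments-total E F G leaf    p = let (u , h) = F p in u , fold-leaf⇓ h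
    fold-arguments-total E F G (l ∙ r) p =
      let (u , h) = fold-arguments-total E F G l p
          (v , k) = fold-arguments-total E F G r p
          (w , m) = E {l} {r} {u} {v} {p}
          (z , n) = G w
      in z , fold-node⇓ h k (after⇓ m n)

  natrec : Y → (ℕ → Y → Y) → ℕ → Y
  natrec z s zero    = z
  natrec z s (suc n) = s n (natrec z s n)

  natrec-computable : {z : Γ → Y} {s : ℕ × Y × Γ → Y} {n : Γ → ℕ} →
    Computable γ ⌜_⌝ℕ n → Computable γ b z → Computable (⌜_⌝ℕ ⊗ b ⊗ γ) b s →
    Computable γ b (λ x → natrec (z x) (λ m y → s (m , y , x)) (n x))
  natrec-computable {γ = γ} {b = b} {z = z} {s} {n} N F S = record
    { program = fold (program F) (program S after predecessor-arguments) after pair (program N) identity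
    ; total   = λ t →
        let (m , h) = total N t
            (u , k) = fold-arguments-total (_ , predecessor-arguments⇓) (total F) (total S) m t
        in u , after⇓ (pair⇓ h identity⇓) k
    ; correct = λ x → after⇓ (pair⇓ (correct N x) identity⇓) (iterate x (n x))
    }
    where
    iterate : ∀ x m → fold (program F) (program S after predecessor-arguments) $ ⌜ m ⌝ℕ ∙ γ x
      ⇓ b (natrec (z x) (λ m y → s (m , y , x)) m)
    iterate x zero    = fold-leaf⇓ (correct F x)
    iterate x (suc m) = fold-node⇓ (fold-leaf⇓ (correct F x)) (iterate x m)
      (after⇓ predecessor-arguments⇓ (correct S _))

  foldr-computable : {z : Γ → Y} {s : X × Y × Γ → Y} {xs : Γ → List X} →
    Computable γ (⌜List⌝ a) xs → Computable γ b z → Computable (a ⊗ b ⊗ γ) b s →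
    Computable γ b (λ x → foldr (λ m y → s (m , y , x)) (z x) (xs x))
  foldr-computable {γ = γ} {a = a} {b = b} {z = z} {s} {xs} N F S = record
    { program = fold (program F) (program S after head-arguments) after pair (program N) identity
    ; total   = λ t →
        let (m , h) = total N t
            (u , k) = fold-arguments-total (_ , head-arguments⇓) (total F) (total S) m t
        in u , after⇓ (pair⇓ h identity⇓) k
    ; correct = λ x → after⇓ (pair⇓ (correct N x) identity⇓) (iterate x (xs x))
    }
    where
    iterate : ∀ x ys → fold (program F) (program S after head-arguments) $ ⌜List⌝ a ys ∙ γ x
      ⇓ b (foldr (λ m y → s (m , y , x)) (z x) ys)
    iterate x []       = fold-leaf⇓ (correct F x)
    iterate x (y ∷ ys) = fold-node⇓
      -- The recursion also enters the code of the head, of which nothing is known; totality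
      -- supplies some result, which `head-arguments` drops.
      (proj₂ (fold-arguments-total (_ , head-arguments⇓) (total F) (total S) (a y) (γ x)))
      (iterate x ys)
      (after⇓ head-arguments⇓ (correct S _))

  -- The code of `true` is a node and that of `false` a leaf, so a fold over it branches. For `true`
  -- the program of g runs on the two leaves as well and its results are discarded, which is
  -- harmless since it halts.
  if-computable : {p : Γ → Bool} {f g : Γ → Y} →
    Computable γ ⌜_⌝bool p → Computable γ b f → Computable γ b g →
    Computable γ b (λ x → if p x then f x else g x)
  if-computable {γ = γ} {b = b} {p = p} {f} {g} P F G = record
    { program = fold (program G) (program F after (second after second)) after pair (program P) identity
    ; total   = λ t →
        let (m , h) = total P t
            (u , k) = fold-total (total G) (after-total (total F) (after-total second-total second-total)) m t
        in u , after⇓ (pair⇓ h identity⇓) k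
    ; correct = λ x → after⇓ (pair⇓ (correct P x) identity⇓) (cases x (p x))
    }
    where
    cases : ∀ x q → fold (program G) (program F after (second after second)) $ ⌜ q ⌝bool ∙ γ x
      ⇓ b (if q then f x else g x)
    cases x false = fold-leaf⇓ (correct G x)
    cases x true  = fold-node⇓ (fold-leaf⇓ (correct G x)) (fold-leaf⇓ (correct G x))
      (after⇓ (after⇓ second⇓ second⇓) (correct F x))

  suc-computable : {n : Γ → ℕ} → Computable γ ⌜_⌝ℕ n → Computable γ ⌜_⌝ℕ (λ x → suc (n x))
  suc-computable N = record
    { program = pair nil (program N)
    ; total   = pair-total (λ _ → leaf , nil⇓) (total N)
    ; correct = λ x → pair⇓ nil⇓ (correct N x)
    }

  var₀ : Computable (a ⊗ γ) a proj₁
  var₀ = fst id-computable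

  var₁ : Computable (a ⊗ b ⊗ γ) b (λ x → proj₁ (proj₂ x))
  var₁ = fst (snd id-computable)

  var₂ : Computable (a ⊗ b ⊗ γ) γ (λ x → proj₂ (proj₂ x))
  var₂ = snd (snd id-computable)

  module _ {m n : Γ → ℕ} (M : Computable γ ⌜_⌝ℕ m) (N : Computable γ ⌜_⌝ℕ n) where

    +-computable : Computable γ ⌜_⌝ℕ (λ x → m x + n x)
    +-computable = cast (λ x → eq (m x) (n x)) (natrec-computable M N (suc-computable var₁))
      where
      eq : ∀ m n → natrec n (λ _ → suc) m ≡ m + n
      eq zero    n = refl
      eq (suc m) n = cong suc (eq m n)

    ∸-computable : Computable γ ⌜_⌝ℕ (λ x → m x ∸ n x)
    ∸-computable = cast (λ x → eq (m x) (n x)) (natrec-computable N M (pred-computable var₁))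
      where
      pred-computable : {k : X → ℕ} → Computable a ⌜_⌝ℕ k → Computable a ⌜_⌝ℕ (λ x → pred (k x))
      pred-computable {k = k} K = cast (λ x → eq (k x)) (natrec-computable K (const-computable 0) var₀)
        where
        eq : ∀ n → natrec 0 (λ m _ → m) n ≡ pred n
        eq zero    = refl
        eq (suc n) = refl
      eq : ∀ m n → natrec m (λ _ → pred) n ≡ m ∸ n
      eq m zero    = refl
      eq m (suc n) = trans (cong pred (eq m n)) (ℕ.pred[m∸n]≡m∸[1+n] m n)

  *-computable : {m n : Γ → ℕ} → Computable γ ⌜_⌝ℕ m → Computable γ ⌜_⌝ℕ n → Computable γ ⌜_⌝ℕ (λ x → m x * n x)
  *-computable {m = m} {n} M N = cast (λ x → eq (m x) (n x))
    (natrec-computable M (const-computable 0) (+-computable (N ∘ᶜ var₂) var₁))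
    where
    eq : ∀ m n → natrec 0 (λ _ k → n + k) m ≡ m * n
    eq zero    n = refl
    eq (suc m) n = cong (n +_) (eq m n)

  not-computable : {p : Γ → Bool} → Computable γ ⌜_⌝bool p → Computable γ ⌜_⌝bool (λ x → not (p x))
  not-computable {p = p} P = cast (λ x → eq (p x)) (if-computable P (const-computable false) (const-computable true))
    where
    eq : ∀ p → (if p then false else true) ≡ not p
    eq false = refl
    eq true  = refl

  xor-computable : {p q : Γ → Bool} → Computable γ ⌜_⌝bool p → Computable γ ⌜_⌝bool q → Computable γ ⌜_⌝bool (λ x → p x xor q x)
  xor-computable {p = p} {q} P Q = cast (λ x → eq (p x) (q x)) (if-computable P (not-computable Q) Q)
    where
    eq : ∀ p q → (if p then not q else q) ≡ p xor q
    eq false q = refl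
    eq true  q = refl

  isZero : ℕ → Bool
  isZero zero    = true
  isZero (suc _) = false

  isZero-computable : {n : Γ → ℕ} → Computable γ ⌜_⌝ℕ n → Computable γ ⌜_⌝bool (λ x → isZero (n x))
  isZero-computable {n = n} N = cast (λ x → eq (n x)) (natrec-computable N (const-computable true) (const-computable false))
    where
    eq : ∀ n → natrec true (λ _ _ → false) n ≡ isZero n
    eq zero    = refl
    eq (suc n) = refl

  isNegative : ℤ → Bool
  isNegative (ℤ.+ _)  = false
  isNegative -[1+ _ ] = true

  -- The number stored in the code of an integer, which for a negative one is the absolute value
  -- less one.
  magnitude : ℤ → ℕ
  magnitude (ℤ.+ n)  = n
  magnitude -[1+ n ] = n

  uncode : Bool × ℕ → ℤ
  uncode (false , n) = ℤ.+ n
  uncode (true  , n) = -[1+ n ]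

  uncode-computable : {u : Γ → Bool × ℕ} → Computable γ (⌜_⌝bool ⊗ ⌜_⌝ℕ) u → Computable γ ⌜_⌝ℤ (λ x → uncode (u x))
  uncode-computable {u = u} U = recode _ _ _ _ (λ x → x) (λ _ → refl) (λ x → eq (u x)) U
    where
    eq : ∀ u → (⌜_⌝bool ⊗ ⌜_⌝ℕ) u ≡ ⌜ uncode u ⌝ℤ
    eq (false , n) = refl
    eq (true  , n) = refl

  components-computable : {i : Γ → ℤ} → Computable γ ⌜_⌝ℤ i →
    Computable γ (⌜_⌝bool ⊗ ⌜_⌝ℕ) (λ x → isNegative (i x) , magnitude (i x))
  components-computable {i = i} I = recode _ _ _ _ (λ x → x) (λ _ → refl) (λ x → eq (i x)) I
    where
    eq : ∀ i → ⌜ i ⌝ℤ ≡ ⌜ isNegative i ⌝bool ∙ ⌜ magnitude i ⌝ℕ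
    eq (ℤ.+ n)  = refl
    eq -[1+ n ] = refl

  signed : Bool → ℕ → ℤ
  signed p n = if p then ℤ.- (ℤ.+ n) else ℤ.+ n

  signed-computable : {p : Γ → Bool} {n : Γ → ℕ} → Computable γ ⌜_⌝bool p → Computable γ ⌜_⌝ℕ n →
    Computable γ ⌜_⌝ℤ (λ x → signed (p x) (n x))
  signed-computable {n = n} P N = if-computable P
    (cast (λ x → eq (n x)) (natrec-computable N (const-computable (ℤ.+ 0)) (uncode-computable (const-computable true ,ᶜ var₀))))
    (uncode-computable (const-computable false ,ᶜ N))
    where
    eq : ∀ n → natrec (ℤ.+ 0) (λ m _ → -[1+ m ]) n ≡ ℤ.- (ℤ.+ n)
    eq zero    = refl
    eq (suc n) = refl

  ∣∣-computable : {i : Γ → ℤ} → Computable γ ⌜_⌝ℤ i → Computable γ ⌜_⌝ℕ (λ x → ℤ.∣ i x ∣)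
  ∣∣-computable {i = i} I = cast (λ x → eq (i x))
    (if-computable (fst (components-computable I)) (suc-computable (snd (components-computable I))) (snd (components-computable I)))
    where
    eq : ∀ i → (if isNegative i then suc (magnitude i) else magnitude i) ≡ ℤ.∣ i ∣
    eq (ℤ.+ n)  = refl
    eq -[1+ n ] = refl

  negℤ-computable : {i : Γ → ℤ} → Computable γ ⌜_⌝ℤ i → Computable γ ⌜_⌝ℤ (λ x → ℤ.- i x)
  negℤ-computable {i = i} I = cast (λ x → eq (i x))
    (signed-computable (not-computable (fst (components-computable I))) (∣∣-computable I))
    where
    eq : ∀ i → signed (not (isNegative i)) ℤ.∣ i ∣ ≡ ℤ.- i
    eq (ℤ.+ n)  = refl
    eq -[1+ n ] = refl

  *ℤ-computable : {i j : Γ → ℤ} → Computable γ ⌜_⌝ℤ i → Computable γ ⌜_⌝ℤ j → Computable γ ⌜_⌝ℤ (λ x → i x ℤ.* j x)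
  *ℤ-computable {i = i} {j} I J = cast (λ x → eq (i x) (j x))
    (signed-computable (xor-computable (fst (components-computable I)) (fst (components-computable J)))
      (*-computable (∣∣-computable I) (∣∣-computable J)))
    where
    +◃ : ∀ n → ℤ.+ n ≡ Sign.+ ℤ.◃ n
    +◃ zero    = refl
    +◃ (suc n) = refl
    -◃ : ∀ n → ℤ.- (ℤ.+ n) ≡ Sign.- ℤ.◃ n
    -◃ zero    = refl
    -◃ (suc n) = refl
    eq : ∀ i j → signed (isNegative i xor isNegative j) (ℤ.∣ i ∣ * ℤ.∣ j ∣) ≡ i ℤ.* j
    eq (ℤ.+ m)  (ℤ.+ n)  = +◃ (m * n)
    eq (ℤ.+ m)  -[1+ n ] = -◃ (m * suc n)
    eq -[1+ m ] (ℤ.+ n)  = -◃ (suc m * n)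
    eq -[1+ m ] -[1+ n ] = +◃ (suc m * suc n)

  fraction-computable : {i : Γ → ℤ} {d : Γ → ℕ} → Computable γ ⌜_⌝ℤ i → Computable γ ⌜_⌝ℕ d →
    Computable γ ⌜_⌝ℚ (λ x → mkℚᵘ (i x) (d x))
  fraction-computable I D = recode _ _ _ _ (λ x → x) (λ _ → refl) (λ _ → refl) (I ,ᶜ D)

  module _ {q : Γ → ℚᵘ} (Q : Computable γ ⌜_⌝ℚ q) where

    private
      parts : Computable γ (⌜_⌝ℤ ⊗ ⌜_⌝ℕ) (λ x → ℚᵘ.numerator (q x) , ℚᵘ.denominator-1 (q x))
      parts = recode _ _ _ _ (λ x → x) (λ _ → refl) (λ x → eq (q x)) Q
        where
        eq : ∀ q → ⌜ q ⌝ℚ ≡ ⌜ ℚᵘ.numerator q ⌝ℤ ∙ ⌜ ℚᵘ.denominator-1 q ⌝ℕ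
        eq (mkℚᵘ i d) = refl

    numerator-computable : Computable γ ⌜_⌝ℤ (λ x → ℚᵘ.numerator (q x))
    numerator-computable = fst parts

    denominator-1-computable : Computable γ ⌜_⌝ℕ (λ x → ℚᵘ.denominator-1 (q x))
    denominator-1-computable = snd parts

  negℚ-computable : {q : Γ → ℚᵘ} → Computable γ ⌜_⌝ℚ q → Computable γ ⌜_⌝ℚ (λ x → ℚᵘ.- q x)
  negℚ-computable {q = q} Q = cast (λ x → eq (q x)) (fraction-computable (negℤ-computable (numerator-computable Q)) (denominator-1-computable Q))
    where
    eq : ∀ q → mkℚᵘ (ℤ.- ℚᵘ.numerator q) (ℚᵘ.denominator-1 q) ≡ ℚᵘ.- q
    eq (mkℚᵘ i d) = refl

  *ℚ-computable : {p q : Γ → ℚᵘ} → Computable γ ⌜_⌝ℚ p → Computable γ ⌜_⌝ℚ q → Computable γ ⌜_⌝ℚ (λ x → p x ℚᵘ.* q x)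
  *ℚ-computable {p = p} {q} P Q = cast (λ x → eq (p x) (q x)) (fraction-computable
    (*ℤ-computable (numerator-computable P) (numerator-computable Q))
    -- Denominators are stored less one, and (1 + d) (1 + e) - 1 unfolds to e + d (1 + e).
    (+-computable (denominator-1-computable Q)
      (*-computable (denominator-1-computable P) (suc-computable (denominator-1-computable Q)))))
    where
    eq : ∀ p q → mkℚᵘ (ℚᵘ.numerator p ℤ.* ℚᵘ.numerator q)
        (ℚᵘ.denominator-1 q + ℚᵘ.denominator-1 p * suc (ℚᵘ.denominator-1 q)) ≡ p ℚᵘ.* q
    eq (mkℚᵘ i d) (mkℚᵘ j e) = refl

  module _ {x : Γ → X} {xs : Γ → List X} where

    ∷-computable : Computable γ a x → Computable γ (⌜List⌝ a) xs → Computable γ (⌜List⌝ a) (λ c → x c ∷ xs c)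
    ∷-computable H T = recode _ _ _ _ (λ x → x) (λ _ → refl) (λ _ → refl) (H ,ᶜ T)

  ++-computable : {xs ys : Γ → List X} → Computable γ (⌜List⌝ a) xs → Computable γ (⌜List⌝ a) ys →
    Computable γ (⌜List⌝ a) (λ c → xs c ++ ys c)
  ++-computable {xs = xs} {ys} H T = cast (λ c → eq (xs c) (ys c)) (foldr-computable H T (∷-computable var₀ var₁))
    where
    eq : ∀ (xs ys : List X) → foldr _∷_ ys xs ≡ xs ++ ys
    eq []       ys = refl
    eq (x ∷ xs) ys = cong (x ∷_) (eq xs ys)

  map-computable : {f : X × Γ → Y} {xs : Γ → List X} → Computable (a ⊗ γ) b f → Computable γ (⌜List⌝ a) xs →
    Computable γ (⌜List⌝ b) (λ c → map (λ x → f (x , c)) (xs c))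
  map-computable {f = f} {xs} F H = cast (λ c → eq c (xs c))
    (foldr-computable H (const-computable []) (∷-computable (F ∘ᶜ (var₀ ,ᶜ var₂)) var₁))
    where
    eq : ∀ c xs → foldr (λ x ys → f (x , c) ∷ ys) [] xs ≡ map (λ x → f (x , c)) xs
    eq c []       = refl
    eq c (x ∷ xs) = cong (f (x , c) ∷_) (eq c xs)

  concatMap-computable : {f : X × Γ → List Y} {xs : Γ → List X} → Computable (a ⊗ γ) (⌜List⌝ b) f → Computable γ (⌜List⌝ a) xs →
    Computable γ (⌜List⌝ b) (λ c → concatMap (λ x → f (x , c)) (xs c))
  concatMap-computable {f = f} {xs} F H = cast (λ c → eq c (xs c))
    (foldr-computable H (const-computable []) (++-computable (F ∘ᶜ (var₀ ,ᶜ var₂)) var₁))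
    where
    eq : ∀ c xs → foldr (λ x ys → f (x , c) ++ ys) [] xs ≡ concatMap (λ x → f (x , c)) xs
    eq c []       = refl
    eq c (x ∷ xs) = cong (f (x , c) ++_) (eq c xs)

-- Computing square roots from rational approximations.

module ApproximateRoots where
  open RealOrder
  open ComputableFunctions
  open import Data.Integer.Base as ℤ using (ℤ; -[1+_]; +_)
  open import Data.Nat.Base using (_+_; _*_; _∸_; _≤_)
  open Reals using (pointwise; term; 2^-+)

  private
    variable
      Γ : Set
      γ : Γ → Tree

  fromℚᵘ-homo-* : ∀ p q → fromℚᵘ (p ℚᵘ.* q) ≡ fromℚᵘ p ℚ.* fromℚᵘ q
  fromℚᵘ-homo-* p q = ℚ.toℚᵘ-injective (begin
    ℚ.toℚᵘ (fromℚᵘ (p ℚᵘ.* q))                         ≈⟨ ℚ.toℚᵘ-fromℚᵘ (p ℚᵘ.* q) ⟩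
    p ℚᵘ.* q                                           ≈⟨ ℚᵘ.*-cong (ℚ.toℚᵘ-fromℚᵘ p) (ℚ.toℚᵘ-fromℚᵘ q) ⟨
    ℚ.toℚᵘ (fromℚᵘ p) ℚᵘ.* ℚ.toℚᵘ (fromℚᵘ q)           ≈⟨ ℚ.toℚᵘ-homo-* (fromℚᵘ p) (fromℚᵘ q) ⟨
    ℚ.toℚᵘ (fromℚᵘ p ℚ.* fromℚᵘ q)                     ∎)
    where open import Relation.Binary.Reasoning.Setoid ℚᵘ.≃-setoid

  fromℚᵘ-homo-+ : ∀ p q → fromℚᵘ (p ℚᵘ.+ q) ≡ fromℚᵘ p ℚ.+ fromℚᵘ q
  fromℚᵘ-homo-+ p q = ℚ.toℚᵘ-injective (begin
    ℚ.toℚᵘ (fromℚᵘ (p ℚᵘ.+ q))                         ≈⟨ ℚ.toℚᵘ-fromℚᵘ (p ℚᵘ.+ q) ⟩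
    p ℚᵘ.+ q                                           ≈⟨ ℚᵘ.+-cong (ℚ.toℚᵘ-fromℚᵘ p) (ℚ.toℚᵘ-fromℚᵘ q) ⟨
    ℚ.toℚᵘ (fromℚᵘ p) ℚᵘ.+ ℚ.toℚᵘ (fromℚᵘ q)           ≈⟨ ℚ.toℚᵘ-homo-+ (fromℚᵘ p) (fromℚᵘ q) ⟨
    ℚ.toℚᵘ (fromℚᵘ p ℚ.+ fromℚᵘ q)                     ∎)
    where open import Relation.Binary.Reasoning.Setoid ℚᵘ.≃-setoid

  fromℚᵘ-homo-neg : ∀ p → fromℚᵘ (ℚᵘ.- p) ≡ ℚ.- fromℚᵘ p
  fromℚᵘ-homo-neg p = ℚ.toℚᵘ-injective (begin
    ℚ.toℚᵘ (fromℚᵘ (ℚᵘ.- p))     ≈⟨ ℚ.toℚᵘ-fromℚᵘ (ℚᵘ.- p) ⟩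
    ℚᵘ.- p                       ≈⟨ ℚᵘ.-‿cong (ℚ.toℚᵘ-fromℚᵘ p) ⟨
    ℚᵘ.- ℚ.toℚᵘ (fromℚᵘ p)       ≈⟨ ℚ.toℚᵘ-homo‿- (fromℚᵘ p) ⟨
    ℚ.toℚᵘ (ℚ.- fromℚᵘ p)        ∎)
    where open import Relation.Binary.Reasoning.Setoid ℚᵘ.≃-setoid

  fromℚᵘ-mono : ∀ {p q} → p ℚᵘ.≤ q → fromℚᵘ p ℚ.≤ fromℚᵘ q
  fromℚᵘ-mono {p} {q} h = ℚ.toℚᵘ-cancel-≤
    (ℚᵘ.≤-respʳ-≃ (ℚᵘ.≃-sym (ℚ.toℚᵘ-fromℚᵘ q)) (ℚᵘ.≤-respˡ-≃ (ℚᵘ.≃-sym (ℚ.toℚᵘ-fromℚᵘ p)) h))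

  -- 2^K is the successor of pow-1 K
  pow-1 : ℕ → ℕ
  pow-1 zero    = 0
  pow-1 (suc k) = pow-1 k + suc (pow-1 k)

  pow-1-computable : {k : Γ → ℕ} → Computable γ ⌜_⌝ℕ k → Computable γ ⌜_⌝ℕ (λ x → pow-1 (k x))
  pow-1-computable {k = k} K = cast (λ x → eq (k x))
    (natrec-computable K (const-computable 0) (+-computable var₁ (suc-computable var₁)))
    where
    eq : ∀ k → natrec 0 (λ _ n → n + suc n) k ≡ pow-1 k
    eq zero    = refl
    eq (suc k) = cong (λ n → n + suc n) (eq k)

  dyadic : ℕ → ℕ → ℚ
  dyadic K n = fromℚᵘ (mkℚᵘ (+ n) (pow-1 K))

  unit : ∀ K → dyadic K 1 ≡ 2^- K
  unit zero    = refl
  unit (suc K) = trans (cong (λ n → fromℚᵘ (mkℚᵘ (+ 1) (pow-1 K + n))) (sym (ℕ.+-identityʳ (suc (pow-1 K)))))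
    (trans (fromℚᵘ-homo-* (mkℚᵘ (+ 1) 1) (mkℚᵘ (+ 1) (pow-1 K))) (cong (½ ℚ.*_) (unit K)))

  dyadic-suc : ∀ K n → dyadic K (suc n) ≡ dyadic K n ℚ.+ 2^- K
  dyadic-suc K n = trans (ℚ.fromℚᵘ-cong (ℚᵘ.≃-sym sum))
    (trans (fromℚᵘ-homo-+ (mkℚᵘ (+ n) P) (mkℚᵘ (+ 1) P)) (cong (dyadic K n ℚ.+_) (unit K)))
    where
    P T : ℕ
    P = pow-1 K
    T = suc P
    sum : mkℚᵘ (+ n) P ℚᵘ.+ mkℚᵘ (+ 1) P ℚᵘ.≃ mkℚᵘ (+ suc n) P
    sum = ℚᵘ.*≡* (begin
      (+ n ℤ.* + T ℤ.+ + 1 ℤ.* + T) ℤ.* + T   ≡⟨ cong (ℤ._* + T) (ℤ.*-distribʳ-+ (+ T) (+ n) (+ 1)) ⟨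
      ((+ n ℤ.+ + 1) ℤ.* + T) ℤ.* + T         ≡⟨ cong (λ z → (z ℤ.* + T) ℤ.* + T) (ℤ.+-comm (+ n) (+ 1)) ⟩
      (+ suc n ℤ.* + T) ℤ.* + T               ≡⟨ ℤ.*-assoc (+ suc n) (+ T) (+ T) ⟩
      + suc n ℤ.* (+ T ℤ.* + T)               ≡⟨ cong (+ suc n ℤ.*_) (ℤ.pos-* T T) ⟨
      + suc n ℤ.* + (T * T)                   ∎)
      where open Relation.Binary.PropositionalEquality.≡-Reasoning

  dyadic-zero : ∀ K → dyadic K 0 ≡ ℚ.0ℚ
  dyadic-zero K = ℚ.fromℚᵘ-cong {mkℚᵘ (+ 0) (pow-1 K)} {mkℚᵘ (+ 0) 0} (ℚᵘ.*≡* refl)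

  nonnegative-part : ℤ → ℕ
  nonnegative-part i = if isNegative i then 0 else magnitude i

  -- the least n with a ≤ n² d
  root : ℕ → ℕ → ℕ
  root a d = natrec 0 (λ _ n → if isZero (a ∸ n * n * d) then n else suc n) a

  module _ (a d-1 : ℕ) where

    private
      d : ℕ
      d = suc d-1

      candidate : ℕ → ℕ
      candidate = natrec 0 (λ _ n → if isZero (a ∸ n * n * d) then n else suc n)

      Found : ℕ → Set
      Found n = a ≤ n * n * d

      isFound : ∀ n → isZero (a ∸ n * n * d) ≡ true → Found n
      isFound n eq with a ∸ n * n * d in e
      ... | zero = ℕ.m∸n≡0⇒m≤n e

      notFound : ∀ n → isZero (a ∸ n * n * d) ≡ false → n * n * d ≤ a
      notFound n eq with a ∸ n * n * d in e
      ... | suc m = ℕ.<⇒≤ (ℕ.m∸n≢0⇒n<m (λ e′ → 1≢0 (trans (sym e) e′)))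
        where
        1≢0 : suc m ≡ 0 → _
        1≢0 ()

      -- As long as no solution is found, every step increments the candidate, so it equals the
      -- number m of steps. A nonzero candidate arose from a rejected predecessor l, whence the
      -- upper bound on `l * l * d`.
      Invariant : ℕ → ℕ → Set
      Invariant m n = (Found n ⊎ n ≡ m) × (n ≡ 0 ⊎ ∃[ l ] n ≡ suc l × l * l * d ≤ a)

      invariant : ∀ m → Invariant m (candidate m)
      invariant zero = inj₂ refl , inj₁ refl
      invariant (suc m) with isZero (a ∸ candidate m * candidate m * d) in eq | invariant m
      ... | true  | _ , low = inj₁ (isFound (candidate m) eq) , low
      ... | false | inj₁ found , low = inj₁ (found′ found) , inj₂ (candidate m , refl , notFound (candidate m) eq)
        where
        found′ : Found (candidate m) → Found (suc (candidate m))
        found′ f = ℕ.≤-trans f (ℕ.*-monoˡ-≤ d (ℕ.*-mono-≤ (ℕ.n≤1+n (candidate m)) (ℕ.n≤1+n (candidate m))))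
      ... | false | inj₂ e , low = inj₂ (cong suc e) , inj₂ (candidate m , refl , notFound (candidate m) eq)

    -- The search makes a steps. If it never meets a solution, it ends at the candidate a, which is
    -- one because d is at least 1.
    root-above : a ≤ root a d * root a d * d
    root-above with invariant a
    ... | inj₁ found , _ = found
    ... | inj₂ e     , _ = subst (λ n → a ≤ n * n * d) (sym e) (square a)
      where
      square : ∀ a → a ≤ a * a * d
      square zero    = ℕ.z≤n
      square (suc a) = ℕ.≤-trans (ℕ.m≤m*n (suc a) (suc a)) (ℕ.m≤m*n (suc a * suc a) d)

    root-below : root a d ≡ 0 ⊎ ∃[ l ] root a d ≡ suc l × l * l * d ≤ a
    root-below = proj₂ (invariant a)

  -- For q = a / d, the square of n / 2^K is at least q exactly when a 4^K ≤ n² d. Approximations to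
  -- the square of a norm may be negative; these are treated as 0.
  root-numerator : ℕ → ℚᵘ → ℕ
  root-numerator K q = root (nonnegative-part (ℚᵘ.numerator q) * (suc (pow-1 K) * suc (pow-1 K))) (suc (ℚᵘ.denominator-1 q))

  approximate-root : ℕ → ℚᵘ → ℚᵘ
  approximate-root K q = mkℚᵘ (+ root-numerator K q) (pow-1 K)

  approximate-root-computable : {K : Γ → ℕ} {q : Γ → ℚᵘ} → Computable γ ⌜_⌝ℕ K → Computable γ ⌜_⌝ℚ q →
    Computable γ ⌜_⌝ℚ (λ x → approximate-root (K x) (q x))
  approximate-root-computable {γ = γ} {K = k} {q} K Q =
    fraction-computable (uncode-computable (const-computable false ,ᶜ root-computable
        (*-computable
          (if-computable (fst (components-computable (numerator-computable Q))) (const-computable 0)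
            (snd (components-computable (numerator-computable Q))))
          (*-computable (suc-computable (pow-1-computable K)) (suc-computable (pow-1-computable K))))
        (suc-computable (denominator-1-computable Q))))
      (pow-1-computable K)
    where
    root-computable : {a d : _ → ℕ} → Computable γ ⌜_⌝ℕ a → Computable γ ⌜_⌝ℕ d → Computable γ ⌜_⌝ℕ (λ x → root (a x) (d x))
    root-computable A D = natrec-computable A (const-computable 0)
      (if-computable (isZero-computable (∸-computable (A ∘ᶜ var₂) (*-computable (*-computable var₁ var₁) (D ∘ᶜ var₂))))
        var₁ (suc-computable var₁))

  module _ (K : ℕ) (q : ℚᵘ) where

    private
      T n : ℕ
      T = suc (pow-1 K)
      n = root-numerator K q

      y : ℕ → ℚᵘ
      y m = mkℚᵘ (+ m) (pow-1 K)

      ≤square : ∀ q m → nonnegative-part (ℚᵘ.numerator q) * (T * T) ≤ m * m * suc (ℚᵘ.denominator-1 q) →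
        q ℚᵘ.≤ y m ℚᵘ.* y m
      ≤square (mkℚᵘ (+ a) d) m h = ℚᵘ.*≤* (begin
        + a ℤ.* + (T * T)        ≡⟨ ℤ.pos-* a (T * T) ⟨
        + (a * (T * T))          ≤⟨ ℤ.+≤+ h ⟩
        + (m * m * suc d)        ≡⟨ ℤ.pos-* (m * m) (suc d) ⟩
        + (m * m) ℤ.* + suc d    ≡⟨ cong (ℤ._* + suc d) (ℤ.pos-* m m) ⟩
        + m ℤ.* + m ℤ.* + suc d  ∎)
        where open ℤ.≤-Reasoning
      ≤square (mkℚᵘ -[1+ a ] d) m h = ℚᵘ.*≤* (begin
        -[1+ a ] ℤ.* + (T * T)   ≤⟨ ℤ.-≤+ ⟩
        + (m * m * suc d)        ≡⟨ ℤ.pos-* (m * m) (suc d) ⟩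
        + (m * m) ℤ.* + suc d    ≡⟨ cong (ℤ._* + suc d) (ℤ.pos-* m m) ⟩
        + m ℤ.* + m ℤ.* + suc d  ∎)
        where open ℤ.≤-Reasoning

      -- The second alternative is for negative q: its numerator is cut off at 0, and this forces m
      -- to vanish.
      square≤ : ∀ q m → m * m * suc (ℚᵘ.denominator-1 q) ≤ nonnegative-part (ℚᵘ.numerator q) * (T * T) →
        y m ℚᵘ.* y m ℚᵘ.≤ q ⊎ m ≡ 0
      square≤ (mkℚᵘ (+ a) d) m h = inj₁ (ℚᵘ.*≤* (begin
        + m ℤ.* + m ℤ.* + suc d  ≡⟨ cong (ℤ._* + suc d) (ℤ.pos-* m m) ⟨
        + (m * m) ℤ.* + suc d    ≡⟨ ℤ.pos-* (m * m) (suc d) ⟨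
        + (m * m * suc d)        ≤⟨ ℤ.+≤+ h ⟩
        + (a * (T * T))          ≡⟨ ℤ.pos-* a (T * T) ⟩
        + a ℤ.* + (T * T)        ∎))
        where open ℤ.≤-Reasoning
      square≤ (mkℚᵘ -[1+ a ] d) zero    h = inj₂ refl
      square≤ (mkℚᵘ -[1+ a ] d) (suc m) ()

      δ : ℝ
      δ = ratℝ (2^- K)

      Y : ℕ → ℝ
      Y m = ratℝ (dyadic K m)

      Y-nonneg : ∀ m → 0ℝ ≤ℝ Y m
      Y-nonneg m = ratℝ-mono-≤ (subst (ℚ._≤ dyadic K m) (dyadic-zero K)
        (fromℚᵘ-mono {y 0} {y m} (ℚᵘ.*≤* (ℤ.*-monoʳ-≤-nonNeg (+ T) {+ 0} {+ m} (ℤ.+≤+ ℕ.z≤n)))))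

      open ≤ℝ-Reasoning
      open +-*-Solver using (solve; _:=_; _:+_; _:*_; _:-_; :-_; con)

      -- Subadditivity of the square root, stated without roots. An error of at most `δ *ℝ δ` in the
      -- square thereby costs at most `δ` in the root, which is why the square is required to
      -- precision `2^- (K + K)`.
      square-sum : ∀ a b → 0ℝ ≤ℝ a → 0ℝ ≤ℝ b → a *ℝ a +ℝ b *ℝ b ≤ℝ (a +ℝ b) *ℝ (a +ℝ b)
      square-sum a b 0≤a 0≤b = begin
        a *ℝ a +ℝ b *ℝ b                            ≈⟨ ℝᵣ.+-identityʳ _ ⟨
        (a *ℝ a +ℝ b *ℝ b) +ℝ 0ℝ
          ≤⟨ +-monoʳ-≤ (a *ℝ a +ℝ b *ℝ b) (+-nonneg (*-nonneg 0≤a 0≤b) (*-nonneg 0≤a 0≤b)) ⟩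
        (a *ℝ a +ℝ b *ℝ b) +ℝ (a *ℝ b +ℝ a *ℝ b)
          ≈⟨ pointwise _ _ (λ n → solve 2 (λ a b → (a :* a :+ b :* b) :+ (a :* b :+ a :* b) := (a :+ b) :* (a :+ b)) refl (term a n) (term b n)) ⟩
        (a +ℝ b) *ℝ (a +ℝ b)                        ∎

    module _ {s : ℝ} (0≤s : 0ℝ ≤ℝ s) (close : ∣ s *ℝ s -ℝ ratℝ (fromℚᵘ q) ∣ℝ <ℝ ratℝ (2^- (K + K))) where

      private
        δ² : ratℝ (2^- (K + K)) ≈ℝ δ *ℝ δ
        δ² = pointwise _ _ λ _ → 2^-+ K K

        Q : ℝ
        Q = ratℝ (fromℚᵘ q)

        s²≤ : s *ℝ s ≤ℝ Q +ℝ δ *ℝ δ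
        s²≤ = begin
          s *ℝ s
            ≈⟨ pointwise _ _ (λ n → solve 2 (λ s q → s := q :+ (s :- q)) refl (term s n ℚ.* term s n) (fromℚᵘ q)) ⟩
          Q +ℝ (s *ℝ s -ℝ Q)          ≤⟨ +-monoʳ-≤ Q (≤-trans (x≤∣x∣ _) (<⇒≤ close)) ⟩
          Q +ℝ ratℝ (2^- (K + K))     ≈⟨ ℝᵣ.+-congˡ {Q} δ² ⟩
          Q +ℝ δ *ℝ δ                 ∎

        ≤s² : Q ≤ℝ s *ℝ s +ℝ δ *ℝ δ
        ≤s² = begin
          Q
            ≈⟨ pointwise _ _ (λ n → solve 2 (λ s q → q := s :+ (:- (s :- q))) refl (term s n ℚ.* term s n) (fromℚᵘ q)) ⟩
          s *ℝ s +ℝ (-ℝ (s *ℝ s -ℝ Q))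
            ≤⟨ +-monoʳ-≤ (s *ℝ s) (≤-trans (-x≤∣x∣ (s *ℝ s -ℝ Q)) (<⇒≤ close)) ⟩
          s *ℝ s +ℝ ratℝ (2^- (K + K))         ≈⟨ ℝᵣ.+-congˡ {s *ℝ s} δ² ⟩
          s *ℝ s +ℝ δ *ℝ δ                     ∎

        upper : s ≤ℝ Y n +ℝ δ
        upper = square-cancel-≤ (begin
            0ℝ          ≈⟨ ℝᵣ.+-identityʳ 0ℝ ⟨
            0ℝ +ℝ 0ℝ    ≤⟨ +-mono-≤ (Y-nonneg n) (2^-nonneg K) ⟩
            Y n +ℝ δ    ∎)
          (begin
            s *ℝ s                       ≤⟨ s²≤ ⟩
            Q +ℝ δ *ℝ δ
              ≤⟨ +-monoˡ-≤ (δ *ℝ δ) (ratℝ-mono-≤ (fromℚᵘ-mono (≤square q n (root-above _ _)))) ⟩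
            ratℝ (fromℚᵘ (y n ℚᵘ.* y n)) +ℝ δ *ℝ δ
              ≈⟨ ℝᵣ.+-congʳ {δ *ℝ δ} (pointwise _ _ (λ _ → fromℚᵘ-homo-* (y n) (y n))) ⟩
            Y n *ℝ Y n +ℝ δ *ℝ δ         ≤⟨ square-sum (Y n) δ (Y-nonneg n) (2^-nonneg K) ⟩
            (Y n +ℝ δ) *ℝ (Y n +ℝ δ)     ∎)

        0≤s+δ : 0ℝ ≤ℝ s +ℝ δ
        0≤s+δ = begin
            0ℝ          ≈⟨ ℝᵣ.+-identityʳ 0ℝ ⟨
            0ℝ +ℝ 0ℝ    ≤⟨ +-mono-≤ 0≤s (2^-nonneg K) ⟩
            s +ℝ δ      ∎

        below-root : ∀ m → y m ℚᵘ.* y m ℚᵘ.≤ q ⊎ m ≡ 0 → Y m ≤ℝ s +ℝ δ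
        below-root m (inj₁ h) = square-cancel-≤ 0≤s+δ (begin
          Y m *ℝ Y m                    ≈⟨ pointwise _ _ (λ _ → fromℚᵘ-homo-* (y m) (y m)) ⟨
          ratℝ (fromℚᵘ (y m ℚᵘ.* y m))  ≤⟨ ratℝ-mono-≤ (fromℚᵘ-mono h) ⟩
          Q                             ≤⟨ ≤s² ⟩
          s *ℝ s +ℝ δ *ℝ δ              ≤⟨ square-sum s δ 0≤s (2^-nonneg K) ⟩
          (s +ℝ δ) *ℝ (s +ℝ δ)          ∎)
        below-root m (inj₂ refl) = ≤-trans (≈⇒≤ (ratℝ-cong (dyadic-zero K))) 0≤s+δ

        -- The predecessor l lies below the root, up to one `δ` for the error of q; the second `δ`
        -- is the step of the grid from l to its successor.
        lower′ : ∀ m → m ≡ 0 ⊎ ∃[ l ] m ≡ suc l × (y l ℚᵘ.* y l ℚᵘ.≤ q ⊎ l ≡ 0) → Y m ≤ℝ s +ℝ δ +ℝ δ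
        lower′ m (inj₁ refl) = begin
          Y 0                ≈⟨ ratℝ-cong (dyadic-zero K) ⟩
          0ℝ                 ≈⟨ ℝᵣ.+-identityʳ 0ℝ ⟨
          0ℝ +ℝ 0ℝ           ≤⟨ +-mono-≤ 0≤s+δ (2^-nonneg K) ⟩
          s +ℝ δ +ℝ δ        ∎
        lower′ m (inj₂ (l , refl , h)) = begin
          Y (suc l)          ≈⟨ pointwise _ _ (λ _ → dyadic-suc K l) ⟩
          Y l +ℝ δ           ≤⟨ +-monoˡ-≤ δ (below-root l h) ⟩
          s +ℝ δ +ℝ δ        ∎

        lower : Y n ≤ℝ s +ℝ δ +ℝ δ
        lower with root-below (nonnegative-part (ℚᵘ.numerator q) * (T * T)) (ℚᵘ.denominator-1 q)
        ... | inj₁ e           = lower′ n (inj₁ e)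
        ... | inj₂ (l , e , h) = lower′ n (inj₂ (l , e , square≤ q l h))

      approximate-root-close : ∣ s -ℝ ratℝ (fromℚᵘ (approximate-root K q)) ∣ℝ ≤ℝ δ +ℝ δ
      approximate-root-close = ∣∣-≤
        (begin
          s -ℝ Y n            ≤⟨ +-monoˡ-≤ (-ℝ Y n) upper ⟩
          Y n +ℝ δ -ℝ Y n
            ≈⟨ pointwise _ _ (λ _ → solve 2 (λ y d → (y :+ d) :- y := d) refl (dyadic K n) (2^- K)) ⟩
          δ                   ≈⟨ ℝᵣ.+-identityʳ δ ⟨
          δ +ℝ 0ℝ             ≤⟨ +-monoʳ-≤ δ (2^-nonneg K) ⟩
          δ +ℝ δ              ∎)
        (begin
          -ℝ (s -ℝ Y n)
            ≈⟨ pointwise _ _ (λ n′ → solve 2 (λ s y → :- (s :- y) := y :- s) refl (term s n′) (dyadic K n)) ⟩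
          Y n -ℝ s                  ≤⟨ +-monoˡ-≤ (-ℝ s) lower ⟩
          s +ℝ δ +ℝ δ -ℝ s
            ≈⟨ pointwise _ _ (λ n′ → solve 2 (λ s d → ((s :+ d) :+ d) :- s := d :+ d) refl (term s n′) (2^- K)) ⟩
          δ +ℝ δ                    ∎)

-- Elementary consequences of the norm and algebra axioms.

module NormedAlgebras where
  open RealOrder
  open Reals using (pointwise; ≈ℝ-sym; ≈ℝ-trans)

  module NormedSpace {F : BaseField} {V : RawNormedSpace F} (isBanachSpace : IsBanachSpace V) where
    open RawNormedSpace V public
    open IsBanachSpace isBanachSpace public hiding (isLeftModule)
    open IsBanachSpace isBanachSpace using (isLeftModule)
    open IsLeftModule isLeftModule public
      using ()
      renaming
        ( ≈ᴹ-refl to ≈-refl; ≈ᴹ-sym to ≈-sym; ≈ᴹ-trans to ≈-trans; ≈ᴹ-setoid to ≈-setoid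
        ; +ᴹ-cong to +-cong; +ᴹ-congˡ to +-congˡ; +ᴹ-congʳ to +-congʳ
        ; +ᴹ-assoc to +-assoc; +ᴹ-comm to +-comm; +ᴹ-identityʳ to +-identityʳ; +ᴹ-identityˡ to +-identityˡ
        ; -ᴹ‿cong to -‿cong; -ᴹ‿inverseʳ to -‿inverseʳ; -ᴹ‿inverseˡ to -‿inverseˡ
        ; *ₗ-cong to •-cong; *ₗ-congˡ to •-congˡ; *ₗ-congʳ to •-congʳ; *ₗ-zeroˡ to •-zeroˡ; *ₗ-zeroʳ to •-zeroʳ
        ; *ₗ-distribʳ to •-distribʳ; *ₗ-distribˡ to •-distribˡ; *ₗ-identityˡ to •-identityˡ
        ; *ₗ-assoc to •-assoc
        )
    open IsLeftModule isLeftModule using (+ᴹ-isAbelianGroup)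

    private
      module K = CommutativeRing (scalarRing F)

    additiveGroup : AbelianGroup 0ℓ 0ℓ
    additiveGroup = record { isAbelianGroup = +ᴹ-isAbelianGroup }

    open AbelianGroupProperties additiveGroup public
      using (inverseˡ-unique; inverseʳ-unique)
      renaming (⁻¹-involutive to neg-involutive; ⁻¹-∙-comm to neg-+; x∙y⁻¹≈ε⇒x≈y to x-y≈0⇒x≈y;
                x≈y⇒x∙y⁻¹≈ε to x≈y⇒x-y≈0; ⁻¹-anti-homo‿- to neg-difference; ε⁻¹≈ε to neg-zero;
                //-rightDividesˡ to x-y+y≈x; //-rightDividesʳ to x+y-y≈x)
    open SemigroupProperties (AbelianGroup.commutativeSemigroup additiveGroup) public
      using () renaming (interchange to +-interchange)

    module ≈-Reasoning = SetoidReasoning ≈-setoid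

    sum-difference : ∀ a b c d → (a + b) - (c + d) ≈ (a - c) + (b - d)
    sum-difference a b c d = begin
      (a + b) - (c + d)      ≈⟨ +-congˡ (neg-+ c d) ⟨
      (a + b) + (- c + - d)  ≈⟨ +-interchange a b (- c) (- d) ⟩
      (a - c) + (b - d)      ∎
      where open ≈-Reasoning

    telescope : ∀ x y z → x - z ≈ (x - y) + (y - z)
    telescope x y z = begin
      x - z                  ≈⟨ +-congʳ (x-y+y≈x y x) ⟨
      ((x - y) + y) - z      ≈⟨ +-assoc (x - y) y (- z) ⟩
      (x - y) + (y - z)      ∎
      where open ≈-Reasoning

    •-neg : ∀ c x → c • (- x) ≈ - (c • x)
    •-neg c x = inverseˡ-unique (c • (- x)) (c • x)
      (≈-trans (≈-sym (•-distribˡ c (- x) x)) (≈-trans (•-congˡ (-‿inverseˡ x)) (•-zeroʳ c)))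

    neg-• : ∀ c x → (K.- c) • x ≈ - (c • x)
    neg-• c x = inverseˡ-unique ((K.- c) • x) (c • x)
      (≈-trans (≈-sym (•-distribʳ x (K.- c) c)) (≈-trans (•-congʳ (K.-‿inverseˡ c)) (•-zeroˡ x)))

    -- Homogeneity is assumed in squared form only. When the modulus r of the scalar is at hand, the
    -- squares can be removed.
    ‖•‖ : ∀ c r x → 0ℝ ≤ℝ r → modulus² F c ≈ℝ r *ℝ r → ‖ c • x ‖ ≈ℝ r *ℝ ‖ x ‖
    ‖•‖ c r x 0≤r h = square-injective (‖‖-nonneg (c • x)) (*-nonneg 0≤r (‖‖-nonneg x)) (begin
      ‖ c • x ‖ *ℝ ‖ c • x ‖                 ≈⟨ ‖‖-homogeneous c x ⟩
      modulus² F c *ℝ (‖ x ‖ *ℝ ‖ x ‖)       ≈⟨ ℝᵣ.*-congʳ {‖ x ‖ *ℝ ‖ x ‖} h ⟩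
      (r *ℝ r) *ℝ (‖ x ‖ *ℝ ‖ x ‖)           ≈⟨ *-interchange r r ‖ x ‖ ‖ x ‖ ⟩
      (r *ℝ ‖ x ‖) *ℝ (r *ℝ ‖ x ‖)           ∎)
      where
      open SetoidReasoning ℝᵣ.setoid
      open SemigroupProperties ℝᵣ.*-commutativeSemigroup using () renaming (interchange to *-interchange)

    ‖-x‖ : ∀ x → ‖ - x ‖ ≈ℝ ‖ x ‖
    ‖-x‖ x = begin
      ‖ - x ‖                 ≈⟨ ‖‖-cong (-‿cong (•-identityˡ x)) ⟨
      ‖ - (K.1# • x) ‖        ≈⟨ ‖‖-cong (neg-• K.1# x) ⟨
      ‖ (K.- K.1#) • x ‖      ≈⟨ ‖•‖ (K.- K.1#) 1ℝ x (ratℝ-mono-≤ (ℚ.nonNegative⁻¹ ℚ.1ℚ)) (unimodular F) ⟩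
      1ℝ *ℝ ‖ x ‖             ≈⟨ ℝᵣ.*-identityˡ ‖ x ‖ ⟩
      ‖ x ‖                   ∎
      where
      open SetoidReasoning ℝᵣ.setoid
      unimodular : ∀ F → modulus² F (CommutativeRing.-_ (scalarRing F) (CommutativeRing.1# (scalarRing F))) ≈ℝ 1ℝ *ℝ 1ℝ
      unimodular real    = pointwise _ _ λ _ → refl
      unimodular complex = pointwise _ _ λ _ → refl

    ‖0‖ : ‖ 0# ‖ ≈ℝ 0ℝ
    ‖0‖ = begin
      ‖ 0# ‖              ≈⟨ ‖‖-cong (•-zeroˡ 0#) ⟨
      ‖ K.0# • 0# ‖       ≈⟨ ‖•‖ K.0# 0ℝ 0# ≤-refl (vanishing F) ⟩
      0ℝ *ℝ ‖ 0# ‖        ≈⟨ ℝᵣ.zeroˡ ‖ 0# ‖ ⟩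
      0ℝ                  ∎
      where
      open SetoidReasoning ℝᵣ.setoid
      vanishing : ∀ F → modulus² F (CommutativeRing.0# (scalarRing F)) ≈ℝ 0ℝ *ℝ 0ℝ
      vanishing real    = pointwise _ _ λ _ → refl
      vanishing complex = pointwise _ _ λ _ → refl

    ‖x-y‖≈‖y-x‖ : ∀ x y → ‖ x - y ‖ ≈ℝ ‖ y - x ‖
    ‖x-y‖≈‖y-x‖ x y = ≈ℝ-trans (≈ℝ-sym (‖-x‖ (x - y))) (‖‖-cong (neg-difference x y))

    ‖‖-difference : ∀ x y → ‖ x - y ‖ ≤ℝ ‖ x ‖ +ℝ ‖ y ‖
    ‖‖-difference x y = ≤-trans (‖‖-triangle x (- y)) (+-monoʳ-≤ ‖ x ‖ (≈⇒≤ (‖-x‖ y)))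

    ‖‖-telescope : ∀ x y z → ‖ x - z ‖ ≤ℝ ‖ x - y ‖ +ℝ ‖ y - z ‖
    ‖‖-telescope x y z = ≤-trans (≈⇒≤ (‖‖-cong (telescope x y z))) (‖‖-triangle (x - y) (y - z))

    ‖x‖≤0⇒x≈0 : ∀ {x} → ‖ x ‖ ≤ℝ 0ℝ → x ≈ 0#
    ‖x‖≤0⇒x≈0 {x} h = ‖‖-definite x (≤-antisym h (‖‖-nonneg x))

    close⇒≈ : ∀ {x y} → (∀ k → ‖ x - y ‖ ≤ℝ ratℝ (2^- k)) → x ≈ y
    close⇒≈ {x} {y} h = x-y≈0⇒x≈y x y (‖x‖≤0⇒x≈0 (≤0-from-2^- h))

    x≈y⇒‖x-y‖≈0 : ∀ {x y} → x ≈ y → ‖ x - y ‖ ≈ℝ 0ℝ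
    x≈y⇒‖x-y‖≈0 h = ≈ℝ-trans (‖‖-cong (x≈y⇒x-y≈0 h)) ‖0‖

  module NormedAlgebra {F : BaseField} {A : RawNormedAlgebra F} (isBanachAlgebra : IsBanachAlgebra A) where
    open RawNormedAlgebra A using (_*_) public
    open IsBanachAlgebra isBanachAlgebra using
      (isBanachSpace; *-cong; *-assoc; distrib; •-*-assoc; *-•-comm; ‖‖-submultiplicative) public
    open NormedSpace isBanachSpace public

    *-congˡ : ∀ {x y z} → y ≈ z → x * y ≈ x * z
    *-congˡ h = *-cong ≈-refl h

    *-congʳ : ∀ {x y z} → y ≈ z → y * x ≈ z * x
    *-congʳ h = *-cong h ≈-refl

    distribˡ : ∀ x y z → x * (y + z) ≈ x * y + x * z
    distribˡ = proj₁ distrib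

    distribʳ : ∀ x y z → (y + z) * x ≈ y * x + z * x
    distribʳ = proj₂ distrib

    zeroʳ : ∀ x → x * 0# ≈ 0#
    zeroʳ x = begin
      x * 0#                                            ≈⟨ *-congˡ (•-zeroˡ 0#) ⟨
      x * (CommutativeRing.0# (scalarRing F) • 0#)      ≈⟨ *-•-comm _ x 0# ⟩
      CommutativeRing.0# (scalarRing F) • (x * 0#)      ≈⟨ •-zeroˡ (x * 0#) ⟩
      0#                                                ∎
      where open ≈-Reasoning

    zeroˡ : ∀ x → 0# * x ≈ 0#
    zeroˡ x = begin
      0# * x                                            ≈⟨ *-congʳ (•-zeroˡ 0#) ⟨
      (CommutativeRing.0# (scalarRing F) • 0#) * x      ≈⟨ •-*-assoc _ 0# x ⟩
      CommutativeRing.0# (scalarRing F) • (0# * x)      ≈⟨ •-zeroˡ (0# * x) ⟩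
      0#                                                ∎
      where open ≈-Reasoning

    *-neg : ∀ x y → x * (- y) ≈ - (x * y)
    *-neg x y = inverseˡ-unique (x * (- y)) (x * y)
      (≈-trans (≈-sym (distribˡ x (- y) y)) (≈-trans (*-congˡ (-‿inverseˡ y)) (zeroʳ x)))

-- Rational polynomials: programs, values and translations between presentations.

module RationalPolynomials where
  open RealOrder
  open ComputableFunctions
  open NormedAlgebras
  open ApproximateRoots using (fromℚᵘ-homo-*; fromℚᵘ-homo-neg)
  open Reals using (pointwise; ≈ℝ-sym; ≈ℝ-trans)

  private
    variable
      F G : BaseField
      L L′ Γ : Set

  wordCode : (L → Tree) → List⁺ L → Tree
  wordCode c w = ⌜List⌝ c (List⁺.toList w)

  polyCode : (L → Tree) → Polynomial F L → Tree
  polyCode {F = F} c = ⌜List⌝ (⌜_⌝scalar {F} ⊗ wordCode c)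

  module _ {c : L → Tree} {γ : Γ → Tree} where

    wordParts-computable : {w : Γ → List⁺ L} → Computable γ (wordCode c) w →
      Computable γ (c ⊗ ⌜List⌝ c) (λ x → List⁺.head (w x) , List⁺.tail (w x))
    wordParts-computable W = recode _ _ _ _ (λ x → x) (λ _ → refl) (λ _ → refl) W

    word-computable : {x : Γ → L} {xs : Γ → List L} → Computable γ c x → Computable γ (⌜List⌝ c) xs →
      Computable γ (wordCode c) (λ y → x y ∷ xs y)
    word-computable X XS = recode _ _ _ _ (λ x → x) (λ _ → refl) (λ _ → refl) (X ,ᶜ XS)

    ⁺++⁺-computable : {v w : Γ → List⁺ L} → Computable γ (wordCode c) v → Computable γ (wordCode c) w →
      Computable γ (wordCode c) (λ x → v x ⁺++⁺ w x)
    ⁺++⁺-computable {v} {w} V W = word-computable (fst (wordParts-computable V))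
      (++-computable (snd (wordParts-computable V))
        (∷-computable (fst (wordParts-computable W)) (snd (wordParts-computable W))))

  -- The product of q + ri and q′ + r′i as a sum of four scalars, which saves
  -- programming the addition of fractions.
  mulScalar : RationalScalar complex → RationalScalar complex → List (RationalScalar complex)
  mulScalar (q , r) (q′ , r′) =
    (q ℚᵘ.* q′ , 0ℚᵘ) ∷ (ℚᵘ.- (r ℚᵘ.* r′) , 0ℚᵘ) ∷ (0ℚᵘ , q ℚᵘ.* r′) ∷ (0ℚᵘ , r ℚᵘ.* q′) ∷ []

  mulMonomial : RationalScalar complex × List⁺ L → RationalScalar complex × List⁺ L → Polynomial complex L
  mulMonomial (c , v) (d , w) = map (λ e → e , v ⁺++⁺ w) (mulScalar c d)

  _⊛_ : Polynomial complex L → Polynomial complex L → Polynomial complex L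
  p ⊛ q = concatMap (λ m → concatMap (λ m′ → mulMonomial m m′) q) p

  scale : RationalScalar complex → Polynomial complex L → Polynomial complex L
  scale c = concatMap (λ m → map (λ e → e , proj₂ m) (mulScalar c (proj₁ m)))

  -- The factor of the first letter is put last, so that one right fold over the tail suffices. In a
  -- commutative algebra the value is the same.
  substituteWord : (L → Polynomial complex L′) → List⁺ L → Polynomial complex L′
  substituteWord σ (x ∷ xs) = foldr (λ y p → σ y ⊛ p) (σ x) xs

  substitute : (L → Polynomial complex L′) → Polynomial complex L → Polynomial complex L′
  substitute σ = concatMap (λ m → scale (proj₁ m) (substituteWord σ (proj₂ m)))

  conjugate : Polynomial complex L → Polynomial complex L
  conjugate = map (λ m → (proj₁ (proj₁ m) , ℚᵘ.- proj₂ (proj₁ m)) , proj₂ m)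

  -- Acting on coefficients alone, these give the real and imaginary parts of the value when all
  -- words are self-adjoint.
  realCoefficients imaginaryCoefficients : Polynomial complex L → Polynomial real L
  realCoefficients      = map (λ m → proj₁ (proj₁ m) , proj₂ m)
  imaginaryCoefficients = map (λ m → proj₂ (proj₁ m) , proj₂ m)

  complexCoefficients : Polynomial real L → Polynomial complex L
  complexCoefficients = map (λ m → (proj₁ m , 0ℚᵘ) , proj₂ m)

  mapLetters : (L → L′) → Polynomial F L → Polynomial F L′
  mapLetters f = map (λ m → proj₁ m , List⁺.map f (proj₂ m))

  scalarCode : RationalScalar complex → Tree
  scalarCode = ⌜_⌝ℚ ⊗ ⌜_⌝ℚ

  module _ {γ : Γ → Tree} where

    mulScalar-computable : {c d : Γ → RationalScalar complex} →
      Computable γ scalarCode c → Computable γ scalarCode d → Computable γ (⌜List⌝ scalarCode) (λ x → mulScalar (c x) (d x))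
    mulScalar-computable C D =
      ∷-computable (*ℚ-computable (fst C) (fst D) ,ᶜ const-computable 0ℚᵘ)
      (∷-computable (negℚ-computable (*ℚ-computable (snd C) (snd D)) ,ᶜ const-computable 0ℚᵘ)
      (∷-computable (const-computable 0ℚᵘ ,ᶜ *ℚ-computable (fst C) (snd D))
      (∷-computable (const-computable 0ℚᵘ ,ᶜ *ℚ-computable (snd C) (fst D))
      (const-computable []))))

  module _ {γ : Γ → Tree} {c : L → Tree} where

    ⊛-computable : {p q : Γ → Polynomial complex L} → Computable γ (polyCode {F = complex} c) p → Computable γ (polyCode {F = complex} c) q →
      Computable γ (polyCode {F = complex} c) (λ x → p x ⊛ q x)
    ⊛-computable P Q = concatMap-computable (concatMap-computable
      (map-computable (var₀ ,ᶜ ⁺++⁺-computable (snd (fst (snd (snd id-computable)))) (snd (fst (snd id-computable))))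
        (mulScalar-computable (fst (fst (snd id-computable))) (fst (fst id-computable))))
      (Q ∘ᶜ snd id-computable)) P

    scale-computable : {d : Γ → RationalScalar complex} {p : Γ → Polynomial complex L} →
      Computable γ scalarCode d → Computable γ (polyCode {F = complex} c) p → Computable γ (polyCode {F = complex} c) (λ x → scale (d x) (p x))
    scale-computable D P = concatMap-computable
      (map-computable (var₀ ,ᶜ snd (fst (snd id-computable)))
        (mulScalar-computable (D ∘ᶜ snd id-computable) (fst (fst id-computable)))) P

  module _ {γ : Γ → Tree} {c : L → Tree} {c′ : L′ → Tree} {σ : L → Polynomial complex L′}
    (Σ : Computable c (polyCode {F = complex} c′) σ) where

    substituteWord-computable : {w : Γ → List⁺ L} → Computable γ (wordCode c) w →
      Computable γ (polyCode {F = complex} c′) (λ x → substituteWord σ (w x))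
    substituteWord-computable W = foldr-computable (snd (wordParts-computable W))
      (Σ ∘ᶜ fst (wordParts-computable W)) (⊛-computable (Σ ∘ᶜ var₀) var₁)

  module _ {c : L → Tree} {c′ : L′ → Tree} {σ : L → Polynomial complex L′}
    (Σ : Computable c (polyCode {F = complex} c′) σ) where

    substitute-computable : Computable (polyCode {F = complex} c) (polyCode {F = complex} c′) (substitute σ)
    substitute-computable = concatMap-computable
      (scale-computable (fst (fst id-computable)) (substituteWord-computable Σ (snd (fst id-computable))))
      id-computable

  module _ {c : L → Tree} where

    conjugate-computable : Computable (polyCode {F = complex} c) (polyCode {F = complex} c) conjugate
    conjugate-computable = map-computable
      ((fst (fst var₀) ,ᶜ negℚ-computable (snd (fst var₀))) ,ᶜ snd var₀) id-computable

    realCoefficients-computable : Computable (polyCode {F = complex} c) (polyCode {F = real} c) realCoefficients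
    realCoefficients-computable = map-computable (fst (fst var₀) ,ᶜ snd var₀) id-computable

    imaginaryCoefficients-computable : Computable (polyCode {F = complex} c) (polyCode {F = real} c) imaginaryCoefficients
    imaginaryCoefficients-computable = map-computable (snd (fst var₀) ,ᶜ snd var₀) id-computable

    complexCoefficients-computable : Computable (polyCode {F = real} c) (polyCode {F = complex} c) complexCoefficients
    complexCoefficients-computable = map-computable ((fst var₀ ,ᶜ const-computable 0ℚᵘ) ,ᶜ snd var₀) id-computable

  module _ {c : L → Tree} {c′ : L′ → Tree} {f : L → L′} (Φ : Computable c c′ f) where

    mapLetters-computable : Computable (polyCode {F = F} c) (polyCode {F = F} c′) (mapLetters {F = F} f)
    mapLetters-computable = map-computable (fst var₀ ,ᶜ
      word-computable (Φ ∘ᶜ fst (wordParts-computable (snd var₀)))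
        (map-computable (Φ ∘ᶜ var₀) (snd (wordParts-computable (snd var₀))))) id-computable

  module Values {A : RawNormedAlgebra F} (isBanachAlgebra : IsBanachAlgebra A) (X : Letters A) where
    open NormedAlgebra isBanachAlgebra
    open Letters X

    monomial : RationalScalar F × List⁺ Letter → Carrier
    monomial (c , w) = fromRational F c • word w

    ⟦++⟧ : ∀ p q → ⟦ p ++ q ⟧ ≈ ⟦ p ⟧ + ⟦ q ⟧
    ⟦++⟧ []      q = ≈-sym (+-identityˡ ⟦ q ⟧)
    ⟦++⟧ (m ∷ p) q = ≈-trans (+-congˡ (⟦++⟧ p q)) (≈-sym (+-assoc (monomial m) ⟦ p ⟧ ⟦ q ⟧))

    word-++ : ∀ v w → word (v ⁺++⁺ w) ≈ word v * word w
    word-++ (x ∷ xs) w = go x xs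
      where
      go : ∀ x xs → word ((x ∷ xs) ⁺++⁺ w) ≈ word (x ∷ xs) * word w
      go x []       = ≈-refl
      go x (y ∷ ys) = ≈-trans (*-congˡ (go y ys)) (≈-sym (*-assoc (value x) (word (y ∷ ys)) (word w)))

  module _ {A : RawNormedAlgebra F} {A′ : RawNormedAlgebra G}
    (isBanachAlgebra : IsBanachAlgebra A) (isBanachAlgebra′ : IsBanachAlgebra A′)
    (X : Letters A) (Y : Letters A′) where

    private
      module A = NormedAlgebra isBanachAlgebra
      module A′ = NormedAlgebra isBanachAlgebra′
      module X = Letters X
      module Y = Letters Y
      module VX = Values isBanachAlgebra X
      module VY = Values isBanachAlgebra′ Y

    module _ (g : A.Carrier → A′.Carrier)
      (g-0 : g A.0# A′.≈ A′.0#) (g-+ : ∀ x y → g (x A.+ y) A′.≈ g x A′.+ g y) where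

      -- The value of a polynomial is a sum over its monomials and g is additive, so a rewriting of
      -- polynomials needs to be checked on monomials only.
      ⟦concatMap⟧ : ∀ {f} → (∀ m → Y.⟦ f m ⟧ A′.≈ g (VX.monomial m)) → ∀ p → Y.⟦ concatMap f p ⟧ A′.≈ g X.⟦ p ⟧
      ⟦concatMap⟧ h []      = A′.≈-sym g-0
      ⟦concatMap⟧ {f} h (m ∷ p) = A′.≈-trans (VY.⟦++⟧ (f m) (concatMap f p))
        (A′.≈-trans (A′.+-cong (h m) (⟦concatMap⟧ h p)) (A′.≈-sym (g-+ (VX.monomial m) X.⟦ p ⟧)))

      ⟦map⟧ : ∀ {f} → (∀ m → VY.monomial (f m) A′.≈ g (VX.monomial m)) → ∀ p → Y.⟦ map f p ⟧ A′.≈ g X.⟦ p ⟧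
      ⟦map⟧ h []      = A′.≈-sym g-0
      ⟦map⟧ h (m ∷ p) = A′.≈-trans (A′.+-cong (h m) (⟦map⟧ h p)) (A′.≈-sym (g-+ (VX.monomial m) X.⟦ p ⟧))

  module Products {A : RawNormedAlgebra complex} (isBanachAlgebra : IsBanachAlgebra A) (X : Letters A) where
    open NormedAlgebra isBanachAlgebra
    open Letters X
    open Values isBanachAlgebra X
    open ≈-Reasoning
    private
      ν : RationalScalar complex → ℂ
      ν = fromRational complex

    mulScalar-sum : ∀ c d → foldr (λ e s → ν e ℂᵣ.+ s) ℂᵣ.0# (mulScalar c d) ℂᵣ.≈ ν c ℂᵣ.* ν d
    mulScalar-sum (q , r) (q′ , r′) =
        pointwise _ _ (λ _ → trans (solve 2 (λ a b → a :+ (b :+ (con ℚ.0ℚ :+ (con ℚ.0ℚ :+ con ℚ.0ℚ))) := a :+ b) refl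
            (fromℚᵘ (q ℚᵘ.* q′)) (fromℚᵘ (ℚᵘ.- (r ℚᵘ.* r′))))
          (cong₂ ℚ._+_ (fromℚᵘ-homo-* q q′) (trans (fromℚᵘ-homo-neg (r ℚᵘ.* r′)) (cong ℚ.-_ (fromℚᵘ-homo-* r r′)))))
      , pointwise _ _ (λ _ → trans (solve 2 (λ a b → con ℚ.0ℚ :+ (con ℚ.0ℚ :+ (a :+ (b :+ con ℚ.0ℚ))) := a :+ b) refl
            (fromℚᵘ (q ℚᵘ.* r′)) (fromℚᵘ (r ℚᵘ.* q′)))
          (cong₂ ℚ._+_ (fromℚᵘ-homo-* q r′) (fromℚᵘ-homo-* r q′)))
      where open +-*-Solver

    ⟦scalars⟧ : ∀ cs w → ⟦ map (λ e → e , w) cs ⟧ ≈ foldr (λ e s → ν e ℂᵣ.+ s) ℂᵣ.0# cs • word w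
    ⟦scalars⟧ []       w = ≈-sym (•-zeroˡ (word w))
    ⟦scalars⟧ (c ∷ cs) w = ≈-trans (+-congˡ (⟦scalars⟧ cs w)) (≈-sym (•-distribʳ (word w) (ν c) _))

    ⟦mulScalar⟧ : ∀ c d w → ⟦ map (λ e → e , w) (mulScalar c d) ⟧ ≈ ν c • ν d • word w
    ⟦mulScalar⟧ c d w = begin
      ⟦ map (λ e → e , w) (mulScalar c d) ⟧   ≈⟨ ⟦scalars⟧ (mulScalar c d) w ⟩
      _ • word w                              ≈⟨ •-congʳ (mulScalar-sum c d) ⟩
      (ν c ℂᵣ.* ν d) • word w             ≈⟨ •-assoc (ν c) (ν d) (word w) ⟩
      ν c • ν d • word w                  ∎

    ⟦scale⟧ : ∀ c p → ⟦ scale c p ⟧ ≈ ν c • ⟦ p ⟧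
    ⟦scale⟧ c = ⟦concatMap⟧ isBanachAlgebra isBanachAlgebra X X (ν c •_) (•-zeroʳ (ν c)) (•-distribˡ (ν c))
      (λ m → ⟦mulScalar⟧ c (proj₁ m) (proj₂ m))

    ⟦mulMonomial⟧ : ∀ m m′ → ⟦ mulMonomial m m′ ⟧ ≈ monomial m * monomial m′
    ⟦mulMonomial⟧ (c , v) (d , w) = begin
      ⟦ mulMonomial (c , v) (d , w) ⟧          ≈⟨ ⟦mulScalar⟧ c d (v ⁺++⁺ w) ⟩
      ν c • ν d • word (v ⁺++⁺ w)          ≈⟨ •-congˡ (•-congˡ (word-++ v w)) ⟩
      ν c • ν d • (word v * word w)        ≈⟨ •-congˡ (*-•-comm (ν d) (word v) (word w)) ⟨
      ν c • (word v * (ν d • word w))        ≈⟨ •-*-assoc (ν c) (word v) (ν d • word w) ⟨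
      (ν c • word v) * (ν d • word w)      ∎

    ⟦⊛⟧ : ∀ p q → ⟦ p ⊛ q ⟧ ≈ ⟦ p ⟧ * ⟦ q ⟧
    ⟦⊛⟧ p q = ⟦concatMap⟧ isBanachAlgebra isBanachAlgebra X X (_* ⟦ q ⟧) (zeroˡ ⟦ q ⟧) (distribʳ ⟦ q ⟧)
      (λ m → ⟦concatMap⟧ isBanachAlgebra isBanachAlgebra X X (monomial m *_) (zeroʳ (monomial m)) (distribˡ (monomial m))
        (λ m′ → ⟦mulMonomial⟧ m m′) q) p

  module Substitution {A : RawNormedAlgebra complex} (isBanachAlgebra : IsBanachAlgebra A)
    (commutative : ∀ x y → RawNormedAlgebra._≈_ A (RawNormedAlgebra._*_ A x y) (RawNormedAlgebra._*_ A y x))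
    (X Y : Letters A) where
    open NormedAlgebra isBanachAlgebra
    open ≈-Reasoning
    private
      module X = Letters X
      module Y = Letters Y
      module PY = Products isBanachAlgebra Y

    module _ {σ : X.Letter → Polynomial complex Y.Letter} (h : ∀ x → Y.⟦ σ x ⟧ ≈ X.value x) where

      ⟦substituteWord⟧ : ∀ x xs → Y.⟦ substituteWord σ (x ∷ xs) ⟧ ≈ X.word (x ∷ xs)
      ⟦substituteWord⟧ x xs = ≈-trans (products xs) (≈-sym (last-first x xs))
        where
        product : List X.Letter → Carrier
        product = foldr (λ y p → X.value y * p) (X.value x)
        products : ∀ ys → Y.⟦ foldr (λ y p → σ y ⊛ p) (σ x) ys ⟧ ≈ product ys
        products []       = h x
        products (y ∷ ys) = ≈-trans (PY.⟦⊛⟧ (σ y) (foldr (λ y p → σ y ⊛ p) (σ x) ys)) (*-cong (h y) (products ys))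
        -- The factor of x stays at the right end on both sides, while that of y travels from beside
        -- it to the front, one commutation for each letter of ys.
        shift : ∀ x y ys → foldr (λ y p → X.value y * p) (X.value y) ys * X.value x ≈
          foldr (λ y p → X.value y * p) (X.value x) (y ∷ ys)
        shift x y []       = ≈-refl
        shift x y (z ∷ ys) = begin
          (X.value z * p) * X.value x    ≈⟨ *-assoc (X.value z) p (X.value x) ⟩
          X.value z * (p * X.value x)    ≈⟨ *-congˡ (shift x y ys) ⟩
          X.value z * (X.value y * q)    ≈⟨ *-assoc (X.value z) (X.value y) q ⟨
          (X.value z * X.value y) * q    ≈⟨ *-congʳ (commutative (X.value z) (X.value y)) ⟩
          (X.value y * X.value z) * q    ≈⟨ *-assoc (X.value y) (X.value z) q ⟩
          X.value y * (X.value z * q)    ∎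
          where
          p q : Carrier
          p = foldr (λ y p → X.value y * p) (X.value y) ys
          q = foldr (λ y p → X.value y * p) (X.value x) ys
        last-first : ∀ x ys → X.word (x ∷ ys) ≈ foldr (λ y p → X.value y * p) (X.value x) ys
        last-first x []       = ≈-refl
        last-first x (y ∷ ys) = begin
          X.value x * X.word (y ∷ ys)                                    ≈⟨ *-congˡ (last-first y ys) ⟩
          X.value x * foldr (λ y p → X.value y * p) (X.value y) ys       ≈⟨ commutative (X.value x) _ ⟩
          foldr (λ y p → X.value y * p) (X.value y) ys * X.value x       ≈⟨ shift x y ys ⟩
          foldr (λ y p → X.value y * p) (X.value x) (y ∷ ys)             ∎

      ⟦substitute⟧ : ∀ p → Y.⟦ substitute σ p ⟧ ≈ X.⟦ p ⟧
      ⟦substitute⟧ = ⟦concatMap⟧ isBanachAlgebra isBanachAlgebra X Y (λ x → x) ≈-refl (λ _ _ → ≈-refl)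
        (λ (c , x ∷ xs) → ≈-trans (PY.⟦scale⟧ c (substituteWord σ (x ∷ xs))) (•-congˡ (⟦substituteWord⟧ x xs)))

  -- A computable renaming of rational points that realises g exactly, with no approximation
  -- involved. The base field may change, so that A and B can be compared.
  record Translation {A : RawNormedAlgebra F} {A′ : RawNormedAlgebra G} (X : Letters A) (Y : Letters A′)
    (g : RawNormedAlgebra.Carrier A → RawNormedAlgebra.Carrier A′) : Set where
    private
      module X = Letters X
      module Y = Letters Y
    open RawNormedAlgebra A′ using (_≈_)
    field
      translate  : Polynomial F X.Letter → Polynomial G Y.Letter
      computable : Computable X.⌜_⌝ Y.⌜_⌝ translate
      correct    : ∀ p → Y.⟦ translate p ⟧ ≈ g X.⟦ p ⟧

  module _ {A : RawNormedAlgebra F} {A′ : RawNormedAlgebra G} (isBanachAlgebra′ : IsBanachAlgebra A′)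
    {X : Letters A} {Y : Letters A′} {g : RawNormedAlgebra.Carrier A → RawNormedAlgebra.Carrier A′} where
    private
      module A = RawNormedAlgebra A
      module A′ = NormedAlgebra isBanachAlgebra′
      module X = Letters X

    norm-transfer : Translation X Y g → (∀ x → A′.‖ g x ‖ ≈ℝ A.‖ x ‖) → NormIsComputable Y → NormIsComputable X
    norm-transfer T g-isometric (e , norm) = e after pair (program after left) right , λ p k →
      let (q , run , close) = norm (translate p) k
      in q , after⇓ (pair⇓ (after⇓ left⇓ (correctᵖ p)) right⇓) run , <-respˡ (close-cong p q) close
      where
      open Translation T
      open Computable computable using (program) renaming (correct to correctᵖ)
      <-respˡ : ∀ {x y z} → x ≈ℝ y → y <ℝ z → x <ℝ z
      <-respˡ h = ≤-<-trans (≈⇒≤ h)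
      close-cong : ∀ p q → ∣ A.‖ X.⟦ p ⟧ ‖ -ℝ ratℝ (fromℚᵘ q) ∣ℝ ≈ℝ ∣ A′.‖ Letters.⟦_⟧ Y (translate p) ‖ -ℝ ratℝ (fromℚᵘ q) ∣ℝ
      close-cong p q = ∣∣-cong (CommutativeRing.+-congʳ ℝ-commutativeRing {CommutativeRing.-_ ℝ-commutativeRing (ratℝ (fromℚᵘ q))}
        (≈ℝ-sym (≈ℝ-trans (A′.‖‖-cong (correct p)) (g-isometric X.⟦ p ⟧))))

  module _ {A A′ : RawNormedAlgebra F} {A₁ A₁′ : RawNormedAlgebra G}
    (isBanachAlgebra′ : IsBanachAlgebra A′) (isBanachAlgebra₁′ : IsBanachAlgebra A₁′)
    {X : Letters A} {Y : Letters A′} {X₁ : Letters A₁} {Y₁ : Letters A₁′} where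
    private
      module A = RawNormedAlgebra A
      module A′ = NormedAlgebra isBanachAlgebra′
      module A₁ = RawNormedAlgebra A₁
      module A₁′ = NormedAlgebra isBanachAlgebra₁′
      module X = Letters X
      module Y = Letters Y
      module Y₁ = Letters Y₁

    -- A point is renamed along g, the procedure for φ is run at the same precision, and its answer
    -- is renamed along h. The contraction hypothesis ensures that the last step does not increase
    -- the error.
    map-transfer : ∀ {g h φ} {ψ : A.Carrier → A′.Carrier} → Translation X X₁ g → Translation Y₁ Y h →
      (∀ {x y} → x A₁.≈ y → φ x A₁′.≈ φ y) →
      (∀ x y → A′.‖ ψ x A′.- h y ‖ ≤ℝ A₁′.‖ φ (g x) A₁′.- y ‖) →
      IsComputableMap X₁ Y₁ φ → IsComputableMap X Y ψ
    map-transfer {g} {h} {φ} {ψ} T S φ-cong contract (e , approximate) =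
      S.program after (e after pair (T.program after left) right) , λ p k →
        let (s , run , close) = approximate (T.translate p) k
        in S.translate s
         , after⇓ (after⇓ (pair⇓ (after⇓ left⇓ (T.correctᵖ p)) right⇓) run) (S.correctᵖ s)
         , (begin-strict
             A′.‖ ψ X.⟦ p ⟧ A′.- Y.⟦ S.translate s ⟧ ‖
               ≈⟨ A′.‖‖-cong (A′.+-congˡ (A′.-‿cong (S.correct s))) ⟩
             A′.‖ ψ X.⟦ p ⟧ A′.- h Y₁.⟦ s ⟧ ‖                             ≤⟨ contract X.⟦ p ⟧ Y₁.⟦ s ⟧ ⟩
             A₁′.‖ φ (g X.⟦ p ⟧) A₁′.- Y₁.⟦ s ⟧ ‖
               ≈⟨ A₁′.‖‖-cong (A₁′.+-congʳ (φ-cong (T.correct p))) ⟨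
             A₁′.‖ φ (Letters.⟦_⟧ X₁ (T.translate p)) A₁′.- Y₁.⟦ s ⟧ ‖    <⟨ close ⟩
             ratℝ (2^- k)                                                 ∎)
      where
      module T where
        open Translation T public
        open Computable computable public using (program) renaming (correct to correctᵖ)
      module S where
        open Translation S public
        open Computable computable public using (program) renaming (correct to correctᵖ)
      open ≤ℝ-Reasoning

  module _ {A : RawNormedAlgebra F} (isBanachAlgebra : IsBanachAlgebra A) {X Y : Letters A} where
    open NormedAlgebra isBanachAlgebra
    private
      module X = Letters X
      module Y = Letters Y

    renaming-translation : ∀ {f : X.Letter → Y.Letter} → Computable X.code Y.code f →
      (∀ x → Y.value (f x) ≈ X.value x) → Translation X Y (λ x → x)
    renaming-translation {f} computable h = record
      { translate  = mapLetters f
      ; computable = mapLetters-computable computable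
      ; correct    = ⟦map⟧ isBanachAlgebra isBanachAlgebra X Y (λ x → x) ≈-refl (λ _ _ → ≈-refl)
          (λ (c , x ∷ xs) → •-congˡ (words x xs))
      }
      where
      words : ∀ x xs → Y.word (f x ∷ map f xs) ≈ X.word (x ∷ xs)
      words x []       = h x
      words x (y ∷ ys) = *-cong (h x) (words y ys)

-- Multiplication by i, real and imaginary parts.

module ComplexStructure where
  open RealOrder
  open NormedAlgebras
  open Reals using (pointwise; ≈ℝ-trans; ≈ℝ-refl; term)

  i : ℂ
  i = 0ℝ , 1ℝ

  module ComplexSpace {V : RawNormedSpace complex} (isBanachSpace : IsBanachSpace V) where
    open NormedSpace isBanachSpace

    infix 8 i•_
    i•_ : Carrier → Carrier
    i• x = i • x

    i•i• : ∀ x → i• i• x ≈ - x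
    i•i• x = begin
      i • i • x                  ≈⟨ •-assoc i i x ⟨
      (i ℂᵣ.* i) • x
        ≈⟨ •-congʳ (pointwise _ (-ℝ 1ℝ) (λ _ → refl) , pointwise _ (-ℝ 0ℝ) (λ _ → refl)) ⟩
      (ℂᵣ.- ℂᵣ.1#) • x           ≈⟨ neg-• ℂᵣ.1# x ⟩
      - (ℂᵣ.1# • x)              ≈⟨ -‿cong (•-identityˡ x) ⟩
      - x                        ∎
      where open ≈-Reasoning

    complex-• : ∀ a b x → (a , b) • x ≈ (a , 0ℝ) • x + i• ((b , 0ℝ) • x)
    complex-• a b x = begin
      (a , b) • x                            ≈⟨ •-congʳ (split-re , split-im) ⟩
      ((a , 0ℝ) ℂᵣ.+ i ℂᵣ.* (b , 0ℝ)) • x    ≈⟨ •-distribʳ x (a , 0ℝ) (i ℂᵣ.* (b , 0ℝ)) ⟩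
      (a , 0ℝ) • x + (i ℂᵣ.* (b , 0ℝ)) • x   ≈⟨ +-congˡ (•-assoc i (b , 0ℝ) x) ⟩
      (a , 0ℝ) • x + i• ((b , 0ℝ) • x)       ∎
      where
      open ≈-Reasoning
      open +-*-Solver
      split-re : a ≈ℝ a +ℝ (0ℝ *ℝ b -ℝ 1ℝ *ℝ 0ℝ)
      split-re = pointwise _ _ λ n → solve 2 (λ a b →
        a := a :+ (con ℚ.0ℚ :* b :- con ℚ.1ℚ :* con ℚ.0ℚ)) refl (term a n) (term b n)
      split-im : b ≈ℝ 0ℝ +ℝ (0ℝ *ℝ 0ℝ +ℝ 1ℝ *ℝ b)
      split-im = pointwise _ _ λ n → solve 1 (λ b →
        b := con ℚ.0ℚ :+ (con ℚ.0ℚ :* con ℚ.0ℚ :+ con ℚ.1ℚ :* b)) refl (term b n)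

    •-i• : ∀ c x → c • i• x ≈ i• (c • x)
    •-i• c x = ≈-trans (≈-sym (•-assoc c i x)) (≈-trans (•-congʳ (ℂᵣ.*-comm c i)) (•-assoc i c x))

    ‖i•‖ : ∀ x → ‖ i• x ‖ ≈ℝ ‖ x ‖
    ‖i•‖ x = ≈ℝ-trans (‖•‖ i 1ℝ x (ratℝ-mono-≤ (ℚ.nonNegative⁻¹ ℚ.1ℚ)) (pointwise _ _ λ _ → refl)) (ℝᵣ.*-identityˡ ‖ x ‖)

  module RealAndImaginaryParts (B : CStarAlgebra complex) (abelian : IsAbelian B) where
    open CStarAlgebra B using (rawNormedAlgebra; _⋆; ⋆-cong; ⋆-+; ⋆-•; ⋆-*; ⋆-involutive; ⋆-isometric; isBanachAlgebra) public
    open NormedAlgebra isBanachAlgebra public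
    open ComplexSpace isBanachSpace public
    open SelfAdjoint B abelian public using (IsSelfAdjoint; conj-real; +-selfAdjoint; *-selfAdjoint;
      •-selfAdjoint; 0-selfAdjoint; neg-selfAdjoint; ⋆-selfAdjoint)

    private
      module A = RawStarAlgebra (selfAdjointPart B abelian)

    halfℂ -i/2 : ℂ
    halfℂ = ratℝ ½ , 0ℝ
    -i/2  = 0ℝ , ratℝ (ℚ.- ½)

    neg-⋆ : ∀ x → (- x) ⋆ ≈ - x ⋆
    neg-⋆ x = inverseˡ-unique ((- x) ⋆) (x ⋆)
      (≈-trans (≈-sym (⋆-+ (- x) x)) (≈-trans (⋆-cong (-‿inverseˡ x)) 0-selfAdjoint))

    real-⋆ : ∀ r x → ((r , 0ℝ) • x) ⋆ ≈ (r , 0ℝ) • x ⋆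
    real-⋆ r x = ≈-trans (⋆-• (r , 0ℝ) x) (•-congʳ (conj-real r))

    imaginary-⋆ : ∀ r x → ((0ℝ , r) • x) ⋆ ≈ - ((0ℝ , r) • x ⋆)
    imaginary-⋆ r x = ≈-trans (⋆-• (0ℝ , r) x) (≈-trans
      (•-congʳ (pointwise _ _ (λ _ → refl) , ≈ℝ-refl)) (neg-• (0ℝ , r) (x ⋆)))

    realPart imaginaryPart : Carrier → A.Carrier
    realPart x = halfℂ • (x + x ⋆) , (begin
      (halfℂ • (x + x ⋆)) ⋆       ≈⟨ real-⋆ (ratℝ ½) (x + x ⋆) ⟩
      halfℂ • (x + x ⋆) ⋆         ≈⟨ •-congˡ (⋆-+ x (x ⋆)) ⟩
      halfℂ • (x ⋆ + x ⋆ ⋆)       ≈⟨ •-congˡ (+-congˡ (⋆-involutive x)) ⟩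
      halfℂ • (x ⋆ + x)           ≈⟨ •-congˡ (+-comm (x ⋆) x) ⟩
      halfℂ • (x + x ⋆)           ∎)
      where open ≈-Reasoning
    imaginaryPart x = -i/2 • (x - x ⋆) , (begin
      (-i/2 • (x - x ⋆)) ⋆        ≈⟨ imaginary-⋆ (ratℝ (ℚ.- ½)) (x - x ⋆) ⟩
      - (-i/2 • (x - x ⋆) ⋆)      ≈⟨ •-neg -i/2 ((x - x ⋆) ⋆) ⟨
      -i/2 • (- (x - x ⋆) ⋆)      ≈⟨ •-congˡ (neg-⋆ (x - x ⋆)) ⟨
      -i/2 • (- (x - x ⋆)) ⋆      ≈⟨ •-congˡ (⋆-cong (neg-difference x (x ⋆))) ⟩
      -i/2 • (x ⋆ - x) ⋆          ≈⟨ •-congˡ (⋆-+ (x ⋆) (- x)) ⟩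
      -i/2 • (x ⋆ ⋆ + (- x) ⋆)    ≈⟨ •-congˡ (+-cong (⋆-involutive x) (neg-⋆ x)) ⟩
      -i/2 • (x - x ⋆)            ∎)
      where open ≈-Reasoning

    re im : Carrier → Carrier
    re x = proj₁ (realPart x)
    im x = proj₁ (imaginaryPart x)

    re-cong : ∀ {x y} → x ≈ y → re x ≈ re y
    re-cong h = •-congˡ (+-cong h (⋆-cong h))

    im-cong : ∀ {x y} → x ≈ y → im x ≈ im y
    im-cong h = •-congˡ (+-cong h (-‿cong (⋆-cong h)))

    i*-i/2 : i ℂᵣ.* -i/2 ℂᵣ.≈ halfℂ
    i*-i/2 = pointwise _ _ (λ _ → refl) , pointwise _ _ (λ _ → refl)

    halves : ∀ x → halfℂ • x + halfℂ • x ≈ x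
    halves x = ≈-trans (≈-sym (•-distribʳ x halfℂ halfℂ))
      (≈-trans (•-congʳ {x} {halfℂ ℂᵣ.+ halfℂ} {ℂᵣ.1#} (pointwise _ _ (λ _ → refl) , pointwise _ _ (λ _ → refl))) (•-identityˡ x))

    half-double : ∀ x → halfℂ • (x + x) ≈ x
    half-double x = ≈-trans (•-distribˡ halfℂ x x) (halves x)

    decomposition : ∀ x → x ≈ re x + i• im x
    decomposition x = ≈-sym (begin
      halfℂ • (x + x ⋆) + i • -i/2 • (x - x ⋆)      ≈⟨ +-congˡ (•-assoc i -i/2 (x - x ⋆)) ⟨
      halfℂ • (x + x ⋆) + (i ℂᵣ.* -i/2) • (x - x ⋆) ≈⟨ +-congˡ (•-congʳ i*-i/2) ⟩
      halfℂ • (x + x ⋆) + halfℂ • (x - x ⋆)         ≈⟨ •-distribˡ halfℂ (x + x ⋆) (x - x ⋆) ⟨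
      halfℂ • ((x + x ⋆) + (x - x ⋆))               ≈⟨ •-congˡ (+-interchange x (x ⋆) x (- x ⋆)) ⟩
      halfℂ • ((x + x) + (x ⋆ - x ⋆))               ≈⟨ •-congˡ (+-congˡ (-‿inverseʳ (x ⋆))) ⟩
      halfℂ • ((x + x) + 0#)                        ≈⟨ •-congˡ (+-identityʳ (x + x)) ⟩
      halfℂ • (x + x)                               ≈⟨ half-double x ⟩
      x                                             ∎)
      where open ≈-Reasoning

    +i-cong : ∀ {x y u v} → x ≈ u → y ≈ v → x + i• y ≈ u + i• v
    +i-cong p q = +-cong p (•-congˡ q)

    ⋆-+i : ∀ {x y} → IsSelfAdjoint x → IsSelfAdjoint y → (x + i• y) ⋆ ≈ x - i• y
    ⋆-+i {x} {y} p q = begin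
      (x + i• y) ⋆        ≈⟨ ⋆-+ x (i• y) ⟩
      x ⋆ + (i• y) ⋆      ≈⟨ +-cong p (imaginary-⋆ 1ℝ y) ⟩
      x - i• (y ⋆)        ≈⟨ +-congˡ (-‿cong (•-congˡ q)) ⟩
      x - i• y            ∎
      where open ≈-Reasoning

    -- Together with `im-unique` this is the uniqueness of the decomposition. The formulas for the
    -- parts of sums, multiples, products and adjoints follow by exhibiting a decomposition with
    -- self-adjoint components.
    re-unique : ∀ {x y} → IsSelfAdjoint x → IsSelfAdjoint y → ∀ {z} → z ≈ x + i• y → re z ≈ x
    re-unique {x} {y} p q {z} h = begin
      halfℂ • (z + z ⋆)                      ≈⟨ •-congˡ (+-cong h (≈-trans (⋆-cong h) (⋆-+i p q))) ⟩
      halfℂ • ((x + i• y) + (x - i• y))      ≈⟨ •-congˡ (+-interchange x (i• y) x (- i• y)) ⟩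
      halfℂ • ((x + x) + (i• y - i• y))      ≈⟨ •-congˡ (+-congˡ (-‿inverseʳ (i• y))) ⟩
      halfℂ • ((x + x) + 0#)                 ≈⟨ •-congˡ (+-identityʳ (x + x)) ⟩
      halfℂ • (x + x)                        ≈⟨ half-double x ⟩
      x                                      ∎
      where open ≈-Reasoning

    im-unique : ∀ {x y} → IsSelfAdjoint x → IsSelfAdjoint y → ∀ {z} → z ≈ x + i• y → im z ≈ y
    im-unique {x} {y} p q {z} h = begin
      -i/2 • (z - z ⋆)                       ≈⟨ •-congˡ (+-cong h (-‿cong (≈-trans (⋆-cong h) (⋆-+i p q)))) ⟩
      -i/2 • ((x + i• y) - (x - i• y))       ≈⟨ •-congˡ (sum-difference x (i• y) x (- i• y)) ⟩
      -i/2 • ((x - x) + (i• y - (- i• y)))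
        ≈⟨ •-congˡ (+-cong (-‿inverseʳ x) (+-congˡ (neg-involutive (i• y)))) ⟩
      -i/2 • (0# + (i• y + i• y))            ≈⟨ •-congˡ (+-identityˡ (i• y + i• y)) ⟩
      -i/2 • (i• y + i• y)                   ≈⟨ •-distribˡ -i/2 (i• y) (i• y) ⟩
      -i/2 • i• y + -i/2 • i• y              ≈⟨ +-cong step step ⟩
      halfℂ • y + halfℂ • y                  ≈⟨ halves y ⟩
      y                                      ∎
      where
      open ≈-Reasoning
      step : -i/2 • i• y ≈ halfℂ • y
      step = ≈-trans (≈-sym (•-assoc -i/2 i y)) (•-congʳ (ℂᵣ.trans (ℂᵣ.*-comm -i/2 i) i*-i/2))

    selfAdjoint-+i0 : ∀ x → x ≈ x + i• 0#
    selfAdjoint-+i0 x = ≈-sym (≈-trans (+-congˡ (•-zeroʳ i)) (+-identityʳ x))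

    re-selfAdjoint : ∀ {x} → IsSelfAdjoint x → re x ≈ x
    re-selfAdjoint {x} p = re-unique p 0-selfAdjoint (selfAdjoint-+i0 x)

    im-selfAdjoint : ∀ {x} → IsSelfAdjoint x → im x ≈ 0#
    im-selfAdjoint {x} p = im-unique p 0-selfAdjoint (selfAdjoint-+i0 x)

    +i-+ : ∀ x y u v → (x + i• y) + (u + i• v) ≈ (x + u) + i• (y + v)
    +i-+ x y u v = ≈-trans (+-interchange x (i• y) u (i• v)) (+-congˡ (≈-sym (•-distribˡ i y v)))

    +i-i• : ∀ x y → i• (x + i• y) ≈ (- y) + i• x
    +i-i• x y = ≈-trans (•-distribˡ i x (i• y)) (≈-trans (+-congˡ (i•i• y)) (+-comm (i• x) (- y)))

    +i-* : ∀ x y u v → (x + i• y) * (u + i• v) ≈ (x * u - y * v) + i• (x * v + y * u)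
    +i-* x y u v = begin
      (x + i• y) * (u + i• v)                                  ≈⟨ distribʳ (u + i• v) x (i• y) ⟩
      x * (u + i• v) + i• y * (u + i• v)
        ≈⟨ +-cong (distribˡ x u (i• v)) (•-*-assoc i y (u + i• v)) ⟩
      (x * u + x * i• v) + i• (y * (u + i• v))
        ≈⟨ +-cong (+-congˡ (*-•-comm i x v)) (•-congˡ (≈-trans (distribˡ y u (i• v)) (+-congˡ (*-•-comm i y v)))) ⟩
      (x * u + i• (x * v)) + i• (y * u + i• (y * v))           ≈⟨ +-congˡ (+i-i• (y * u) (y * v)) ⟩
      (x * u + i• (x * v)) + (- (y * v) + i• (y * u))          ≈⟨ +i-+ (x * u) (x * v) (- (y * v)) (y * u) ⟩
      (x * u - y * v) + i• (x * v + y * u)                     ∎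
      where open ≈-Reasoning

    +i-neg : ∀ x y → - (x + i• y) ≈ (- x) + i• (- y)
    +i-neg x y = ≈-trans (≈-sym (neg-+ x (i• y))) (+-congˡ (≈-sym (•-neg i y)))

    +i-• : ∀ a b x y → (a , b) • (x + i• y) ≈ ((a , 0ℝ) • x - (b , 0ℝ) • y) + i• ((a , 0ℝ) • y + (b , 0ℝ) • x)
    +i-• a b x y = begin
      (a , b) • z                                                        ≈⟨ complex-• a b z ⟩
      (a , 0ℝ) • z + i• ((b , 0ℝ) • z)
        ≈⟨ +-cong (real-• a) (≈-trans (•-congˡ (real-• b)) (+i-i• _ _)) ⟩
      ((a , 0ℝ) • x + i• ((a , 0ℝ) • y)) + ((- ((b , 0ℝ) • y)) + i• ((b , 0ℝ) • x)) ≈⟨ +i-+ _ _ _ _ ⟩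
      ((a , 0ℝ) • x - (b , 0ℝ) • y) + i• ((a , 0ℝ) • y + (b , 0ℝ) • x)   ∎
      where
      open ≈-Reasoning
      z : Carrier
      z = x + i• y
      real-• : ∀ r → (r , 0ℝ) • z ≈ (r , 0ℝ) • x + i• ((r , 0ℝ) • y)
      real-• r = ≈-trans (•-distribˡ (r , 0ℝ) x (i• y)) (+-congˡ (•-i• (r , 0ℝ) y))

    re-sa : ∀ x → IsSelfAdjoint (re x)
    re-sa x = proj₂ (realPart x)

    im-sa : ∀ x → IsSelfAdjoint (im x)
    im-sa x = proj₂ (imaginaryPart x)

    re-+ : ∀ x y → re (x + y) ≈ re x + re y
    re-+ x y = re-unique (+-selfAdjoint (re-sa x) (re-sa y)) (+-selfAdjoint (im-sa x) (im-sa y))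
      (≈-trans (+-cong (decomposition x) (decomposition y)) (+i-+ _ _ _ _))

    im-+ : ∀ x y → im (x + y) ≈ im x + im y
    im-+ x y = im-unique (+-selfAdjoint (re-sa x) (re-sa y)) (+-selfAdjoint (im-sa x) (im-sa y))
      (≈-trans (+-cong (decomposition x) (decomposition y)) (+i-+ _ _ _ _))

    re-neg : ∀ x → re (- x) ≈ - re x
    re-neg x = re-unique (neg-selfAdjoint (re-sa x)) (neg-selfAdjoint (im-sa x))
      (≈-trans (-‿cong (decomposition x)) (+i-neg _ _))

    im-neg : ∀ x → im (- x) ≈ - im x
    im-neg x = im-unique (neg-selfAdjoint (re-sa x)) (neg-selfAdjoint (im-sa x))
      (≈-trans (-‿cong (decomposition x)) (+i-neg _ _))

    module _ (a b : ℝ) (x : Carrier) where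
      private
        p : IsSelfAdjoint ((a , 0ℝ) • re x - (b , 0ℝ) • im x)
        p = +-selfAdjoint (•-selfAdjoint a (re-sa x)) (neg-selfAdjoint (•-selfAdjoint b (im-sa x)))
        q : IsSelfAdjoint ((a , 0ℝ) • im x + (b , 0ℝ) • re x)
        q = +-selfAdjoint (•-selfAdjoint a (im-sa x)) (•-selfAdjoint b (re-sa x))
        h : (a , b) • x ≈ ((a , 0ℝ) • re x - (b , 0ℝ) • im x) + i• ((a , 0ℝ) • im x + (b , 0ℝ) • re x)
        h = ≈-trans (•-congˡ (decomposition x)) (+i-• a b _ _)

      re-• : re ((a , b) • x) ≈ (a , 0ℝ) • re x - (b , 0ℝ) • im x
      re-• = re-unique p q h

      im-• : im ((a , b) • x) ≈ (a , 0ℝ) • im x + (b , 0ℝ) • re x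
      im-• = im-unique p q h

    module _ (x y : Carrier) where
      private
        p : IsSelfAdjoint (re x * re y - im x * im y)
        p = +-selfAdjoint (*-selfAdjoint (re-sa x) (re-sa y)) (neg-selfAdjoint (*-selfAdjoint (im-sa x) (im-sa y)))
        q : IsSelfAdjoint (re x * im y + im x * re y)
        q = +-selfAdjoint (*-selfAdjoint (re-sa x) (im-sa y)) (*-selfAdjoint (im-sa x) (re-sa y))
        h : x * y ≈ (re x * re y - im x * im y) + i• (re x * im y + im x * re y)
        h = ≈-trans (*-cong (decomposition x) (decomposition y)) (+i-* _ _ _ _)

      re-* : re (x * y) ≈ re x * re y - im x * im y
      re-* = re-unique p q h

      im-* : im (x * y) ≈ re x * im y + im x * re y
      im-* = im-unique p q h

    ⋆-decomposition : ∀ x → x ⋆ ≈ re x + i• (- im x)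
    ⋆-decomposition x = ≈-trans (⋆-cong (decomposition x))
      (≈-trans (⋆-+i (re-sa x) (im-sa x)) (+-congˡ (≈-sym (•-neg i (im x)))))

    re-⋆ : ∀ x → re (x ⋆) ≈ re x
    re-⋆ x = re-unique (re-sa x) (neg-selfAdjoint (im-sa x)) (⋆-decomposition x)

    im-⋆ : ∀ x → im (x ⋆) ≈ - im x
    im-⋆ x = im-unique (re-sa x) (neg-selfAdjoint (im-sa x)) (⋆-decomposition x)

    private
      half-bound : ∀ c x y → modulus² complex c ≈ℝ ratℝ ½ *ℝ ratℝ ½ → ‖ y ‖ ≤ℝ ‖ x ‖ +ℝ ‖ x ‖ → ‖ c • y ‖ ≤ℝ ‖ x ‖
      half-bound c x y h k = begin
        ‖ c • y ‖                        ≈⟨ ‖•‖ c (ratℝ ½) y 0≤½ h ⟩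
        ratℝ ½ *ℝ ‖ y ‖                  ≤⟨ *-monoˡ-≤ (ratℝ ½) 0≤½ k ⟩
        ratℝ ½ *ℝ (‖ x ‖ +ℝ ‖ x ‖)
          ≈⟨ pointwise _ _ (λ n → solve 1 (λ x → con ½ :* (x :+ x) := x) refl (term ‖ x ‖ n)) ⟩
        ‖ x ‖                            ∎
        where
        open ≤ℝ-Reasoning
        open +-*-Solver

    -- Being contractions, `re` and `im` respect limits, and `re` moves an approximant of a
    -- self-adjoint element into A without loss.
    ‖re‖≤ : ∀ x → ‖ re x ‖ ≤ℝ ‖ x ‖
    ‖re‖≤ x = half-bound halfℂ x (x + x ⋆) (pointwise _ _ λ _ → refl)
      (≤-trans (‖‖-triangle x (x ⋆)) (+-monoʳ-≤ ‖ x ‖ (≈⇒≤ (⋆-isometric x))))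

    ‖im‖≤ : ∀ x → ‖ im x ‖ ≤ℝ ‖ x ‖
    ‖im‖≤ x = half-bound -i/2 x (x - x ⋆) (pointwise _ _ λ _ → refl)
      (≤-trans (‖‖-difference x (x ⋆)) (+-monoʳ-≤ ‖ x ‖ (≈⇒≤ (⋆-isometric x))))

    ‖+i‖≤ : ∀ x y → ‖ x + i• y ‖ ≤ℝ ‖ x ‖ +ℝ ‖ y ‖
    ‖+i‖≤ x y = ≤-trans (‖‖-triangle x (i• y)) (+-monoʳ-≤ ‖ x ‖ (≈⇒≤ (‖i•‖ y)))

-- Norm estimates for operators from the inner product.

module InnerProducts where
  open RealOrder
  open NormedAlgebras
  open Reals using (pointwise; ≈ℝ-sym; ≈ℝ-trans; *ℝ-cong; +ℝ-cong; -ℝ-cong; term)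
  open +-*-Solver using (solve; _:=_; _:+_; _:*_; _:-_; :-_; con)
  open ≤ℝ-Reasoning

  -- Here u is 1 / (2 t). The real x below t serves as the witness that t is positive.
  half-inverse : ∀ {x t} → 0ℝ ≤ℝ x → x <ℝ ratℝ t → ∃[ u ] (0ℝ ≤ℝ ratℝ u) × (u ℚ.* t ≡ ½)
  half-inverse {x} {t} 0≤x x<t = ½ ℚ.* s , ratℝ-mono-≤ 0≤u , trans (ℚ.*-assoc ½ s t) (cong (½ ℚ.*_) (ℚ.*-inverseˡ t))
    where
    0<t : 0ℚ ℚ.< t
    0<t = ratℝ-cancel-< (≤-<-trans 0≤x x<t)
    instance
      t-positive : ℚ.Positive t
      t-positive = ℚ.positive 0<t
      t-nonzero : ℚ.NonZero t
      t-nonzero = ℚ.pos⇒nonZero t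
    s : ℚ
    s = ℚ.1/ t
    0≤u : 0ℚ ℚ.≤ ½ ℚ.* s
    0≤u = subst (ℚ._≤ ½ ℚ.* s) (ℚ.*-zeroʳ ½)
      (ℚ.*-monoˡ-≤-nonNeg ½ (ℚ.<⇒≤ (ℚ.positive⁻¹ s {{ℚ.1/pos⇒pos t}})))

  module RealHilbert (H : HilbertSpace real) where
    open HilbertSpace H using (⟨_,_⟩; ⟨⟩-cong; ⟨⟩-+; ⟨⟩-•; ⟨⟩-conj; ⟨⟩-‖‖; isBanachSpace)
    open NormedSpace isBanachSpace

    ⟨⟩-+ʳ : ∀ x y z → ⟨ x , y + z ⟩ ≈ℝ ⟨ x , y ⟩ +ℝ ⟨ x , z ⟩
    ⟨⟩-+ʳ x y z = ≈ℝ-trans (⟨⟩-conj (y + z) x) (≈ℝ-trans (⟨⟩-+ y z x) (+ℝ-cong (⟨⟩-conj x y) (⟨⟩-conj x z)))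

    ⟨⟩-neg : ∀ x y → ⟨ - x , y ⟩ ≈ℝ -ℝ ⟨ x , y ⟩
    ⟨⟩-neg x y = begin-equality
      ⟨ - x , y ⟩
        ≈⟨ ⟨⟩-cong (≈-trans (-‿cong (≈-sym (•-identityˡ x))) (≈-sym (neg-• 1ℝ x))) ≈-refl ⟩
      ⟨ (-ℝ 1ℝ) • x , y ⟩        ≈⟨ ⟨⟩-• (-ℝ 1ℝ) x y ⟩
      (-ℝ 1ℝ) *ℝ ⟨ x , y ⟩
        ≈⟨ pointwise _ _ (λ n → solve 1 (λ a → (:- con 1ℚ) :* a := :- a) refl (term ⟨ x , y ⟩ n)) ⟩
      -ℝ ⟨ x , y ⟩               ∎

    ⟨⟩-negʳ : ∀ x y → ⟨ x , - y ⟩ ≈ℝ -ℝ ⟨ x , y ⟩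
    ⟨⟩-negʳ x y = ≈ℝ-trans (⟨⟩-conj (- y) x) (≈ℝ-trans (⟨⟩-neg y x) (-ℝ-cong (⟨⟩-conj x y)))

    ‖+‖² : ∀ v w → ‖ v + w ‖ *ℝ ‖ v + w ‖ ≈ℝ (‖ v ‖ *ℝ ‖ v ‖ +ℝ ⟨ v , w ⟩) +ℝ (⟨ v , w ⟩ +ℝ ‖ w ‖ *ℝ ‖ w ‖)
    ‖+‖² v w = begin-equality
      ‖ v + w ‖ *ℝ ‖ v + w ‖                                               ≈⟨ ⟨⟩-‖‖ (v + w) ⟨
      ⟨ v + w , v + w ⟩                                                    ≈⟨ ⟨⟩-+ v w (v + w) ⟩
      ⟨ v , v + w ⟩ +ℝ ⟨ w , v + w ⟩
        ≈⟨ +ℝ-cong (⟨⟩-+ʳ v v w) (⟨⟩-+ʳ w v w) ⟩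
      (⟨ v , v ⟩ +ℝ ⟨ v , w ⟩) +ℝ (⟨ w , v ⟩ +ℝ ⟨ w , w ⟩)
        ≈⟨ +ℝ-cong (ℝᵣ.+-congʳ {⟨ v , w ⟩} (⟨⟩-‖‖ v)) (+ℝ-cong (⟨⟩-conj v w) (⟨⟩-‖‖ w)) ⟩
      (‖ v ‖ *ℝ ‖ v ‖ +ℝ ⟨ v , w ⟩) +ℝ (⟨ v , w ⟩ +ℝ ‖ w ‖ *ℝ ‖ w ‖)       ∎

    -- The triangle inequality is among the axioms, so Cauchy-Schwarz comes out of it: expand ‖v +
    -- w‖² ≤ (‖v‖ + ‖w‖)², cancel the squares and halve.
    ⟨⟩≤ : ∀ v w → ⟨ v , w ⟩ ≤ℝ ‖ v ‖ *ℝ ‖ w ‖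
    ⟨⟩≤ v w = begin
      ⟨ v , w ⟩                     ≈⟨ half-sum ⟨ v , w ⟩ ⟩
      ratℝ ½ *ℝ (⟨ v , w ⟩ +ℝ ⟨ v , w ⟩)
        ≤⟨ *-monoˡ-≤ (ratℝ ½) 0≤½ (+-cancelʳ-≤ℝ (‖ v ‖ *ℝ ‖ v ‖ +ℝ ‖ w ‖ *ℝ ‖ w ‖) doubled) ⟩
      ratℝ ½ *ℝ (‖ v ‖ *ℝ ‖ w ‖ +ℝ ‖ v ‖ *ℝ ‖ w ‖) ≈⟨ half-sum (‖ v ‖ *ℝ ‖ w ‖) ⟨
      ‖ v ‖ *ℝ ‖ w ‖                ∎
      where
      half-sum : ∀ a → a ≈ℝ ratℝ ½ *ℝ (a +ℝ a)
      half-sum a = pointwise _ _ λ n → solve 1 (λ a → a := con ½ :* (a :+ a)) refl (term a n)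
      doubled : (⟨ v , w ⟩ +ℝ ⟨ v , w ⟩) +ℝ (‖ v ‖ *ℝ ‖ v ‖ +ℝ ‖ w ‖ *ℝ ‖ w ‖) ≤ℝ
        (‖ v ‖ *ℝ ‖ w ‖ +ℝ ‖ v ‖ *ℝ ‖ w ‖) +ℝ (‖ v ‖ *ℝ ‖ v ‖ +ℝ ‖ w ‖ *ℝ ‖ w ‖)
      doubled = begin
        (⟨ v , w ⟩ +ℝ ⟨ v , w ⟩) +ℝ (‖ v ‖ *ℝ ‖ v ‖ +ℝ ‖ w ‖ *ℝ ‖ w ‖)
          ≈⟨ pointwise _ _
               (λ n → solve 3 (λ p a b → (p :+ p) :+ (a :* a :+ b :* b) :=
                    (a :* a :+ p) :+ (p :+ b :* b)) refl (term ⟨ v , w ⟩ n) (term ‖ v ‖ n) (term ‖ w ‖ n)) ⟩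
        (‖ v ‖ *ℝ ‖ v ‖ +ℝ ⟨ v , w ⟩) +ℝ (⟨ v , w ⟩ +ℝ ‖ w ‖ *ℝ ‖ w ‖)   ≈⟨ ‖+‖² v w ⟨
        ‖ v + w ‖ *ℝ ‖ v + w ‖
          ≤⟨ *-mono-≤ (‖‖-nonneg (v + w)) (+-nonneg (‖‖-nonneg v) (‖‖-nonneg w)) (‖‖-triangle v w) (‖‖-triangle v w) ⟩
        (‖ v ‖ +ℝ ‖ w ‖) *ℝ (‖ v ‖ +ℝ ‖ w ‖)
          ≈⟨ pointwise _ _
               (λ n → solve 2 (λ a b → (a :+ b) :* (a :+ b) := (a :* b :+ a :* b) :+ (a :* a :+ b :* b)) refl (term ‖ v ‖ n) (term ‖ w ‖ n)) ⟩
        (‖ v ‖ *ℝ ‖ w ‖ +ℝ ‖ v ‖ *ℝ ‖ w ‖) +ℝ (‖ v ‖ *ℝ ‖ v ‖ +ℝ ‖ w ‖ *ℝ ‖ w ‖) ∎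

    -- With t rational the bound (t + M / t) / 2 ≥ √M of T needs no square root;
    -- it gives 2 t N ≤ t² + M, which is used for t close to N.
    norm-of-square : ∀ {N M T S} → IsOperatorNorm H N T → _IsBoundOf_ H M S →
      (∀ v → ⟨ T v , T v ⟩ ≈ℝ ⟨ v , S v ⟩) → N *ℝ N ≤ℝ M
    norm-of-square {N} {M} {T} {S} ((0≤N , _) , least) (0≤M , S-bound) adjoint = ≤-from-2^- λ k →
      let (q , N<q , q≤) = rational-above N k
          (u , 0≤u , uq) = half-inverse 0≤N N<q
      in estimate k q (<⇒≤ N<q) q≤ u 0≤u uq
      where
      ‖Tv‖² : ∀ v → ‖ T v ‖ *ℝ ‖ T v ‖ ≤ℝ M *ℝ (‖ v ‖ *ℝ ‖ v ‖)
      ‖Tv‖² v = begin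
        ‖ T v ‖ *ℝ ‖ T v ‖          ≈⟨ ⟨⟩-‖‖ (T v) ⟨
        ⟨ T v , T v ⟩               ≈⟨ adjoint v ⟩
        ⟨ v , S v ⟩                 ≤⟨ ⟨⟩≤ v (S v) ⟩
        ‖ v ‖ *ℝ ‖ S v ‖            ≤⟨ *-monoˡ-≤ ‖ v ‖ (‖‖-nonneg v) (S-bound v) ⟩
        ‖ v ‖ *ℝ (M *ℝ ‖ v ‖)
          ≈⟨ pointwise _ _ (λ n → solve 2 (λ v m → v :* (m :* v) := m :* (v :* v)) refl (term ‖ v ‖ n) (term M n)) ⟩
        M *ℝ (‖ v ‖ *ℝ ‖ v ‖)       ∎

      module _ (t u : ℚ) (0≤t : 0ℝ ≤ℝ ratℝ t) (0≤u : 0ℝ ≤ℝ ratℝ u) (ut : u ℚ.* t ≡ ½) where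

        b : ℝ
        b = ratℝ u *ℝ (ratℝ t *ℝ ratℝ t +ℝ M)

        0≤b : 0ℝ ≤ℝ b
        0≤b = *-nonneg 0≤u (+-nonneg (0≤x² (ratℝ t)) 0≤M)

        -- The inequality between arithmetic and geometric means: since 2 u t = 1, the difference b²
        -- - M is the square of u (t² - M).
        M≤b² : M ≤ℝ b *ℝ b
        M≤b² = 0≤y-x⇒x≤y (begin
          0ℝ             ≤⟨ 0≤x² (ratℝ u *ℝ (ratℝ t *ℝ ratℝ t -ℝ M)) ⟩
          (ratℝ u *ℝ (ratℝ t *ℝ ratℝ t -ℝ M)) *ℝ (ratℝ u *ℝ (ratℝ t *ℝ ratℝ t -ℝ M))
            ≈⟨ pointwise _ (b *ℝ b -ℝ M) (λ n → trans
                 (solve 3 (λ u t m → (u :* (t :* t :- m)) :* (u :* (t :* t :- m)) :=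
                   (u :* (t :* t :+ m)) :* (u :* (t :* t :+ m)) :- ((u :* t) :+ (u :* t)) :* ((u :* t) :+ (u :* t)) :* m) refl u t (term M n))
                 (trans (cong (λ z → (u ℚ.* (t ℚ.* t ℚ.+ term M n)) ℚ.* (u ℚ.* (t ℚ.* t ℚ.+ term M n)) ℚ.- (z ℚ.+ z) ℚ.* (z ℚ.+ z) ℚ.* term M n) ut)
                   (cong (λ z → (u ℚ.* (t ℚ.* t ℚ.+ term M n)) ℚ.* (u ℚ.* (t ℚ.* t ℚ.+ term M n)) ℚ.- z) (ℚ.*-identityˡ (term M n))))) ⟩
          b *ℝ b -ℝ M    ∎)

        N≤b : N ≤ℝ b
        N≤b = least b (0≤b , λ v → square-cancel-≤ (*-nonneg 0≤b (‖‖-nonneg v)) (begin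
          ‖ T v ‖ *ℝ ‖ T v ‖                ≤⟨ ‖Tv‖² v ⟩
          M *ℝ (‖ v ‖ *ℝ ‖ v ‖)             ≤⟨ *-monoʳ-≤ (‖ v ‖ *ℝ ‖ v ‖) (0≤x² ‖ v ‖) M≤b² ⟩
          (b *ℝ b) *ℝ (‖ v ‖ *ℝ ‖ v ‖)
            ≈⟨ pointwise _ _ (λ n → solve 2 (λ b v → (b :* b) :* (v :* v) := (b :* v) :* (b :* v)) refl (term b n) (term ‖ v ‖ n)) ⟩
          (b *ℝ ‖ v ‖) *ℝ (b *ℝ ‖ v ‖)      ∎))

        2tN≤ : (ratℝ t +ℝ ratℝ t) *ℝ N ≤ℝ ratℝ t *ℝ ratℝ t +ℝ M
        2tN≤ = begin
          (ratℝ t +ℝ ratℝ t) *ℝ N        ≤⟨ *-monoˡ-≤ (ratℝ t +ℝ ratℝ t) (+-nonneg 0≤t 0≤t) N≤b ⟩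
          (ratℝ t +ℝ ratℝ t) *ℝ b        ≈⟨ pointwise _ _ (λ n → trans
                                             (solve 3 (λ t u m → (t :+ t) :* (u :* (t :* t :+ m)) :=
                                                  (u :* t :+ u :* t) :* (t :* t :+ m)) refl t u (term M n))
                                             (trans (cong (λ z → (z ℚ.+ z) ℚ.* (t ℚ.* t ℚ.+ term M n)) ut) (ℚ.*-identityˡ (t ℚ.* t ℚ.+ term M n)))) ⟩
          ratℝ t *ℝ ratℝ t +ℝ M          ∎

      estimate : ∀ k t → N ≤ℝ ratℝ t → ratℝ t ≤ℝ N +ℝ ratℝ (2^- k) → ∀ u → 0ℝ ≤ℝ ratℝ u → u ℚ.* t ≡ ½ →
        N *ℝ N ≤ℝ M +ℝ ratℝ (2^- k)
      estimate k t N≤t t≤ u 0≤u ut = begin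
        N *ℝ N
          ≈⟨ pointwise (N *ℝ N) (((ratℝ t +ℝ ratℝ t) *ℝ N -ℝ ratℝ t *ℝ ratℝ t) +ℝ d *ℝ d)
             (λ n → solve 2 (λ t n → n :* n := ((t :+ t) :* n :- t :* t) :+ (t :- n) :* (t :- n)) refl t (term N n)) ⟩
        ((ratℝ t +ℝ ratℝ t) *ℝ N -ℝ ratℝ t *ℝ ratℝ t) +ℝ d *ℝ d
          ≤⟨ +-mono-≤ (+-monoˡ-≤ (-ℝ (ratℝ t *ℝ ratℝ t)) (2tN≤ t u (≤-trans 0≤N N≤t) 0≤u ut)) d²≤ ⟩
        ((ratℝ t *ℝ ratℝ t +ℝ M) -ℝ ratℝ t *ℝ ratℝ t) +ℝ ratℝ (2^- k)
          ≈⟨ ℝᵣ.+-congʳ {ratℝ (2^- k)} (pointwise _ _ (λ n → solve 2 (λ a m → (a :+ m) :- a := m) refl (t ℚ.* t) (term M n))) ⟩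
        M +ℝ ratℝ (2^- k)                                  ∎
        where
        d : ℝ
        d = ratℝ t -ℝ N
        0≤d : 0ℝ ≤ℝ d
        0≤d = x≤y⇒0≤y-x N≤t
        d≤ : d ≤ℝ ratℝ (2^- k)
        d≤ = begin
          ratℝ t -ℝ N                      ≤⟨ +-monoˡ-≤ (-ℝ N) t≤ ⟩
          (N +ℝ ratℝ (2^- k)) -ℝ N
            ≈⟨ pointwise _ _ (λ n → solve 2 (λ a m → (a :+ m) :- a := m) refl (term N n) (2^- k)) ⟩
          ratℝ (2^- k)                     ∎
        -- One factor is bounded by `2^- k` and the other by 1, which keeps the error linear in
        -- `2^- k`.
        d²≤ : d *ℝ d ≤ℝ ratℝ (2^- k)
        d²≤ = begin
          d *ℝ d
            ≤⟨ *-mono-≤ 0≤d (2^-nonneg k) d≤ (≤-trans d≤ (ratℝ-mono-≤ (Reals.2^-≤1 k))) ⟩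
          ratℝ (2^- k) *ℝ 1ℝ               ≈⟨ ℝᵣ.*-identityʳ (ratℝ (2^- k)) ⟩
          ratℝ (2^- k)                     ∎

    -- ‖v‖² - ‖T v‖² = ‖v - S v‖² when S is self-adjoint and 2 S = S² + T².
    contraction-from-square : ∀ {S T SS TT : Carrier → Carrier} →
      (∀ v → ⟨ S v , S v ⟩ ≈ℝ ⟨ v , SS v ⟩) → (∀ v → ⟨ T v , T v ⟩ ≈ℝ ⟨ v , TT v ⟩) →
      (∀ v → S v + S v ≈ TT v + SS v) → ∀ v → ‖ T v ‖ ≤ℝ ‖ v ‖
    contraction-from-square {S} {T} {SS} {TT} S² T² eq v = square-cancel-≤ (‖‖-nonneg v) (0≤y-x⇒x≤y (begin
      0ℝ                                    ≤⟨ 0≤x² ‖ v - S v ‖ ⟩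
      ‖ v - S v ‖ *ℝ ‖ v - S v ‖            ≈⟨ ‖+‖² v (- S v) ⟩
      (vv +ℝ ⟨ v , - S v ⟩) +ℝ (⟨ v , - S v ⟩ +ℝ ‖ - S v ‖ *ℝ ‖ - S v ‖)
        ≈⟨ +ℝ-cong (ℝᵣ.+-congˡ {vv} (⟨⟩-negʳ v (S v)))
             (+ℝ-cong (⟨⟩-negʳ v (S v)) (≈ℝ-trans (*ℝ-cong (‖-x‖ (S v)) (‖-x‖ (S v))) (≈ℝ-trans (≈ℝ-sym (⟨⟩-‖‖ (S v))) (S² v)))) ⟩
      (vv -ℝ vS) +ℝ ((-ℝ vS) +ℝ vSS)
        ≈⟨ pointwise _ _ (λ n → solve 3 (λ a b c → (a :- b) :+ ((:- b) :+ c) := (a :+ c) :- (b :+ b)) refl (term vv n) (term vS n) (term vSS n)) ⟩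
      (vv +ℝ vSS) -ℝ (vS +ℝ vS)             ≈⟨ ℝᵣ.+-congˡ {vv +ℝ vSS} (-ℝ-cong doubled) ⟩
      (vv +ℝ vSS) -ℝ (vTT +ℝ vSS)
        ≈⟨ pointwise _ _ (λ n → solve 3 (λ a b c → (a :+ c) :- (b :+ c) := a :- b) refl (term vv n) (term vTT n) (term vSS n)) ⟩
      vv -ℝ vTT
        ≈⟨ ℝᵣ.+-congˡ {vv} (-ℝ-cong (≈ℝ-trans (≈ℝ-sym (⟨⟩-‖‖ (T v))) (T² v))) ⟨
      vv -ℝ ‖ T v ‖ *ℝ ‖ T v ‖              ∎))
      where
      vv vS vSS vTT : ℝ
      vv  = ‖ v ‖ *ℝ ‖ v ‖
      vS  = ⟨ v , S v ⟩
      vSS = ⟨ v , SS v ⟩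
      vTT = ⟨ v , TT v ⟩
      doubled : vS +ℝ vS ≈ℝ vTT +ℝ vSS
      doubled = begin-equality
        vS +ℝ vS                       ≈⟨ ⟨⟩-+ʳ v (S v) (S v) ⟨
        ⟨ v , S v + S v ⟩              ≈⟨ ⟨⟩-cong ≈-refl (eq v) ⟩
        ⟨ v , TT v + SS v ⟩            ≈⟨ ⟨⟩-+ʳ v (TT v) (SS v) ⟩
        vTT +ℝ vSS                     ∎

-- Homomorphisms between algebras with trivial involution.

module HermitianIsometry where
  open RealOrder
  open NormedAlgebras
  open InnerProducts
  open Reals using (pointwise; ≈ℝ-sym; ≈ℝ-trans; ≈ℝ-refl; term)
  open +-*-Solver using (solve; _:=_; _:+_; _:*_; _:-_; :-_; con)

  private
    scaled-half : ∀ k → ratℝ ½ *ℝ ratℝ (2^- k) ≈ℝ ratℝ (2^- suc k)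
    scaled-half k = pointwise _ _ λ _ → refl

  module HermitianAlgebra (A : CStarAlgebra real) (hermitian : ∀ x → CStarAlgebra._≈_ A (CStarAlgebra._⋆ A x) x) where
    open CStarAlgebra A using (isBanachAlgebra; _⋆; ⋆-*; hilbertSpace; representation)
    open NormedAlgebra isBanachAlgebra

    private
      module H = NormedSpace (HilbertSpace.isBanachSpace hilbertSpace)
      open HilbertSpace hilbertSpace using (⟨_,_⟩; ⟨⟩-cong)
      open Representation representation
      open RealHilbert hilbertSpace

    commutative : ∀ x y → x * y ≈ y * x
    commutative x y = ≈-trans (≈-sym (hermitian (x * y))) (≈-trans (⋆-* x y) (*-cong (hermitian y) (hermitian x)))

    ⟨π,π⟩ : ∀ x v → ⟨ π x v , π x v ⟩ ≈ℝ ⟨ v , π (x * x) v ⟩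
    ⟨π,π⟩ x v = ≈ℝ-trans (π-⋆ x v (π x v))
      (⟨⟩-cong H.≈-refl (H.≈-trans (π-cong (hermitian x) (π x v)) (H.≈-sym (π-* x x v))))

    ‖x‖²≤‖x²‖ : ∀ x → ‖ x ‖ *ℝ ‖ x ‖ ≤ℝ ‖ x * x ‖
    ‖x‖²≤‖x²‖ x = norm-of-square {‖ x ‖} {‖ x * x ‖} {π x} {π (x * x)} (π-isometric x) (proj₁ (π-isometric (x * x))) (⟨π,π⟩ x)

    half-• : ∀ x → ‖ ratℝ ½ • x ‖ ≈ℝ ratℝ ½ *ℝ ‖ x ‖
    half-• x = ‖•‖ (ratℝ ½) (ratℝ ½) x 0≤½ ≈ℝ-refl

    -- a solution y of 2 y - y² = x², as a fixed point of y ↦ (x² + y²) / 2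
    module SquareRoot (x : Carrier) (‖x‖≤½ : ‖ x ‖ ≤ℝ ratℝ ½) where

      iterate : ℕ → Carrier
      iterate zero    = 0#
      iterate (suc n) = ratℝ ½ • (x * x + iterate n * iterate n)

      product-bound : ∀ a b → ‖ a ‖ ≤ℝ ratℝ ½ → ‖ b ‖ ≤ℝ ratℝ ½ → ‖ a * b ‖ ≤ℝ ratℝ ½ *ℝ ratℝ ½
      product-bound a b p q = ≤-trans (‖‖-submultiplicative a b) (*-mono-≤ (‖‖-nonneg b) 0≤½ p q)

      -- The ball of radius 1/2 is invariant, as both squares have norm at most 1/4 there and their
      -- average is no larger.
      iterate-bound : ∀ n → ‖ iterate n ‖ ≤ℝ ratℝ ½
      iterate-bound zero    = ≤-trans (≈⇒≤ ‖0‖) 0≤½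
      iterate-bound (suc n) = begin
        ‖ iterate (suc n) ‖
          ≈⟨ half-• (x * x + iterate n * iterate n) ⟩
        ratℝ ½ *ℝ ‖ x * x + iterate n * iterate n ‖
          ≤⟨ *-monoˡ-≤ (ratℝ ½) 0≤½ (≤-trans (‖‖-triangle (x * x) (iterate n * iterate n))
             (+-mono-≤ (product-bound x x ‖x‖≤½ ‖x‖≤½) (product-bound _ _ (iterate-bound n) (iterate-bound n)))) ⟩
        ratℝ ½ *ℝ (ratℝ ½ *ℝ ratℝ ½ +ℝ ratℝ ½ *ℝ ratℝ ½)                 ≤⟨ pointwise-≤ (λ _ → ℚ.≤ᵇ⇒≤ _) ⟩
        ratℝ ½                                                           ∎
        where open ≤ℝ-Reasoning

      -- The cross terms cancel because an algebra in which every element is self-adjoint is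
      -- commutative.
      square-difference : ∀ a b → a * a - b * b ≈ (a + b) * (a - b)
      square-difference a b = ≈-sym (begin
        (a + b) * (a - b)                              ≈⟨ distribʳ (a - b) a b ⟩
        a * (a - b) + b * (a - b)                      ≈⟨ +-cong (distribˡ a a (- b)) (distribˡ b a (- b)) ⟩
        (a * a + a * (- b)) + (b * a + b * (- b))
          ≈⟨ +-cong (+-congˡ (*-neg a b)) (+-cong (commutative b a) (*-neg b b)) ⟩
        (a * a - a * b) + (a * b - b * b)              ≈⟨ telescope (a * a) (a * b) (b * b) ⟨
        a * a - b * b                                  ∎)
        where open ≈-Reasoning

      square-difference-bound : ∀ a b → ‖ a * a - b * b ‖ ≤ℝ (‖ a ‖ +ℝ ‖ b ‖) *ℝ ‖ a - b ‖
      square-difference-bound a b = begin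
        ‖ a * a - b * b ‖                ≈⟨ ‖‖-cong (square-difference a b) ⟩
        ‖ (a + b) * (a - b) ‖            ≤⟨ ‖‖-submultiplicative (a + b) (a - b) ⟩
        ‖ a + b ‖ *ℝ ‖ a - b ‖           ≤⟨ *-monoʳ-≤ ‖ a - b ‖ (‖‖-nonneg (a - b)) (‖‖-triangle a b) ⟩
        (‖ a ‖ +ℝ ‖ b ‖) *ℝ ‖ a - b ‖    ∎
        where open ≤ℝ-Reasoning

      -- Two iterates a and b satisfy ‖a‖ + ‖b‖ ≤ 1, so ‖b² - a²‖ ≤ ‖b - a‖, and the factor 1/2 of
      -- the iteration makes each step at most half the bound of the one before.
      step-bound : ∀ n → ‖ iterate (suc n) - iterate n ‖ ≤ℝ ratℝ (2^- n)
      step-bound zero = begin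
        ‖ iterate 1 - 0# ‖             ≤⟨ ‖‖-difference (iterate 1) 0# ⟩
        ‖ iterate 1 ‖ +ℝ ‖ 0# ‖        ≤⟨ +-mono-≤ (iterate-bound 1) (iterate-bound 0) ⟩
        ratℝ ½ +ℝ ratℝ ½               ≈⟨ pointwise _ _ (λ _ → refl) ⟩
        1ℝ                             ∎
        where open ≤ℝ-Reasoning
      step-bound (suc n) = begin
        ‖ iterate (suc (suc n)) - iterate (suc n) ‖    ≈⟨ ‖‖-cong rewritten ⟩
        ‖ ratℝ ½ • (b * b - a * a) ‖                   ≈⟨ half-• (b * b - a * a) ⟩
        ratℝ ½ *ℝ ‖ b * b - a * a ‖                    ≤⟨ *-monoˡ-≤ (ratℝ ½) 0≤½ (begin
          ‖ b * b - a * a ‖                              ≤⟨ square-difference-bound b a ⟩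
          (‖ b ‖ +ℝ ‖ a ‖) *ℝ ‖ b - a ‖
            ≤⟨ *-mono-≤ (‖‖-nonneg (b - a)) (+-nonneg 0≤½ 0≤½) (+-mono-≤ (iterate-bound (suc n)) (iterate-bound n)) (step-bound n) ⟩
          (ratℝ ½ +ℝ ratℝ ½) *ℝ ratℝ (2^- n)             ≈⟨ pointwise _ _ (λ _ → ℚ.*-identityˡ (2^- n)) ⟩
          ratℝ (2^- n)                                   ∎) ⟩
        ratℝ ½ *ℝ ratℝ (2^- n)                         ≈⟨ scaled-half n ⟩
        ratℝ (2^- suc n)                               ∎
        where
        open ≤ℝ-Reasoning
        a b : Carrier
        a = iterate n
        b = iterate (suc n)
        rewritten : iterate (suc (suc n)) - iterate (suc n) ≈ ratℝ ½ • (b * b - a * a)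
        rewritten = ≈-trans (+-congˡ (≈-sym (•-neg (ratℝ ½) (x * x + a * a))))
          (≈-trans (≈-sym (•-distribˡ (ratℝ ½) (x * x + b * b) (- (x * x + a * a))))
            (•-congˡ (≈-trans (sum-difference (x * x) (b * b) (x * x) (a * a))
              (≈-trans (+-congʳ (-‿inverseʳ (x * x))) (+-identityˡ (b * b - a * a))))))

      -- A geometric series, with n varying in the induction: the first step takes one `2^- n` and
      -- the tail starting at `suc n` the other.
      tail-bound : ∀ j n → ‖ iterate (j ℕ.+ n) - iterate n ‖ ≤ℝ ratℝ (2^- n) +ℝ ratℝ (2^- n)
      tail-bound zero n = ≤-trans (≈⇒≤ (x≈y⇒‖x-y‖≈0 ≈-refl)) (+-nonneg (2^-nonneg n) (2^-nonneg n))
      tail-bound (suc j) n = begin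
        ‖ iterate (suc j ℕ.+ n) - iterate n ‖
          ≡⟨ cong (λ m → ‖ iterate m - iterate n ‖) (ℕ.+-suc j n) ⟨
        ‖ iterate (j ℕ.+ suc n) - iterate n ‖
          ≤⟨ ‖‖-telescope (iterate (j ℕ.+ suc n)) (iterate (suc n)) (iterate n) ⟩
        ‖ iterate (j ℕ.+ suc n) - iterate (suc n) ‖ +ℝ ‖ iterate (suc n) - iterate n ‖
          ≤⟨ +-mono-≤ (tail-bound j (suc n)) (step-bound n) ⟩
        (ratℝ (2^- suc n) +ℝ ratℝ (2^- suc n)) +ℝ ratℝ (2^- n)        ≈⟨ ℝᵣ.+-congʳ {ratℝ (2^- n)} (2^-halves n) ⟩
        ratℝ (2^- n) +ℝ ratℝ (2^- n)                                  ∎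
        where open ≤ℝ-Reasoning

      iterate-cauchy : IsCauchy iterate
      -- With N = k + 3 each iterate is within 2^-(k+2) of the N-th one, so two of them differ by at
      -- most 2^-(k+1), which is strictly below `2^- k`.
      iterate-cauchy k = N , λ m n N≤m N≤n → begin-strict
        ‖ iterate m - iterate n ‖
          ≤⟨ ‖‖-telescope (iterate m) (iterate N) (iterate n) ⟩
        ‖ iterate m - iterate N ‖ +ℝ ‖ iterate N - iterate n ‖
          ≤⟨ +-mono-≤ (near m N≤m) (≤-trans (≈⇒≤ (‖x-y‖≈‖y-x‖ (iterate N) (iterate n))) (near n N≤n)) ⟩
        ratℝ (2^- suc (suc k)) +ℝ ratℝ (2^- suc (suc k))           ≈⟨ 2^-halves (suc k) ⟩
        ratℝ (2^- suc k)                                           <⟨ 2^-suc<ℝ k ⟩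
        ratℝ (2^- k)                                               ∎
        where
        open ≤ℝ-Reasoning
        N : ℕ
        N = suc (suc (suc k))
        near : ∀ m → N ℕ.≤ m → ‖ iterate m - iterate N ‖ ≤ℝ ratℝ (2^- suc (suc k))
        near m N≤m = begin
          ‖ iterate m - iterate N ‖                   ≡⟨ cong (λ m → ‖ iterate m - iterate N ‖) (ℕ.m∸n+n≡m N≤m) ⟨
          ‖ iterate (m ℕ.∸ N ℕ.+ N) - iterate N ‖     ≤⟨ tail-bound (m ℕ.∸ N) N ⟩
          ratℝ (2^- N) +ℝ ratℝ (2^- N)                ≈⟨ 2^-halves (suc (suc k)) ⟩
          ratℝ (2^- suc (suc k))                      ∎

      solution : Carrier
      solution = proj₁ (complete iterate iterate-cauchy)

      -- Two successive iterates a and b near the limit y satisfy 2 b = x² + a². Hence 2 y - 2 b and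
      -- a² - y² are both small, and their sum is the defect of the equation at y.
      solves : solution + solution ≈ x * x + solution * solution
      solves = close⇒≈ λ k →
        let (N , near) = proj₂ (complete iterate iterate-cauchy) (suc (suc k))
        in bound k N (<⇒≤ (near N ℕ.≤-refl)) (<⇒≤ (near (suc N) (ℕ.n≤1+n N)))
        where
        open ≤ℝ-Reasoning
        bound : ∀ k n → ‖ iterate n - solution ‖ ≤ℝ ratℝ (2^- suc (suc k)) → ‖ iterate (suc n) - solution ‖ ≤ℝ ratℝ (2^- suc (suc k)) →
          ‖ (solution + solution) - (x * x + solution * solution) ‖ ≤ℝ ratℝ (2^- k)
        bound k n near near′ = begin
          ‖ (y + y) - (x * x + y * y) ‖
            ≤⟨ ‖‖-telescope (y + y) (b + b) (x * x + y * y) ⟩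
          ‖ (y + y) - (b + b) ‖ +ℝ ‖ (b + b) - (x * x + y * y) ‖         ≤⟨ +-mono-≤ first second ⟩
          ratℝ (2^- suc k) +ℝ ratℝ (2^- suc k)                           ≈⟨ 2^-halves k ⟩
          ratℝ (2^- k)                                                   ∎
          where
          a b y : Carrier
          a = iterate n
          b = iterate (suc n)
          y = solution
          ε : ℝ
          ε = ratℝ (2^- suc (suc k))
          ε≤1 : ε ≤ℝ 1ℝ
          ε≤1 = ratℝ-mono-≤ (Reals.2^-≤1 (suc (suc k)))
          near-y : ‖ y - b ‖ ≤ℝ ε
          near-y = ≤-trans (≈⇒≤ (‖x-y‖≈‖y-x‖ y b)) near′
          first : ‖ (y + y) - (b + b) ‖ ≤ℝ ratℝ (2^- suc k)
          first = begin
            ‖ (y + y) - (b + b) ‖          ≈⟨ ‖‖-cong (sum-difference y y b b) ⟩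
            ‖ (y - b) + (y - b) ‖          ≤⟨ ‖‖-triangle (y - b) (y - b) ⟩
            ‖ y - b ‖ +ℝ ‖ y - b ‖         ≤⟨ +-mono-≤ near-y near-y ⟩
            ε +ℝ ε                         ≈⟨ 2^-halves (suc k) ⟩
            ratℝ (2^- suc k)               ∎
          doubled : b + b ≈ x * x + a * a
          doubled = ≈-trans (≈-sym (•-distribʳ (x * x + a * a) (ratℝ ½) (ratℝ ½)))
            (≈-trans (•-congʳ (pointwise _ _ (λ _ → refl))) (•-identityˡ (x * x + a * a)))
          -- This crude bound gives ‖a‖ + ‖y‖ ≤ 2, which just fits the allowance of 2 ε for the
          -- second difference.
          ‖y‖≤ : ‖ y ‖ ≤ℝ 1ℝ +ℝ ratℝ ½
          ‖y‖≤ = begin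
            ‖ y ‖                        ≈⟨ ‖‖-cong (x-y+y≈x b y) ⟨
            ‖ (y - b) + b ‖              ≤⟨ ‖‖-triangle (y - b) b ⟩
            ‖ y - b ‖ +ℝ ‖ b ‖           ≤⟨ +-mono-≤ (≤-trans near-y ε≤1) (iterate-bound (suc n)) ⟩
            1ℝ +ℝ ratℝ ½                 ∎
          second : ‖ (b + b) - (x * x + y * y) ‖ ≤ℝ ratℝ (2^- suc k)
          second = begin
            ‖ (b + b) - (x * x + y * y) ‖
              ≈⟨ ‖‖-cong (≈-trans (+-congʳ doubled)
                   (≈-trans (sum-difference (x * x) (a * a) (x * x) (y * y)) (≈-trans (+-congʳ (-‿inverseʳ (x * x))) (+-identityˡ (a * a - y * y))))) ⟩
            ‖ a * a - y * y ‖                         ≤⟨ square-difference-bound a y ⟩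
            (‖ a ‖ +ℝ ‖ y ‖) *ℝ ‖ a - y ‖
              ≤⟨ *-mono-≤ (‖‖-nonneg (a - y)) (+-nonneg 0≤½ (+-nonneg 0≤1 0≤½)) (+-mono-≤ (iterate-bound n) ‖y‖≤) near ⟩
            (ratℝ ½ +ℝ (1ℝ +ℝ ratℝ ½)) *ℝ ε
              ≈⟨ pointwise _ _ (λ _ → solve 1 (λ e → (con ½ :+ (con 1ℚ :+ con ½)) :* e := e :+ e) refl (2^- suc (suc k))) ⟩
            ε +ℝ ε                                    ≈⟨ 2^-halves (suc k) ⟩
            ratℝ (2^- suc k)                          ∎

    record IsHomomorphism (φ : Carrier → Carrier) : Set where
      field
        φ-cong : ∀ {x y} → x ≈ y → φ x ≈ φ y
        φ-+    : ∀ x y → φ (x + y) ≈ φ x + φ y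
        φ-•    : ∀ c x → φ (c • x) ≈ c • φ x
        φ-*    : ∀ x y → φ (x * y) ≈ φ x * φ y

    module Contractive {φ : Carrier → Carrier} (isHomomorphism : IsHomomorphism φ) where
      open IsHomomorphism isHomomorphism

      -- The equation satisfied by `solution` contains sums and products only, so φ carries it to
      -- `φ x`. It makes `π (φ x)` a contraction, and the norm of `φ x` is the least bound of that
      -- operator.
      unit-bound : ∀ x → ‖ x ‖ ≤ℝ ratℝ ½ → ‖ φ x ‖ ≤ℝ 1ℝ
      unit-bound x h = proj₂ (π-isometric (φ x)) 1ℝ (0≤1 , λ v → ≤-trans
        (contraction-from-square {π z} {π (φ x)} {π (z * z)} {π (φ x * φ x)} (⟨π,π⟩ z) (⟨π,π⟩ (φ x)) equation v)
        (≈⇒≤ (≈ℝ-sym (ℝᵣ.*-identityˡ H.‖ v ‖))))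
        where
        open SquareRoot x h
        z : Carrier
        z = φ solution
        φ-solves : z + z ≈ φ x * φ x + z * z
        φ-solves = begin
          φ solution + φ solution                      ≈⟨ φ-+ solution solution ⟨
          φ (solution + solution)                      ≈⟨ φ-cong solves ⟩
          φ (x * x + solution * solution)              ≈⟨ φ-+ (x * x) (solution * solution) ⟩
          φ (x * x) + φ (solution * solution)          ≈⟨ +-cong (φ-* x x) (φ-* solution solution) ⟩
          φ x * φ x + z * z                            ∎
          where open ≈-Reasoning
        equation : ∀ v → π z v H.+ π z v H.≈ π (φ x * φ x) v H.+ π (z * z) v
        equation v = H.≈-trans (H.≈-sym (π-+ z z v)) (H.≈-trans (π-cong φ-solves v) (π-+ (φ x * φ x) (z * z) v))

      -- Scaling by u = 1 / (2 t) with a rational t just above ‖x‖ brings x into the ball of radius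
      -- 1/2. As t is positive in any case, x = 0 is not a special case.
      double-bound : ∀ x → ‖ φ x ‖ ≤ℝ ‖ x ‖ +ℝ ‖ x ‖
      double-bound x = ≤-from-2^- λ k →
        let (t , x<t , t≤) = rational-above ‖ x ‖ (suc k)
            (u , 0≤u , ut) = half-inverse (‖‖-nonneg x) x<t
        in bound k t (<⇒≤ x<t) t≤ u 0≤u ut
        where
        open ≤ℝ-Reasoning
        bound : ∀ k t → ‖ x ‖ ≤ℝ ratℝ t → ratℝ t ≤ℝ ‖ x ‖ +ℝ ratℝ (2^- suc k) → ∀ u → 0ℝ ≤ℝ ratℝ u → u ℚ.* t ≡ ½ →
          ‖ φ x ‖ ≤ℝ ‖ x ‖ +ℝ ‖ x ‖ +ℝ ratℝ (2^- k)
        bound k t x≤t t≤ u 0≤u ut = begin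
          ‖ φ x ‖
            ≈⟨ pointwise _ _ (λ n → sym (trans (solve 3 (λ t u p → (t :+ t) :* (u :* p) :=
                 (u :* t :+ u :* t) :* p) refl
                 t u (term ‖ φ x ‖ n)) (trans (cong (λ z → (z ℚ.+ z) ℚ.* term ‖ φ x ‖ n) ut) (ℚ.*-identityˡ (term ‖ φ x ‖ n))))) ⟩
          (ratℝ t +ℝ ratℝ t) *ℝ (ratℝ u *ℝ ‖ φ x ‖)
            ≤⟨ *-monoˡ-≤ (ratℝ t +ℝ ratℝ t) (+-nonneg 0≤t 0≤t) scaled ⟩
          (ratℝ t +ℝ ratℝ t) *ℝ 1ℝ                         ≈⟨ ℝᵣ.*-identityʳ (ratℝ t +ℝ ratℝ t) ⟩
          ratℝ t +ℝ ratℝ t                                 ≤⟨ +-mono-≤ t≤ t≤ ⟩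
          (‖ x ‖ +ℝ ratℝ (2^- suc k)) +ℝ (‖ x ‖ +ℝ ratℝ (2^- suc k))
            ≈⟨ pointwise _ _ (λ n → solve 2 (λ x e → (x :+ con ½ :* e) :+ (x :+ con ½ :* e) := (x :+ x) :+ e) refl (term ‖ x ‖ n) (2^- k)) ⟩
          ‖ x ‖ +ℝ ‖ x ‖ +ℝ ratℝ (2^- k)                   ∎
          where
          0≤t : 0ℝ ≤ℝ ratℝ t
          0≤t = ≤-trans (‖‖-nonneg x) x≤t
          scaled : ratℝ u *ℝ ‖ φ x ‖ ≤ℝ 1ℝ
          scaled = begin
            ratℝ u *ℝ ‖ φ x ‖            ≈⟨ ‖•‖ (ratℝ u) (ratℝ u) (φ x) 0≤u ≈ℝ-refl ⟨
            ‖ ratℝ u • φ x ‖             ≈⟨ ‖‖-cong (φ-• (ratℝ u) x) ⟨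
            ‖ φ (ratℝ u • x) ‖           ≤⟨ unit-bound (ratℝ u • x) (begin
              ‖ ratℝ u • x ‖               ≈⟨ ‖•‖ (ratℝ u) (ratℝ u) x 0≤u ≈ℝ-refl ⟩
              ratℝ u *ℝ ‖ x ‖              ≤⟨ *-monoˡ-≤ (ratℝ u) 0≤u x≤t ⟩
              ratℝ u *ℝ ratℝ t             ≈⟨ pointwise _ _ (λ _ → ut) ⟩
              ratℝ ½                       ∎) ⟩
            1ℝ                           ∎

      -- squaring x halves the excess over 1 of the best constant
      excess-bound : ∀ n x → ‖ φ x ‖ ≤ℝ ‖ x ‖ +ℝ ratℝ (2^- n) *ℝ ‖ x ‖
      excess-bound zero x = ≤-trans (double-bound x) (+-monoʳ-≤ ‖ x ‖ (≈⇒≤ (≈ℝ-sym (ℝᵣ.*-identityˡ ‖ x ‖))))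
      excess-bound (suc n) x = square-cancel-≤ (+-nonneg 0≤s (*-nonneg (2^-nonneg (suc n)) 0≤s)) (begin
        ‖ φ x ‖ *ℝ ‖ φ x ‖                                   ≤⟨ ‖x‖²≤‖x²‖ (φ x) ⟩
        ‖ φ x * φ x ‖                                        ≈⟨ ‖‖-cong (φ-* x x) ⟨
        ‖ φ (x * x) ‖                                        ≤⟨ excess-bound n (x * x) ⟩
        ‖ x * x ‖ +ℝ e *ℝ ‖ x * x ‖
          ≤⟨ +-mono-≤ (‖‖-submultiplicative x x) (*-monoˡ-≤ e (2^-nonneg n) (‖‖-submultiplicative x x)) ⟩
        s *ℝ s +ℝ e *ℝ (s *ℝ s)                              ≈⟨ ℝᵣ.+-identityʳ _ ⟨
        -- The added square completes 1 + e to (1 + e / 2)², the square of the next constant.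
        (s *ℝ s +ℝ e *ℝ (s *ℝ s)) +ℝ 0ℝ
          ≤⟨ +-monoʳ-≤ (s *ℝ s +ℝ e *ℝ (s *ℝ s)) (0≤x² (ratℝ (2^- suc n) *ℝ s)) ⟩
        (s *ℝ s +ℝ e *ℝ (s *ℝ s)) +ℝ (ratℝ (2^- suc n) *ℝ s) *ℝ (ratℝ (2^- suc n) *ℝ s)
          ≈⟨ pointwise _ _
               (λ m → solve 2 (λ s e → (s :* s :+ e :* (s :* s)) :+ ((con ½ :* e) :* s) :* ((con ½ :* e) :* s) :=
                    (s :+ (con ½ :* e) :* s) :* (s :+ (con ½ :* e) :* s)) refl (term s m) (2^- n)) ⟩
        (s +ℝ ratℝ (2^- suc n) *ℝ s) *ℝ (s +ℝ ratℝ (2^- suc n) *ℝ s)  ∎)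
        where
        open ≤ℝ-Reasoning
        s e : ℝ
        s = ‖ x ‖
        e = ratℝ (2^- n)
        0≤s : 0ℝ ≤ℝ s
        0≤s = ‖‖-nonneg x

      contractive : ∀ x → ‖ φ x ‖ ≤ℝ ‖ x ‖
      contractive x = ≤-from-2^- λ k →
        let (b , small) = null-multiples ‖ x ‖
        in ≤-trans (excess-bound (b ℕ.+ k) x) (+-monoʳ-≤ ‖ x ‖ (small k))

    module _ {φ : Carrier → Carrier} (isHomomorphism : IsHomomorphism φ) (bijective : Bijective _≈_ _≈_ φ) where
      open IsHomomorphism isHomomorphism
      open Contractive

      private
        inverse : Carrier → Carrier
        inverse y = proj₁ (proj₂ bijective y)

        φ-inverse : ∀ y → φ (inverse y) ≈ y
        φ-inverse y = proj₂ (proj₂ bijective y) ≈-refl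

        injective : ∀ {x y} → φ x ≈ φ y → x ≈ y
        injective = proj₁ bijective

        inverse-isHomomorphism : IsHomomorphism inverse
        inverse-isHomomorphism = record
          { φ-cong = λ {x} {y} h → injective (≈-trans (φ-inverse x) (≈-trans h (≈-sym (φ-inverse y))))
          ; φ-+    = λ x y → injective (≈-trans (φ-inverse (x + y)) (≈-sym (≈-trans (φ-+ _ _) (+-cong (φ-inverse x) (φ-inverse y)))))
          ; φ-•    = λ c x → injective (≈-trans (φ-inverse (c • x)) (≈-sym (≈-trans (φ-• c _) (•-congˡ (φ-inverse x)))))
          ; φ-*    = λ x y → injective (≈-trans (φ-inverse (x * y)) (≈-sym (≈-trans (φ-* _ _) (*-cong (φ-inverse x) (φ-inverse y)))))
          }

      -- The inverse is a homomorphism too, so the contraction estimate applies in both directions.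
      isometric : ∀ x → ‖ φ x ‖ ≈ℝ ‖ x ‖
      isometric x = ≤-antisym (contractive isHomomorphism x) (≤-trans
        (≈⇒≤ (‖‖-cong (≈-sym (injective (φ-inverse (φ x))))))
        (contractive inverse-isHomomorphism (φ x)))

-- Restriction of scalars, and the self-adjoint part as a real C*-algebra.

module RealScalars where
  open RealOrder
  open NormedAlgebras
  open InnerProducts
  open ComplexStructure
  open Reals using (pointwise; ≈ℝ-trans; ≈ℝ-refl; *ℝ-cong; +ℝ-cong; term)
  open +-*-Solver using (solve; _:=_; _:+_; _:*_; _:-_; :-_; con)

  real-* : ∀ a b → ((a , 0ℝ) ℂᵣ.* (b , 0ℝ)) ℂᵣ.≈ (a *ℝ b , 0ℝ)
  real-* a b = pointwise _ _ (λ n → solve 2 (λ a b → a :* b :- con 0ℚ :* con 0ℚ := a :* b) refl (term a n) (term b n))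
             , pointwise _ _ (λ n → solve 2 (λ a b → a :* con 0ℚ :+ con 0ℚ :* b := con 0ℚ) refl (term a n) (term b n))

  real-+ : ∀ a b → ((a , 0ℝ) ℂᵣ.+ (b , 0ℝ)) ℂᵣ.≈ (a +ℝ b , 0ℝ)
  real-+ a b = ≈ℝ-refl , ℝᵣ.+-identityʳ 0ℝ

  real-modulus² : ∀ a → modulus² complex (a , 0ℝ) ≈ℝ modulus² real a
  real-modulus² a = pointwise _ _ λ n → solve 1 (λ a → a :* a :+ con 0ℚ :* con 0ℚ := a :* a) refl (term a n)

  realSpace : RawNormedSpace complex → RawNormedSpace real
  realSpace V = record
    { rawLeftModule = record
      { Carrierᴹ = Carrier ; _≈ᴹ_ = _≈_ ; _+ᴹ_ = _+_ ; _*ₗ_ = λ r x → (r , 0ℝ) • x ; 0ᴹ = 0# ; -ᴹ_ = -_ }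
    ; ‖_‖ = ‖_‖
    }
    where open RawNormedSpace V

  realSpace-isBanachSpace : ∀ {V} → IsBanachSpace V → IsBanachSpace (realSpace V)
  realSpace-isBanachSpace isBanachSpace = record
    { isLeftModule = record
      { isLeftSemimodule = record
        { +ᴹ-isCommutativeMonoid = +ᴹ-isCommutativeMonoid
        ; isPreleftSemimodule = record
          { *ₗ-cong      = λ h → *ₗ-cong (h , ≈ℝ-refl)
          ; *ₗ-zeroˡ     = *ₗ-zeroˡ
          ; *ₗ-distribʳ  = λ x a b → ≈ᴹ-trans (≈ᴹ-sym (*ₗ-congʳ (real-+ a b))) (*ₗ-distribʳ x (a , 0ℝ) (b , 0ℝ))
          ; *ₗ-identityˡ = *ₗ-identityˡ
          ; *ₗ-assoc     = λ a b x → ≈ᴹ-trans (≈ᴹ-sym (*ₗ-congʳ (real-* a b))) (*ₗ-assoc (a , 0ℝ) (b , 0ℝ) x)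
          ; *ₗ-zeroʳ     = λ a → *ₗ-zeroʳ (a , 0ℝ)
          ; *ₗ-distribˡ  = λ a → *ₗ-distribˡ (a , 0ℝ)
          }
        }
      ; -ᴹ‿cong    = -ᴹ‿cong
      ; -ᴹ‿inverse = -ᴹ‿inverse
      }
    ; ‖‖-cong        = ‖‖-cong
    ; ‖‖-nonneg      = ‖‖-nonneg
    ; ‖‖-definite    = ‖‖-definite
    ; ‖‖-homogeneous = λ a x → ≈ℝ-trans (‖‖-homogeneous (a , 0ℝ) x) (ℝᵣ.*-congʳ (real-modulus² a))
    ; ‖‖-triangle    = ‖‖-triangle
    ; complete       = complete
    }
    where
    open IsBanachSpace isBanachSpace
    open IsLeftModule isLeftModule

  module _ (H : HilbertSpace complex) where
    open HilbertSpace H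

    realHilbertSpace : HilbertSpace real
    realHilbertSpace .HilbertSpace.rawNormedSpace  = realSpace rawNormedSpace
    realHilbertSpace .HilbertSpace.isBanachSpace   = realSpace-isBanachSpace isBanachSpace
    realHilbertSpace .HilbertSpace.⟨_,_⟩ x y       = proj₁ ⟨ x , y ⟩
    realHilbertSpace .HilbertSpace.⟨⟩-cong p q     = proj₁ (⟨⟩-cong p q)
    realHilbertSpace .HilbertSpace.⟨⟩-+ x y z      = proj₁ (⟨⟩-+ x y z)
    realHilbertSpace .HilbertSpace.⟨⟩-• a x y      = ≈ℝ-trans (proj₁ (⟨⟩-• (a , 0ℝ) x y))
      (pointwise _ _
        (λ n → solve 3 (λ a b c → a :* b :- con 0ℚ :* c := a :* b) refl (term a n) (term (proj₁ ⟨ x , y ⟩) n) (term (proj₂ ⟨ x , y ⟩) n)))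
    realHilbertSpace .HilbertSpace.⟨⟩-conj x y     = proj₁ (⟨⟩-conj x y)
    realHilbertSpace .HilbertSpace.⟨⟩-‖‖ x         = proj₁ (⟨⟩-‖‖ x)

  represented : ∀ {F} {A : RawStarAlgebra F} {H : HilbertSpace F} →
    Representation A H → IsBanachStarAlgebra A → IsCStarAlgebra A
  represented {H = H} representation isBanachStarAlgebra = record
    { isBanachStarAlgebra = isBanachStarAlgebra ; hilbertSpace = H ; representation = representation }

  module SelfAdjointPart (B : CStarAlgebra complex) (abelian : IsAbelian B) where
    open RealAndImaginaryParts B abelian
    open CStarAlgebra B using (hilbertSpace; representation)

    A : RawStarAlgebra real
    A = selfAdjointPart B abelian

    private
      module R = IsBanachSpace (realSpace-isBanachSpace isBanachSpace)
      module RM = IsLeftModule R.isLeftModule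

    -- The involution is isometric, so x⋆ is as close to a self-adjoint y as x is.
    isSelfAdjoint-closed : ∀ {x} → (∀ k → ∃[ y ] IsSelfAdjoint y × ‖ y - x ‖ ≤ℝ ratℝ (2^- k)) → IsSelfAdjoint x
    isSelfAdjoint-closed {x} approximable = close⇒≈ λ k → close k (approximable (suc k))
      where
      open ≤ℝ-Reasoning
      close : ∀ k → ∃[ y ] IsSelfAdjoint y × ‖ y - x ‖ ≤ℝ ratℝ (2^- suc k) → ‖ x ⋆ - x ‖ ≤ℝ ratℝ (2^- k)
      close k (y , y⋆≈y , h) = begin
        ‖ x ⋆ - x ‖                               ≤⟨ ‖‖-telescope (x ⋆) y x ⟩
        ‖ x ⋆ - y ‖ +ℝ ‖ y - x ‖
          ≈⟨ +ℝ-cong (‖‖-cong (≈-trans (+-congˡ (-‿cong (≈-sym y⋆≈y))) (≈-trans (+-congˡ (≈-sym (neg-⋆ y))) (≈-sym (⋆-+ x (- y)))))) ≈ℝ-refl ⟩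
        ‖ (x - y) ⋆ ‖ +ℝ ‖ y - x ‖
          ≈⟨ +ℝ-cong (≈ℝ-trans (⋆-isometric (x - y)) (‖x-y‖≈‖y-x‖ x y)) ≈ℝ-refl ⟩
        ‖ y - x ‖ +ℝ ‖ y - x ‖                    ≤⟨ +-mono-≤ h h ⟩
        ratℝ (2^- suc k) +ℝ ratℝ (2^- suc k)      ≈⟨ 2^-halves k ⟩
        ratℝ (2^- k)                              ∎

    isBanachStarAlgebraᴬ : IsBanachStarAlgebra A
    isBanachStarAlgebraᴬ = record
      { isBanachAlgebra = record
        { isBanachSpace = record
          { isLeftModule = record
            { isLeftSemimodule = record
              { +ᴹ-isCommutativeMonoid = record
                { isMonoid = record
                  { isSemigroup = record
                    { isMagma = record
                      { isEquivalence = record { refl = ≈-refl ; sym = ≈-sym ; trans = ≈-trans }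
                      ; ∙-cong = +-cong
                      }
                    ; assoc = λ (x , _) (y , _) (z , _) → +-assoc x y z
                    }
                  ; identity = (λ (x , _) → +-identityˡ x) , (λ (x , _) → +-identityʳ x)
                  }
                ; comm = λ (x , _) (y , _) → +-comm x y
                }
              ; isPreleftSemimodule = record
                { *ₗ-cong      = RM.*ₗ-cong
                ; *ₗ-zeroˡ     = λ (x , _) → RM.*ₗ-zeroˡ x
                ; *ₗ-distribʳ  = λ (x , _) → RM.*ₗ-distribʳ x
                ; *ₗ-identityˡ = λ (x , _) → RM.*ₗ-identityˡ x
                ; *ₗ-assoc     = λ a b (x , _) → RM.*ₗ-assoc a b x
                ; *ₗ-zeroʳ     = RM.*ₗ-zeroʳ
                ; *ₗ-distribˡ  = λ a (x , _) (y , _) → RM.*ₗ-distribˡ a x y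
                }
              }
            ; -ᴹ‿cong    = -‿cong
            ; -ᴹ‿inverse = (λ (x , _) → -‿inverseˡ x) , (λ (x , _) → -‿inverseʳ x)
            }
          ; ‖‖-cong        = ‖‖-cong
          ; ‖‖-nonneg      = λ (x , _) → ‖‖-nonneg x
          ; ‖‖-definite    = λ (x , _) → ‖‖-definite x
          ; ‖‖-homogeneous = λ a (x , _) → R.‖‖-homogeneous a x
          ; ‖‖-triangle    = λ (x , _) (y , _) → ‖‖-triangle x y
          ; complete       = λ s cauchy →
              let (x , s→x) = complete (λ n → proj₁ (s n)) cauchy
              in (x , isSelfAdjoint-closed λ k →
                    let (N , near) = s→x k in proj₁ (s N) , proj₂ (s N) , <⇒≤ (near N ℕ.≤-refl))
               , s→x
          }
        ; *-cong    = *-cong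
        ; *-assoc   = λ (x , _) (y , _) (z , _) → *-assoc x y z
        ; distrib   = (λ (x , _) (y , _) (z , _) → distribˡ x y z) , (λ (x , _) (y , _) (z , _) → distribʳ x y z)
        ; •-*-assoc = λ a (x , _) (y , _) → •-*-assoc (a , 0ℝ) x y
        ; *-•-comm  = λ a (x , _) (y , _) → *-•-comm (a , 0ℝ) x y
        ; ‖‖-submultiplicative = λ (x , _) (y , _) → ‖‖-submultiplicative x y
        }
      ; ⋆-cong       = ⋆-cong
      ; ⋆-+          = λ (x , _) (y , _) → ⋆-+ x y
      ; ⋆-•          = λ a (x , _) → real-⋆ a x
      ; ⋆-*          = λ (x , _) (y , _) → ⋆-* x y
      ; ⋆-involutive = λ (x , _) → ⋆-involutive x
      ; ⋆-isometric  = λ (x , _) → ⋆-isometric x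
      }

    private
      module H = NormedSpace (HilbertSpace.isBanachSpace hilbertSpace)
      module HC where
        open RawNormedSpace (HilbertSpace.rawNormedSpace hilbertSpace) public using (_•_)
        open ComplexSpace (HilbertSpace.isBanachSpace hilbertSpace) public using (complex-•; ‖i•‖)
      open Representation representation
      module PL a = LeftModuleMorphisms.IsLeftModuleHomomorphism (BoundedOperator.isLinear (operator a))

    π-0 : ∀ v → π 0# v H.≈ H.0#
    π-0 v = H.≈-trans (π-cong (≈-sym (•-zeroˡ 0#)) v) (H.≈-trans (π-• ℂᵣ.0# 0# v) (H.•-zeroˡ (π 0# v)))

    π-neg : ∀ a v → π (- a) v H.≈ H.- π a v
    π-neg a v = H.inverseˡ-unique (π (- a) v) (π a v)
      (H.≈-trans (H.≈-sym (π-+ (- a) a v)) (H.≈-trans (π-cong (-‿inverseˡ a) v) (π-0 v)))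

    restrict : BoundedOperator hilbertSpace → BoundedOperator (realHilbertSpace hilbertSpace)
    restrict T = record
      { apply    = T.apply
      ; isLinear = record { +ᴹ-isGroupHomomorphism = T.+ᴹ-isGroupHomomorphism ; *ₗ-homo = λ a → T.*ₗ-homo (a , 0ℝ) }
      ; bounded  = T.bounded
      }
      where
      module T where
        open BoundedOperator T public
        open LeftModuleMorphisms.IsLeftModuleHomomorphism isLinear public

    -- A limit of operators π a is ℂ-linear, so that π-closed of B applies; the
    -- limits of the a's in A and in B agree, as π is isometric.
    module Limit (T : BoundedOperator (realHilbertSpace hilbertSpace))
      (approximable : ∀ k → ∃[ a ] _IsBoundOf_ hilbertSpace (ratℝ (2^- k)) (λ v → BoundedOperator.apply T v H.- π (proj₁ {B = IsSelfAdjoint} a) v)) where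
      module T where
        open BoundedOperator T public
        open LeftModuleMorphisms.IsLeftModuleHomomorphism isLinear public
      open T using (apply)

      -- Each `π a` commutes with i and T is a limit of such operators in norm. The exponent b from
      -- `null-multiples` absorbs the norm of the fixed vector v.
      i-linear : ∀ v → apply (i HC.• v) H.≈ i HC.• apply v
      i-linear v = H.close⇒≈ λ k →
        let (b , small) = null-multiples H.‖ v ‖ in close k b small (approximable (b ℕ.+ suc k))
        where
        open ≤ℝ-Reasoning
        close : ∀ k b → (∀ k → ratℝ (2^- (b ℕ.+ k)) *ℝ H.‖ v ‖ ≤ℝ ratℝ (2^- k)) →
          ∃[ a ] _IsBoundOf_ hilbertSpace (ratℝ (2^- (b ℕ.+ suc k))) (λ v → apply v H.- π (proj₁ {B = IsSelfAdjoint} a) v) →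
          H.‖ apply (i HC.• v) H.- i HC.• apply v ‖ ≤ℝ ratℝ (2^- k)
        close k b small ((a , _) , _ , near) = begin
          H.‖ apply iv H.- i HC.• apply v ‖
            ≤⟨ H.‖‖-telescope (apply iv) (π a iv) (i HC.• apply v) ⟩
          H.‖ apply iv H.- π a iv ‖ +ℝ H.‖ π a iv H.- i HC.• apply v ‖
            ≈⟨ ℝᵣ.+-congˡ {H.‖ apply iv H.- π a iv ‖} rotate ⟩
          H.‖ apply iv H.- π a iv ‖ +ℝ H.‖ apply v H.- π a v ‖
            ≤⟨ +-mono-≤ (near iv) (near v) ⟩
          ε *ℝ H.‖ iv ‖ +ℝ ε *ℝ H.‖ v ‖
            ≈⟨ ℝᵣ.+-congʳ {ε *ℝ H.‖ v ‖} (ℝᵣ.*-congˡ {ε} (HC.‖i•‖ v)) ⟩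
          ε *ℝ H.‖ v ‖ +ℝ ε *ℝ H.‖ v ‖
            ≤⟨ +-mono-≤ (small (suc k)) (small (suc k)) ⟩
          ratℝ (2^- suc k) +ℝ ratℝ (2^- suc k)                                           ≈⟨ 2^-halves k ⟩
          ratℝ (2^- k)                                                                   ∎
          where
          ε : ℝ
          ε = ratℝ (2^- (b ℕ.+ suc k))
          iv : H.Carrier
          iv = i HC.• v
          rotate : H.‖ π a iv H.- i HC.• apply v ‖ ≈ℝ H.‖ apply v H.- π a v ‖
          rotate = begin-equality
            H.‖ π a iv H.- i HC.• apply v ‖
              ≈⟨ H.‖‖-cong (H.+-cong (PL.*ₗ-homo a i v) (H.≈-sym (H.•-neg i (apply v)))) ⟩
            H.‖ i HC.• π a v H.+ i HC.• (H.- apply v) ‖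
              ≈⟨ H.‖‖-cong (H.•-distribˡ i (π a v) (H.- apply v)) ⟨
            H.‖ i HC.• (π a v H.- apply v) ‖                   ≈⟨ HC.‖i•‖ (π a v H.- apply v) ⟩
            H.‖ π a v H.- apply v ‖                            ≈⟨ H.‖x-y‖≈‖y-x‖ (π a v) (apply v) ⟩
            H.‖ apply v H.- π a v ‖                            ∎

      complex-linear : ∀ c v → apply (c HC.• v) H.≈ c HC.• apply v
      complex-linear (a , b) v = begin
        apply ((a , b) HC.• v)                                               ≈⟨ T.⟦⟧-cong (HC.complex-• a b v) ⟩
        apply ((a , 0ℝ) HC.• v H.+ i HC.• (b , 0ℝ) HC.• v)                   ≈⟨ T.+ᴹ-homo _ _ ⟩
        apply ((a , 0ℝ) HC.• v) H.+ apply (i HC.• (b , 0ℝ) HC.• v)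
          ≈⟨ H.+-cong (T.*ₗ-homo a v) (i-linear _) ⟩
        (a , 0ℝ) HC.• apply v H.+ i HC.• apply ((b , 0ℝ) HC.• v)
          ≈⟨ H.+-congˡ (H.•-congˡ (T.*ₗ-homo b v)) ⟩
        (a , 0ℝ) HC.• apply v H.+ i HC.• (b , 0ℝ) HC.• apply v               ≈⟨ HC.complex-• a b (apply v) ⟨
        (a , b) HC.• apply v                                                 ∎
        where open H.≈-Reasoning

      complexOperator : BoundedOperator hilbertSpace
      complexOperator = record
        { apply    = apply
        ; isLinear = record { +ᴹ-isGroupHomomorphism = T.+ᴹ-isGroupHomomorphism ; *ₗ-homo = complex-linear }
        ; bounded  = T.bounded
        }

      closed : ∃[ a ] ∀ v → π a v H.≈ apply v
      closed = π-closed complexOperator λ k → let ((a , _) , h) = approximable k in a , h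

      closed-selfAdjoint : IsSelfAdjoint (proj₁ closed)
      closed-selfAdjoint = isSelfAdjoint-closed λ k →
        let ((a , a⋆≈a) , (0≤ε , near)) = approximable k
        in a , a⋆≈a , proj₂ (π-isometric (a - proj₁ closed)) (ratℝ (2^- k)) (0≤ε , λ v → ≤-trans
             (≈⇒≤ (≈ℝ-trans (H.‖‖-cong (H.≈-trans (π-+ a (- proj₁ closed) v) (H.+-congˡ (H.≈-trans (π-neg (proj₁ closed) v) (H.-‿cong (proj₂ closed v))))))
               (H.‖x-y‖≈‖y-x‖ (π a v) (apply v))))
             (near v))

    representationᴬ : Representation A (realHilbertSpace hilbertSpace)
    representationᴬ = record
      { operator    = λ a → restrict (operator (proj₁ a))
      ; π-cong      = π-cong
      ; π-+         = λ a b → π-+ (proj₁ a) (proj₁ b)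
      ; π-•         = λ r a → π-• (r , 0ℝ) (proj₁ a)
      ; π-*         = λ a b → π-* (proj₁ a) (proj₁ b)
      ; π-⋆         = λ a v w → proj₁ (π-⋆ (proj₁ a) v w)
      ; π-isometric = λ a → π-isometric (proj₁ a)
      ; π-closed    = λ T h → (proj₁ (Limit.closed T h) , Limit.closed-selfAdjoint T h) , proj₂ (Limit.closed T h)
      }

    isCStarAlgebraᴬ : IsCStarAlgebra A
    isCStarAlgebraᴬ = represented representationᴬ isBanachStarAlgebraᴬ

    algebraᴬ : CStarAlgebra real
    algebraᴬ = record { isCStarAlgebra = isCStarAlgebraᴬ }

    -- The C*-identity is read off from the representation, viewed over the reals, where
    -- `norm-of-square` gives one inequality. The other is submultiplicativity with the isometric
    -- involution.
    ‖x‖²≈‖x⋆x‖ : ∀ x → ‖ x ‖ *ℝ ‖ x ‖ ≈ℝ ‖ x ⋆ * x ‖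
    ‖x‖²≈‖x⋆x‖ x = ≤-antisym
      (RealHilbert.norm-of-square (realHilbertSpace hilbertSpace) {‖ x ‖} {‖ x ⋆ * x ‖} {π x} {π (x ⋆ * x)}
        (π-isometric x) (proj₁ (π-isometric (x ⋆ * x)))
        (λ v → proj₁ (ℂᵣ.trans (π-⋆ x v (π x v)) (⟨⟩-cong H.≈-refl (H.≈-sym (π-* (x ⋆) x v))))))
      (≤-trans (‖‖-submultiplicative (x ⋆) x) (≈⇒≤ (*ℝ-cong (⋆-isometric x) ≈ℝ-refl)))
      where open HilbertSpace hilbertSpace using (⟨⟩-cong)

-- Categoricity of the self-adjoint part, with and without involution.

module HermitianCategoricity where
  open RealOrder
  open ComputableFunctions
  open NormedAlgebras
  open RationalPolynomials
  open HermitianIsometry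
  open Reals using (≈ℝ-refl)

  module GeneratedSets {F} (A : CStarAlgebra F) where
    open CStarAlgebra A using (rawStarAlgebra; rawNormedAlgebra; isBanachAlgebra)
    open NormedAlgebra isBanachAlgebra
    open CStar rawStarAlgebra

    ≈⇒close : ∀ {x y} k → x ≈ y → ‖ x - y ‖ <ℝ ratℝ (2^- k)
    ≈⇒close k h = ≤-<-trans (≈⇒≤ (x≈y⇒‖x-y‖≈0 h)) (2^-pos k)

    -- `Generated` has no constructor for the equality of the setoid; `limit` with a constant
    -- approximation takes its place.
    generated-resp : ∀ {a x y} → x ≈ y → Generated a x → Generated a y
    generated-resp h g = limit λ k → _ , g , ≈⇒close k h

  module HermitianPresentations (A : CStarAlgebra real) (hermitian : ∀ x → CStarAlgebra._≈_ A (CStarAlgebra._⋆ A x) x) where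
    open CStarAlgebra A using (rawStarAlgebra; rawNormedAlgebra; isBanachAlgebra; _⋆)
    open NormedAlgebra isBanachAlgebra
    open HermitianAlgebra A hermitian using (isometric)
    open GeneratedSets A
    private
      module S = CStar rawStarAlgebra
      module B = Banach rawNormedAlgebra

    module _ {a : Points Carrier} where
      open Points a

      unstarred : ∀ {x} → S.Generated a x → B.Generated a x
      unstarred (S.special i)  = B.special i
      unstarred S.zero         = B.zero
      unstarred (S.add g h)    = B.add (unstarred g) (unstarred h)
      unstarred (S.scale c g)  = B.scale c (unstarred g)
      unstarred (S.mul g h)    = B.mul (unstarred g) (unstarred h)
      unstarred (S.star {x} g) = B.limit λ k → x , unstarred g , ≈⇒close k (≈-sym (hermitian x))
      unstarred (S.limit h)    = B.limit λ k → let (y , g , close) = h k in y , unstarred g , close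

      starred : ∀ {x} → B.Generated a x → S.Generated a x
      starred (B.special i)  = S.special i
      starred B.zero         = S.zero
      starred (B.add g h)    = S.add (starred g) (starred h)
      starred (B.scale c g)  = S.scale c (starred g)
      starred (B.mul g h)    = S.mul (starred g) (starred h)
      starred (B.limit h)    = S.limit λ k → let (y , g , close) = h k in y , starred g , close

      forget-star : Translation (S.letters a) (B.letters a) (λ x → x)
      forget-star = renaming-translation isBanachAlgebra {f = proj₁} var₀ λ where
        (i , false) → ≈-refl
        (i , true)  → ≈-sym (hermitian (point i))

      add-star : Translation (B.letters a) (S.letters a) (λ x → x)
      add-star = renaming-translation isBanachAlgebra {f = _, false} (id-computable ,ᶜ const-computable false) (λ _ → ≈-refl)

      unstarred-presentation : S.IsComputablePresentation a → B.IsComputablePresentation a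
      unstarred-presentation h = record
        { generates      = λ x → unstarred (generates x)
        ; normComputable = norm-transfer isBanachAlgebra add-star (λ _ → ≈ℝ-refl) normComputable
        }
        where open S.IsComputablePresentation h

      starred-presentation : B.IsComputablePresentation a → S.IsComputablePresentation a
      starred-presentation h = record
        { generates      = λ x → starred (generates x)
        ; normComputable = norm-transfer isBanachAlgebra forget-star (λ _ → ≈ℝ-refl) normComputable
        }
        where open B.IsComputablePresentation h

    starIsomorphism : ∀ {φ} → B.IsIsometricIsomorphism φ → S.IsStarIsomorphism φ
    starIsomorphism {φ} h = record
      { isLinear  = isLinear
      ; *-homo    = *-homo
      ; ⋆-homo    = λ x → ≈-trans (⟦⟧-cong (hermitian x)) (≈-sym (hermitian (φ x)))
      ; bijective = bijective
      }
      where
      open B.IsIsometricIsomorphism h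
      open LeftModuleMorphisms.IsLeftModuleHomomorphism isLinear using (⟦⟧-cong)

    isometricIsomorphism : ∀ {φ} → S.IsStarIsomorphism φ → B.IsIsometricIsomorphism φ
    isometricIsomorphism {φ} h = record
      { isLinear  = isLinear
      ; *-homo    = *-homo
      ; isometric = isometric (record { φ-cong = ⟦⟧-cong ; φ-+ = +ᴹ-homo ; φ-• = *ₗ-homo ; φ-* = *-homo }) bijective
      ; bijective = bijective
      }
      where
      open S.IsStarIsomorphism h
      open LeftModuleMorphisms.IsLeftModuleHomomorphism isLinear using (⟦⟧-cong; +ᴹ-homo; *ₗ-homo)

    private
      linear-cong : ∀ {φ} → LeftModuleMorphisms.IsLeftModuleHomomorphism rawLeftModule rawLeftModule φ → ∀ {x y} → x ≈ y → φ x ≈ φ y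
      linear-cong = LeftModuleMorphisms.IsLeftModuleHomomorphism.⟦⟧-cong

    -- The same map serves in both settings. Its procedure is wrapped in translations that add or
    -- drop stars, which leave the values of the points unchanged.
    star⇒banach : S.ComputablyCategorical → B.ComputablyCategorical
    star⇒banach categorical a a⁺ p p⁺ =
      let (φ , iso , computable) = categorical a a⁺ (starred-presentation p) (starred-presentation p⁺)
      in φ , isometricIsomorphism iso
       , map-transfer isBanachAlgebra isBanachAlgebra add-star forget-star (linear-cong (S.IsStarIsomorphism.isLinear iso)) (λ _ _ → ≤-refl) computable

    banach⇒star : B.ComputablyCategorical → S.ComputablyCategorical
    banach⇒star categorical a a⁺ p p⁺ =
      let (φ , iso , computable) = categorical a a⁺ (unstarred-presentation p) (unstarred-presentation p⁺)
      in φ , starIsomorphism iso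
       , map-transfer isBanachAlgebra isBanachAlgebra forget-star add-star (linear-cong (B.IsIsometricIsomorphism.isLinear iso)) (λ _ _ → ≤-refl) computable

-- From presentations of A to presentations of B, and restriction of isomorphisms.

module InducedPresentations where
  open RealOrder
  open ComputableFunctions
  open ComplexStructure
  open RationalPolynomials
  open ApproximateRoots
  open HermitianCategoricity
  open RealScalars
  open Reals using (pointwise; ≈ℝ-sym; ≈ℝ-refl)

  module SelfAdjointPresentations (B : CStarAlgebra complex) (abelian : IsAbelian B) where
    open RealAndImaginaryParts B abelian public
    open SelfAdjointPart B abelian public using (A; algebraᴬ; isBanachStarAlgebraᴬ; ‖x‖²≈‖x⋆x‖)
    rawB : RawStarAlgebra complex
    rawB = CStarAlgebra.rawStarAlgebra B

    module A where
      open RawStarAlgebra A public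
      open IsBanachStarAlgebra isBanachStarAlgebraᴬ public using (isBanachAlgebra)
      open CStar A public
      open GeneratedSets algebraᴬ public

    module CB where
      open CStar rawB public
      open GeneratedSets B public

    module _ (x : Points A.Carrier) where
      private
        y : Points Carrier
        y = mapPoints proj₁ x
        module X = Letters (A.letters x)
        module Y = Letters (CB.letters y)

      value-agrees : ∀ l → Y.value l ≈ proj₁ (X.value l)
      value-agrees (i , false) = ≈-refl
      value-agrees (i , true)  = ≈-refl

      word-agrees : ∀ w → Y.word w ≈ proj₁ (X.word w)
      word-agrees (l ∷ ls) = go l ls
        where
        go : ∀ l ls → Y.word (l ∷ ls) ≈ proj₁ (X.word (l ∷ ls))
        go l []       = value-agrees l
        go l (m ∷ ms) = *-cong (value-agrees l) (go m ms)

      complexification : Translation (A.letters x) (CB.letters y) proj₁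
      complexification = record
        { translate  = complexCoefficients
        ; computable = complexCoefficients-computable
        ; correct    = ⟦map⟧ A.isBanachAlgebra isBanachAlgebra (A.letters x) (CB.letters y) proj₁ ≈-refl (λ _ _ → ≈-refl)
            (λ (q , w) → •-cong (≈ℝ-refl , pointwise _ _ (λ _ → refl)) (word-agrees w))
        }

      module _ (q r : ℚᵘ) (w : List⁺ Y.Letter) where
        private
          a b : ℝ
          a = ratℝ (fromℚᵘ q)
          b = ratℝ (fromℚᵘ r)
          v : Carrier
          v = proj₁ (X.word w)
          v⋆≈v : IsSelfAdjoint v
          v⋆≈v = proj₂ (X.word w)

        -- The word is a product in A and therefore self-adjoint, so taking the real part affects
        -- the coefficient only.
        re-monomial : (a , 0ℝ) • v ≈ re ((a , b) • Y.word w)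
        re-monomial = ≈-sym (begin
          re ((a , b) • Y.word w)              ≈⟨ re-cong (•-congˡ (word-agrees w)) ⟩
          re ((a , b) • v)                     ≈⟨ re-• a b v ⟩
          (a , 0ℝ) • re v - (b , 0ℝ) • im v
            ≈⟨ +-cong (•-congˡ (re-selfAdjoint v⋆≈v)) (-‿cong (≈-trans (•-congˡ (im-selfAdjoint v⋆≈v)) (•-zeroʳ (b , 0ℝ)))) ⟩
          (a , 0ℝ) • v - 0#                    ≈⟨ +-congˡ neg-zero ⟩
          (a , 0ℝ) • v + 0#                    ≈⟨ +-identityʳ ((a , 0ℝ) • v) ⟩
          (a , 0ℝ) • v                         ∎)
          where open ≈-Reasoning

        im-monomial : (b , 0ℝ) • v ≈ im ((a , b) • Y.word w)
        im-monomial = ≈-sym (begin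
          im ((a , b) • Y.word w)              ≈⟨ im-cong (•-congˡ (word-agrees w)) ⟩
          im ((a , b) • v)                     ≈⟨ im-• a b v ⟩
          (a , 0ℝ) • im v + (b , 0ℝ) • re v
            ≈⟨ +-cong (≈-trans (•-congˡ (im-selfAdjoint v⋆≈v)) (•-zeroʳ (a , 0ℝ))) (•-congˡ (re-selfAdjoint v⋆≈v)) ⟩
          0# + (b , 0ℝ) • v                    ≈⟨ +-identityˡ ((b , 0ℝ) • v) ⟩
          (b , 0ℝ) • v                         ∎)
          where open ≈-Reasoning

        ⋆-monomial : fromRational complex (q , ℚᵘ.- r) • Y.word w ≈ ((a , b) • Y.word w) ⋆
        ⋆-monomial = begin
          fromRational complex (q , ℚᵘ.- r) • Y.word w
            ≈⟨ •-cong (≈ℝ-refl , pointwise _ _ (λ _ → fromℚᵘ-homo-neg r)) (word-agrees w) ⟩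
          (a , -ℝ b) • v                                 ≈⟨ •-congˡ v⋆≈v ⟨
          (a , -ℝ b) • v ⋆                               ≈⟨ ⋆-• (a , b) v ⟨
          ((a , b) • v) ⋆                                ≈⟨ ⋆-cong (•-congˡ (word-agrees w)) ⟨
          ((a , b) • Y.word w) ⋆                         ∎
          where open ≈-Reasoning

      re-0 : re 0# ≈ 0#
      re-0 = re-selfAdjoint 0-selfAdjoint

      im-0 : im 0# ≈ 0#
      im-0 = im-selfAdjoint 0-selfAdjoint

      realPart-translation : Translation (CB.letters y) (A.letters x) realPart
      realPart-translation = record
        { translate  = realCoefficients
        ; computable = realCoefficients-computable
        ; correct    = ⟦map⟧ isBanachAlgebra A.isBanachAlgebra (CB.letters y) (A.letters x) realPart re-0 (λ u v → re-+ u v)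
            (λ ((q , r) , w) → re-monomial q r w)
        }

      imaginaryPart-translation : Translation (CB.letters y) (A.letters x) imaginaryPart
      imaginaryPart-translation = record
        { translate  = imaginaryCoefficients
        ; computable = imaginaryCoefficients-computable
        ; correct    = ⟦map⟧ isBanachAlgebra A.isBanachAlgebra (CB.letters y) (A.letters x) imaginaryPart im-0 (λ u v → im-+ u v)
            (λ ((q , r) , w) → im-monomial q r w)
        }

      conjugate-translation : Translation (CB.letters y) (CB.letters y) _⋆
      conjugate-translation = record
        { translate  = conjugate
        ; computable = conjugate-computable
        ; correct    = ⟦map⟧ isBanachAlgebra isBanachAlgebra (CB.letters y) (CB.letters y) _⋆ 0-selfAdjoint ⋆-+
            (λ ((q , r) , w) → ⋆-monomial q r w)
        }

      generated-A⇒B : ∀ {z} → A.Generated x z → CB.Generated y (proj₁ z)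
      generated-A⇒B (CStar.special i) = CStar.special i
      generated-A⇒B CStar.zero        = CStar.zero
      generated-A⇒B (CStar.add g h)   = CStar.add (generated-A⇒B g) (generated-A⇒B h)
      generated-A⇒B (CStar.scale c g) = CStar.scale (c , 0ℝ) (generated-A⇒B g)
      generated-A⇒B (CStar.mul g h)   = CStar.mul (generated-A⇒B g) (generated-A⇒B h)
      generated-A⇒B (CStar.star g)    = CStar.star (generated-A⇒B g)
      generated-A⇒B (CStar.limit h)   = CStar.limit λ k → let (z , g , close) = h k in proj₁ z , generated-A⇒B g , close

      -- ‖z‖² = ‖z⋆ z‖, and z⋆ z is self-adjoint.
      norm-computable : NormIsComputable (A.letters x) → NormIsComputable (CB.letters y)
      norm-computable (e , norm) = approximation.program after pair (precision.program after right) (e after query.program) , λ p k →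
        -- The computed root is off by at most twice `2^- K`, which is 2^-(k+1) and so strictly
        -- below `2^- k`. The query asks for `K + K` digits because it concerns the square.
        let K               = suc (suc k)
            s               = realCoefficients (conjugate p ⊛ p)
            (q , run , close) = norm s (K ℕ.+ K)
        in approximate-root K q
         , after⇓ (pair⇓ (after⇓ right⇓ (precision.correct k)) (after⇓ (query.correct (p , k)) run)) (approximation.correct (K , q))
         , correct p k q close
        where
        open ≤ℝ-Reasoning
        module precision = Computable {a = ⌜_⌝ℕ} {b = ⌜_⌝ℕ} {f = λ k → suc (suc k)} (suc-computable (suc-computable id-computable))
        module approximation = Computable {a = ⌜_⌝ℕ ⊗ ⌜_⌝ℚ} {b = ⌜_⌝ℚ} {f = λ (K , q) → approximate-root K q}
          (approximate-root-computable (fst id-computable) (snd id-computable))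
        module query = Computable {a = Y.⌜_⌝ ⊗ ⌜_⌝ℕ} {b = X.⌜_⌝ ⊗ ⌜_⌝ℕ}
          {f = λ (p , k) → realCoefficients (conjugate p ⊛ p) , suc (suc k) ℕ.+ suc (suc k)}
          (realCoefficients-computable ∘ᶜ ⊛-computable (conjugate-computable ∘ᶜ fst id-computable) (fst id-computable)
            ,ᶜ +-computable (suc-computable (suc-computable (snd id-computable))) (suc-computable (suc-computable (snd id-computable))))
        square : ∀ p → A.‖ X.⟦ realCoefficients (conjugate p ⊛ p) ⟧ ‖ ≈ℝ ‖ Y.⟦ p ⟧ ‖ *ℝ ‖ Y.⟦ p ⟧ ‖
        square p = begin-equality
          A.‖ X.⟦ realCoefficients (conjugate p ⊛ p) ⟧ ‖
            ≈⟨ ‖‖-cong (Translation.correct realPart-translation (conjugate p ⊛ p)) ⟩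
          ‖ re Y.⟦ conjugate p ⊛ p ⟧ ‖
            ≈⟨ ‖‖-cong (re-cong (Products.⟦⊛⟧ isBanachAlgebra (CB.letters y) (conjugate p) p)) ⟩
          ‖ re (Y.⟦ conjugate p ⟧ * z) ‖
            ≈⟨ ‖‖-cong (re-cong (*-congʳ (Translation.correct conjugate-translation p))) ⟩
          ‖ re (z ⋆ * z) ‖
            ≈⟨ ‖‖-cong (re-selfAdjoint (≈-trans (⋆-* (z ⋆) z) (*-congˡ (⋆-involutive z)))) ⟩
          ‖ z ⋆ * z ‖                                        ≈⟨ ‖x‖²≈‖x⋆x‖ z ⟨
          ‖ z ‖ *ℝ ‖ z ‖                                     ∎
          where
          z : Carrier
          z = Y.⟦ p ⟧
        correct : ∀ p k q → ∣ A.‖ X.⟦ realCoefficients (conjugate p ⊛ p) ⟧ ‖ -ℝ ratℝ (fromℚᵘ q) ∣ℝ <ℝ ratℝ (2^- (suc (suc k) ℕ.+ suc (suc k))) →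
          ∣ ‖ Y.⟦ p ⟧ ‖ -ℝ ratℝ (fromℚᵘ (approximate-root (suc (suc k)) q)) ∣ℝ <ℝ ratℝ (2^- k)
        correct p k q close = begin-strict
          ∣ ‖ Y.⟦ p ⟧ ‖ -ℝ ratℝ (fromℚᵘ (approximate-root (suc (suc k)) q)) ∣ℝ
            ≤⟨ approximate-root-close (suc (suc k)) q (‖‖-nonneg Y.⟦ p ⟧)
                 (≤-<-trans (≈⇒≤ (∣∣-cong (ℝᵣ.+-congʳ { -ℝ ratℝ (fromℚᵘ q)} (≈ℝ-sym (square p))))) close) ⟩
          ratℝ (2^- suc (suc k)) +ℝ ratℝ (2^- suc (suc k))    ≈⟨ 2^-halves (suc k) ⟩
          ratℝ (2^- suc k)                                   <⟨ 2^-suc<ℝ k ⟩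
          ratℝ (2^- k)                                       ∎

      induced-presentation : A.IsComputablePresentation x → CB.IsComputablePresentation y
      induced-presentation h = record
        { generates      = λ z → CB.generated-resp (≈-sym (decomposition z))
            (CStar.add (generated-A⇒B (generates (realPart z))) (CStar.scale i (generated-A⇒B (generates (imaginaryPart z)))))
        ; normComputable = norm-computable normComputable
        }
        where open A.IsComputablePresentation h

    module Restricted {Φ : Carrier → Carrier} (isStarIsomorphism : CB.IsStarIsomorphism Φ) where
      open CB.IsStarIsomorphism isStarIsomorphism
      open LeftModuleMorphisms.IsLeftModuleHomomorphism isLinear

      φ : A.Carrier → A.Carrier
      φ (x , x⋆≈x) = Φ x , ≈-trans (≈-sym (⋆-homo x)) (⟦⟧-cong x⋆≈x)

      φ-isStarIsomorphism : A.IsStarIsomorphism φ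
      φ-isStarIsomorphism = record
        { isLinear = record
          { +ᴹ-isGroupHomomorphism = record
            { isMonoidHomomorphism = record
              { isMagmaHomomorphism = record
                { isRelHomomorphism = record { cong = ⟦⟧-cong }
                ; homo = λ (x , _) (y , _) → +ᴹ-homo x y
                }
              ; ε-homo = 0ᴹ-homo
              }
            ; ⁻¹-homo = λ (x , _) → -ᴹ-homo x
            }
          ; *ₗ-homo = λ r (x , _) → *ₗ-homo (r , 0ℝ) x
          }
        ; *-homo = λ (x , _) (y , _) → *-homo x y
        ; ⋆-homo = λ (x , _) → ⋆-homo x
        -- The preimage of a self-adjoint element is self-adjoint: Φ takes the same value at x⋆ and
        -- at x and is injective.
        ; bijective = proj₁ bijective , λ (y , y⋆≈y) →
            let (x , x↦y) = proj₂ bijective y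
                Φx≈y = x↦y ≈-refl
            in (x , proj₁ bijective (≈-trans (⋆-homo x) (≈-trans (⋆-cong Φx≈y) (≈-trans y⋆≈y (≈-sym Φx≈y))))) , x↦y
        }

      -- The approximation found in B may lie outside A. Its real part is a rational point of A and
      -- no further from the self-adjoint target, as `re` is a contraction fixing that target.
      φ-computable : ∀ x x⁺ → IsComputableMap (CB.letters (mapPoints proj₁ x)) (CB.letters (mapPoints proj₁ x⁺)) Φ →
        IsComputableMap (A.letters x) (A.letters x⁺) φ
      φ-computable x x⁺ = map-transfer {A = A.rawNormedAlgebra} {A₁ = rawNormedAlgebra} A.isBanachAlgebra isBanachAlgebra
        {X = A.letters x} {Y = A.letters x⁺} {X₁ = CB.letters (mapPoints proj₁ x)} {Y₁ = CB.letters (mapPoints proj₁ x⁺)}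
        {g = proj₁} {h = realPart} {φ = Φ} {ψ = φ} (complexification x) (realPart-translation x⁺) ⟦⟧-cong
        λ (z , z⋆≈z) y → ≤-trans
          (≈⇒≤ (‖‖-cong (≈-sym (≈-trans (re-+ (Φ z) (- y)) (+-cong (re-selfAdjoint (proj₂ (φ (z , z⋆≈z)))) (re-neg y))))))
          (‖re‖≤ (Φ z - y))

    complex⇒real : CB.ComputablyCategorical → A.ComputablyCategorical
    complex⇒real categorical x x⁺ p p⁺ =
      let (Φ , iso , computable) = categorical (mapPoints proj₁ x) (mapPoints proj₁ x⁺) (induced-presentation x p) (induced-presentation x⁺ p⁺)
      in Restricted.φ iso , Restricted.φ-isStarIsomorphism iso , Restricted.φ-computable iso x x⁺ computable

-- From presentations of B to presentations of A, and complexification of isomorphisms.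

module DoubledPresentations where
  open RealOrder
  open ComputableFunctions
  open NormedAlgebras
  open ComplexStructure
  open RationalPolynomials
  open InducedPresentations
  open import Data.Integer.Base as ℤ using (+_; -[1+_])
  open Reals using (pointwise; ≈ℝ-refl)

  bit : Bool → ℕ
  bit false = 0
  bit true  = 1

  interleave : ℕ → Bool → ℕ
  interleave n b = bit b ℕ.+ (n ℕ.+ n)

  increment : ℕ × Bool → ℕ × Bool
  increment (n , b) = (if b then suc n else n) , not b

  -- Quotient and remainder by 2, obtained by counting up, so that `natrec-computable` applies
  -- directly.
  halve : ℕ → ℕ × Bool
  halve = natrec (0 , false) (λ _ → increment)

  halve-interleave : ∀ n b → halve (interleave n b) ≡ (n , b)
  halve-interleave zero    false = refl
  halve-interleave zero    true  = refl
  halve-interleave (suc n) b     = trans (cong (λ m → halve (bit b ℕ.+ suc m)) (ℕ.+-suc n n)) (shift b (n ℕ.+ n) (halve-interleave n b))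
    where
    shift : ∀ b m → halve (bit b ℕ.+ m) ≡ (n , b) → halve (bit b ℕ.+ suc (suc m)) ≡ (suc n , b)
    shift false m eq = cong (λ u → increment (increment u)) eq
    shift true  m eq = cong (λ u → increment (increment u)) eq

  double : Length → Length
  double (finite n) = finite (n ℕ.* 2)
  double infinite   = infinite

  toFin : Bool → Fin 2
  toFin false = Fin.zero
  toFin true  = Fin.suc Fin.zero

  fromFin : Fin 2 → Bool
  fromFin Fin.zero    = false
  fromFin (Fin.suc _) = true

  toℕ-toFin : ∀ b → toℕ (toFin b) ≡ bit b
  toℕ-toFin false = refl
  toℕ-toFin true  = refl

  toFin-fromFin : ∀ i → toFin (fromFin i) ≡ i
  toFin-fromFin Fin.zero            = refl
  toFin-fromFin (Fin.suc Fin.zero) = refl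

  position : ∀ {ℓ} → Index ℓ → ℕ
  position {finite n} i = toℕ i
  position {infinite} i = i

  code-position : ∀ {ℓ} (i : Index ℓ) → ⌜ position i ⌝ℕ ≡ ⌜ i ⌝index
  code-position {finite n} i = refl
  code-position {infinite} i = refl

  join : ∀ {ℓ} → Index ℓ × Bool → Index (double ℓ)
  join {finite n} (i , b) = combine i (toFin b)
  join {infinite} (i , b) = interleave i b

  split : ∀ {ℓ} → Index (double ℓ) → Index ℓ × Bool
  split {finite n} j = proj₁ (remQuot {n} 2 j) , fromFin (proj₂ (remQuot {n} 2 j))
  split {infinite} j = halve j

  split-join : ∀ {ℓ} (u : Index ℓ × Bool) → split {ℓ} (join u) ≡ u
  split-join {finite n} (i , false) = cong (λ v → proj₁ v , fromFin (proj₂ v)) (Fin.remQuot-combine i (toFin false))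
  split-join {finite n} (i , true)  = cong (λ v → proj₁ v , fromFin (proj₂ v)) (Fin.remQuot-combine i (toFin true))
  split-join {infinite} (i , b)     = halve-interleave i b

  position-combine : ∀ {n} (i : Fin n) (b : Fin 2) → toℕ (combine i b) ≡ interleave (toℕ i) (fromFin b)
  position-combine i b = trans (Fin.toℕ-combine i b) (trans (ℕ.+-comm (2 ℕ.* toℕ i) (toℕ b))
    (cong₂ ℕ._+_ (trans (cong toℕ (sym (toFin-fromFin b))) (toℕ-toFin (fromFin b))) (cong (toℕ i ℕ.+_) (ℕ.+-identityʳ (toℕ i)))))

  -- `combine` lists pairs by rows of length 2, so it too sends the pair to position 2 i + b. One
  -- program thus serves finite and infinite presentations.
  position-join : ∀ {ℓ} (u : Index ℓ × Bool) → position {double ℓ} (join u) ≡ interleave (position (proj₁ u)) (proj₂ u)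
  position-join {finite n} (i , false) = position-combine i (toFin false)
  position-join {finite n} (i , true)  = position-combine i (toFin true)
  position-join {infinite} (i , b)     = refl

  position-split : ∀ {ℓ} (j : Index (double ℓ)) → halve (position {double ℓ} j) ≡ (position (proj₁ (split {ℓ} j)) , proj₂ (split {ℓ} j))
  position-split {finite n} j = trans (cong (λ k → halve (toℕ k)) (sym (Fin.combine-remQuot {n} 2 j)))
    (trans (cong halve (position-combine (proj₁ (remQuot {n} 2 j)) (proj₂ (remQuot {n} 2 j)))) (halve-interleave _ _))
  position-split {infinite} j = refl

  join-computable : ∀ {ℓ} → Computable (⌜_⌝index {ℓ} ⊗ ⌜_⌝bool) (⌜_⌝index {double ℓ}) (join {ℓ})
  join-computable {ℓ} = recode _ _ _ _ (λ u → position (proj₁ u) , proj₂ u)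
    (λ u → cong (_∙ ⌜ proj₂ u ⌝bool) (code-position (proj₁ u)))
    (λ u → trans (cong ⌜_⌝ℕ (sym (position-join {ℓ} u))) (code-position {double ℓ} (join u)))
    interleave-computable
    where
    interleave-computable : Computable (⌜_⌝ℕ ⊗ ⌜_⌝bool) ⌜_⌝ℕ (λ u → interleave (proj₁ u) (proj₂ u))
    interleave-computable = +-computable
      (cast (λ u → bit-if (proj₂ u)) (if-computable (snd id-computable) (const-computable 1) (const-computable 0)))
      (+-computable (fst id-computable) (fst id-computable))
      where
      bit-if : ∀ b → (if b then 1 else 0) ≡ bit b
      bit-if false = refl
      bit-if true  = refl

  split-computable : ∀ {ℓ} → Computable (⌜_⌝index {double ℓ}) (⌜_⌝index {ℓ} ⊗ ⌜_⌝bool) (split {ℓ})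
  split-computable {ℓ} = recode _ _ _ _ (position {double ℓ}) (code-position {double ℓ})
    (λ j → trans (cong (⌜_⌝ℕ ⊗ ⌜_⌝bool) (position-split {ℓ} j)) (cong (_∙ ⌜ proj₂ (split {ℓ} j) ⌝bool) (code-position {ℓ} (proj₁ (split {ℓ} j)))))
    halve-computable
    where
    halve-computable : Computable ⌜_⌝ℕ (⌜_⌝ℕ ⊗ ⌜_⌝bool) halve
    halve-computable = natrec-computable id-computable (const-computable (0 , false))
      (if-computable (snd var₁) (suc-computable (fst var₁)) (fst var₁) ,ᶜ not-computable (snd var₁))

  ½ᵘ -½ᵘ -1ᵘ : ℚᵘ
  ½ᵘ  = mkℚᵘ (+ 1) 1
  -½ᵘ = mkℚᵘ -[1+ 0 ] 1
  -1ᵘ = mkℚᵘ -[1+ 0 ] 0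

  module Doubled (B : CStarAlgebra complex) (abelian : IsAbelian B) where
    open SelfAdjointPresentations B abelian

    part : Carrier × Bool → A.Carrier
    part (x , false) = realPart x
    part (x , true)  = imaginaryPart x

    re-difference : ∀ x y → re x - re y ≈ re (x - y)
    re-difference x y = ≈-sym (≈-trans (re-+ x (- y)) (+-congˡ (re-neg y)))

    im-difference : ∀ x y → im x - im y ≈ im (x - y)
    im-difference x y = ≈-sym (≈-trans (im-+ x (- y)) (+-congˡ (im-neg y)))

    module _ (a : Points Carrier) where
      open Points a

      parts : Points A.Carrier
      parts = points (double length) λ j → part (point (proj₁ (split {length} j)) , proj₂ (split {length} j))

      parts-join : ∀ u → Points.point parts (join {length} u) ≡ part (point (proj₁ u) , proj₂ u)
      parts-join u = cong (λ v → part (point (proj₁ v) , proj₂ v)) (split-join {length} u)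

      private
        b : Points Carrier
        b = mapPoints proj₁ parts
        module X = Letters (CB.letters a)
        module Y = Letters (CB.letters b)

      -- Negation is not a constructor of `Generated`; it is recovered as scaling by -1.
      negate : ∀ {z} → A.Generated parts z → A.Generated parts (A.- z)
      negate {z} g = A.generated-resp (NormedAlgebra.≈-trans A.isBanachAlgebra {A._•_ (-ℝ 1ℝ) z} {A.- (A._•_ 1ℝ z)} {A.- z}
        (NormedAlgebra.neg-• A.isBanachAlgebra 1ℝ z)
        (-‿cong (NormedAlgebra.•-identityˡ A.isBanachAlgebra z))) (CStar.scale (-ℝ 1ℝ) g)

      -- Both parts go through the induction together, since either part of a product or of a
      -- complex multiple involves both parts of the factors.
      generated-parts : ∀ {z} → CB.Generated a z → A.Generated parts (realPart z) × A.Generated parts (imaginaryPart z)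
      generated-parts (CStar.special i) =
          subst (A.Generated parts) (parts-join (i , false)) (CStar.special (join {length} (i , false)))
        , subst (A.Generated parts) (parts-join (i , true)) (CStar.special (join {length} (i , true)))
      generated-parts CStar.zero =
          A.generated-resp (≈-sym (re-selfAdjoint 0-selfAdjoint)) CStar.zero
        , A.generated-resp (≈-sym (im-selfAdjoint 0-selfAdjoint)) CStar.zero
      generated-parts (CStar.add {x} {y} g h) =
        let (p , q) = generated-parts g ; (r , s) = generated-parts h
        in A.generated-resp (≈-sym (re-+ x y)) (CStar.add p r)
         , A.generated-resp (≈-sym (im-+ x y)) (CStar.add q s)
      generated-parts (CStar.scale (c , d) {x} g) =
        let (p , q) = generated-parts g
        in A.generated-resp (≈-sym (re-• c d x)) (CStar.add (CStar.scale c p) (negate (CStar.scale d q)))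
         , A.generated-resp (≈-sym (im-• c d x)) (CStar.add (CStar.scale c q) (CStar.scale d p))
      generated-parts (CStar.mul {x} {y} g h) =
        let (p , q) = generated-parts g ; (r , s) = generated-parts h
        in A.generated-resp (≈-sym (re-* x y)) (CStar.add (CStar.mul p r) (negate (CStar.mul q s)))
         , A.generated-resp (≈-sym (im-* x y)) (CStar.add (CStar.mul p s) (CStar.mul q r))
      generated-parts (CStar.star {x} g) =
        let (p , q) = generated-parts g
        in A.generated-resp (≈-sym (re-⋆ x)) p , A.generated-resp (≈-sym (im-⋆ x)) (negate q)
      generated-parts (CStar.limit {x} h) =
          CStar.limit (λ k → let (y , g , close) = h k in
            realPart y , proj₁ (generated-parts g) , ≤-<-trans (≤-trans (≈⇒≤ (‖‖-cong (re-difference y x))) (‖re‖≤ (y - x))) close)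
        , CStar.limit (λ k → let (y , g , close) = h k in
            imaginaryPart y , proj₂ (generated-parts g) , ≤-<-trans (≤-trans (≈⇒≤ (‖‖-cong (im-difference y x))) (‖im‖≤ (y - x))) close)

      -- The formulas are re a = a / 2 + a⋆ / 2 and im a = -(i / 2) a + (i / 2) a⋆. The star of the
      -- letter itself is dropped, as the parts are self-adjoint.
      toPoints : Y.Letter → Polynomial complex X.Letter
      toPoints (j , _) =
        if proj₂ (split {length} j)
          then ((0ℚᵘ , -½ᵘ) , (proj₁ (split {length} j) , false) ∷ []) ∷ ((0ℚᵘ , ½ᵘ) , (proj₁ (split {length} j) , true) ∷ []) ∷ []
          else ((½ᵘ , 0ℚᵘ) , (proj₁ (split {length} j) , false) ∷ []) ∷ ((½ᵘ , 0ℚᵘ) , (proj₁ (split {length} j) , true) ∷ []) ∷ []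

      -- Here a = re a + i im a and a⋆ = re a - i im a, so a star on the letter shows only in the
      -- sign of the second coefficient.
      toParts : X.Letter → Polynomial complex Y.Letter
      toParts (i , s) =
        ((1ℚᵘ , 0ℚᵘ) , (join {length} (i , false) , false) ∷ []) ∷
        ((0ℚᵘ , (if s then -1ᵘ else 1ℚᵘ)) , (join {length} (i , true) , false) ∷ []) ∷ []

      toPoints-computable : Computable Y.code (polyCode {F = complex} X.code) toPoints
      toPoints-computable = if-computable (snd (split-computable {length} ∘ᶜ fst id-computable))
        (∷-computable (const-computable (0ℚᵘ , -½ᵘ) ,ᶜ letter false) (∷-computable (const-computable (0ℚᵘ , ½ᵘ) ,ᶜ letter true) (const-computable [])))
        (∷-computable (const-computable (½ᵘ , 0ℚᵘ) ,ᶜ letter false) (∷-computable (const-computable (½ᵘ , 0ℚᵘ) ,ᶜ letter true) (const-computable [])))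
        where
        letter : ∀ s → Computable Y.code (wordCode X.code) (λ l → (proj₁ (split {length} (proj₁ l)) , s) ∷ [])
        letter s = word-computable (fst (split-computable {length} ∘ᶜ fst id-computable) ,ᶜ const-computable s) (const-computable [])

      toParts-computable : Computable X.code (polyCode {F = complex} Y.code) toParts
      toParts-computable = ∷-computable (const-computable (1ℚᵘ , 0ℚᵘ) ,ᶜ letter false)
        (∷-computable ((const-computable 0ℚᵘ ,ᶜ if-computable (snd id-computable) (const-computable -1ᵘ) (const-computable 1ℚᵘ)) ,ᶜ letter true)
          (const-computable []))
        where
        letter : ∀ s → Computable X.code (wordCode Y.code) (λ l → (join {length} (proj₁ l , s) , false) ∷ [])
        letter s = word-computable (join-computable {length} ∘ᶜ (fst id-computable ,ᶜ const-computable s) ,ᶜ const-computable false) (const-computable [])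

      value-part : ∀ j s → Y.value (j , s) ≈ proj₁ (part (point (proj₁ (split {length} j)) , proj₂ (split {length} j)))
      value-part j false = ≈-refl
      value-part j true  = proj₂ (Points.point parts j)

      ⟦toPoints⟧ : ∀ l → X.⟦ toPoints l ⟧ ≈ Y.value l
      ⟦toPoints⟧ (j , s) = ≈-trans (evaluate (proj₁ (split {length} j)) (proj₂ (split {length} j))) (≈-sym (value-part j s))
        where
        evaluate : ∀ i b → X.⟦ (if b
            then ((0ℚᵘ , -½ᵘ) , (i , false) ∷ []) ∷ ((0ℚᵘ , ½ᵘ) , (i , true) ∷ []) ∷ []
            else ((½ᵘ , 0ℚᵘ) , (i , false) ∷ []) ∷ ((½ᵘ , 0ℚᵘ) , (i , true) ∷ []) ∷ []) ⟧ ≈ proj₁ (part (point i , b))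
        evaluate i false = ≈-trans (+-cong (•-congʳ half) (≈-trans (+-identityʳ _) (•-congʳ half)))
          (≈-sym (•-distribˡ halfℂ (point i) (point i ⋆)))
          where
          half : fromRational complex (½ᵘ , 0ℚᵘ) ℂᵣ.≈ halfℂ
          half = pointwise _ _ (λ _ → refl) , pointwise _ _ (λ _ → refl)
        evaluate i true = ≈-trans (+-cong (•-congʳ (pointwise _ _ (λ _ → refl) , pointwise _ _ (λ _ → refl)))
            (≈-trans (+-identityʳ _) (≈-trans (•-congʳ {point i ⋆} {_} {ℂᵣ.- -i/2} (pointwise _ _ (λ _ → refl) , pointwise _ _ (λ _ → refl)))
              (≈-trans (neg-• -i/2 (point i ⋆)) (≈-sym (•-neg -i/2 (point i ⋆)))))))
          (≈-sym (•-distribˡ -i/2 (point i) (- point i ⋆)))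

      ⟦toParts⟧ : ∀ l → Y.⟦ toParts l ⟧ ≈ X.value l
      ⟦toParts⟧ (k , s) = ≈-trans
        (+-cong (≈-trans (•-congʳ (pointwise _ _ (λ _ → refl) , pointwise _ _ (λ _ → refl))) (≈-trans (•-identityˡ _) (joined false)))
          (≈-trans (+-identityʳ _) (•-congˡ (joined true))))
        (evaluate s)
        where
        joined : ∀ b → proj₁ (Points.point parts (join {length} (k , b))) ≈ proj₁ (part (point k , b))
        joined b = subst (λ u → proj₁ (Points.point parts (join {length} (k , b))) ≈ proj₁ u) (parts-join (k , b)) ≈-refl
        evaluate : ∀ s → re (point k) + fromRational complex (0ℚᵘ , (if s then -1ᵘ else 1ℚᵘ)) • im (point k) ≈ X.value (k , s)
        evaluate false = ≈-trans (+-congˡ (•-congʳ (pointwise _ _ (λ _ → refl) , pointwise _ _ (λ _ → refl))))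
          (≈-sym (decomposition (point k)))
        evaluate true = ≈-trans (+-congˡ (≈-trans (•-congʳ {im (point k)} {_} {ℂᵣ.- i} (pointwise _ _ (λ _ → refl) , pointwise _ _ (λ _ → refl)))
            (≈-trans (neg-• i (im (point k))) (≈-sym (•-neg i (im (point k)))))))
          (≈-sym (⋆-decomposition (point k)))

      toPoints-translation : Translation (CB.letters b) (CB.letters a) (λ x → x)
      toPoints-translation = record
        { translate  = substitute toPoints
        ; computable = substitute-computable toPoints-computable
        ; correct    = Substitution.⟦substitute⟧ isBanachAlgebra abelian (CB.letters b) (CB.letters a) ⟦toPoints⟧
        }

      toParts-translation : Translation (CB.letters a) (CB.letters b) (λ x → x)
      toParts-translation = record
        { translate  = substitute toParts
        ; computable = substitute-computable toParts-computable
        ; correct    = Substitution.⟦substitute⟧ isBanachAlgebra abelian (CB.letters a) (CB.letters b) ⟦toParts⟧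
        }

      inclusion-translation : Translation (A.letters parts) (CB.letters a) proj₁
      inclusion-translation = record
        { translate  = λ p → T.translate (S.translate p)
        ; computable = T.computable ∘ᶜ S.computable
        ; correct    = λ p → ≈-trans (T.correct (S.translate p)) (S.correct p)
        }
        where
        module S = Translation (complexification parts)
        module T = Translation toPoints-translation

      parts-presentation : CB.IsComputablePresentation a → A.IsComputablePresentation parts
      parts-presentation h = record
        -- A self-adjoint x is its own real part, so its generation in B yields one in A.
        { generates      = λ (x , x⋆≈x) → A.generated-resp (re-selfAdjoint x⋆≈x) (proj₁ (generated-parts (generates x)))
        ; normComputable = norm-transfer isBanachAlgebra {X = A.letters parts} {Y = CB.letters a} inclusion-translation (λ _ → ≈ℝ-refl) normComputable
        }
        where open CB.IsComputablePresentation h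

    module Complexified {φ : A.Carrier → A.Carrier} (isStarIsomorphism : A.IsStarIsomorphism φ) where
      open A.IsStarIsomorphism isStarIsomorphism
      open LeftModuleMorphisms.IsLeftModuleHomomorphism isLinear

      φ₁ : A.Carrier → Carrier
      φ₁ x = proj₁ (φ x)

      φ-sa : ∀ x → IsSelfAdjoint (φ₁ x)
      φ-sa x = proj₂ (φ x)

      Φ : Carrier → Carrier
      Φ z = φ₁ (realPart z) + i• φ₁ (imaginaryPart z)

      Φ-cong : ∀ {z w} → z ≈ w → Φ z ≈ Φ w
      Φ-cong h = +i-cong (⟦⟧-cong (re-cong h)) (⟦⟧-cong (im-cong h))

      re-Φ : ∀ z → re (Φ z) ≈ φ₁ (realPart z)
      re-Φ z = re-unique (φ-sa (realPart z)) (φ-sa (imaginaryPart z)) ≈-refl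

      im-Φ : ∀ z → im (Φ z) ≈ φ₁ (imaginaryPart z)
      im-Φ z = im-unique (φ-sa (realPart z)) (φ-sa (imaginaryPart z)) ≈-refl

      φ-difference : ∀ x y → φ₁ (x A.- y) ≈ φ₁ x - φ₁ y
      φ-difference x y = ≈-trans (+ᴹ-homo x (A.- y)) (+-congˡ (-ᴹ-homo y))

      Φ-+ : ∀ z w → Φ (z + w) ≈ Φ z + Φ w
      Φ-+ z w = ≈-trans (+i-cong (≈-trans (⟦⟧-cong (re-+ z w)) (+ᴹ-homo (realPart z) (realPart w)))
        (≈-trans (⟦⟧-cong (im-+ z w)) (+ᴹ-homo (imaginaryPart z) (imaginaryPart w)))) (≈-sym (+i-+ _ _ _ _))

      Φ-0 : Φ 0# ≈ 0#
      Φ-0 = ≈-trans (+i-cong (≈-trans (⟦⟧-cong (re-selfAdjoint 0-selfAdjoint)) 0ᴹ-homo) (≈-trans (⟦⟧-cong (im-selfAdjoint 0-selfAdjoint)) 0ᴹ-homo))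
        (≈-sym (selfAdjoint-+i0 0#))

      Φ-neg : ∀ z → Φ (- z) ≈ - Φ z
      Φ-neg z = ≈-trans (+i-cong (≈-trans (⟦⟧-cong (re-neg z)) (-ᴹ-homo (realPart z)))
        (≈-trans (⟦⟧-cong (im-neg z)) (-ᴹ-homo (imaginaryPart z)))) (≈-sym (+i-neg _ _))

      Φ-• : ∀ c z → Φ (c • z) ≈ c • Φ z
      Φ-• (a , b) z = ≈-trans (+i-cong
          (≈-trans (⟦⟧-cong (re-• a b z)) (≈-trans (φ-difference (a A.• realPart z) (b A.• imaginaryPart z))
            (+-cong (*ₗ-homo a (realPart z)) (-‿cong (*ₗ-homo b (imaginaryPart z))))))
          (≈-trans (⟦⟧-cong (im-• a b z)) (≈-trans (+ᴹ-homo (a A.• imaginaryPart z) (b A.• realPart z))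
            (+-cong (*ₗ-homo a (imaginaryPart z)) (*ₗ-homo b (realPart z))))))
        (≈-sym (+i-• a b _ _))

      Φ-* : ∀ z w → Φ (z * w) ≈ Φ z * Φ w
      Φ-* z w = ≈-trans (+i-cong
          (≈-trans (⟦⟧-cong (re-* z w)) (≈-trans (φ-difference (realPart z A.* realPart w) (imaginaryPart z A.* imaginaryPart w))
            (+-cong (*-homo (realPart z) (realPart w)) (-‿cong (*-homo (imaginaryPart z) (imaginaryPart w))))))
          (≈-trans (⟦⟧-cong (im-* z w)) (≈-trans (+ᴹ-homo (realPart z A.* imaginaryPart w) (imaginaryPart z A.* realPart w))
            (+-cong (*-homo (realPart z) (imaginaryPart w)) (*-homo (imaginaryPart z) (realPart w))))))
        (≈-sym (+i-* _ _ _ _))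

      Φ-⋆ : ∀ z → Φ (z ⋆) ≈ Φ z ⋆
      Φ-⋆ z = ≈-trans (+i-cong (⟦⟧-cong (re-⋆ z)) (≈-trans (⟦⟧-cong (im-⋆ z)) (-ᴹ-homo (imaginaryPart z))))
        (≈-trans (+-congˡ (•-neg i _)) (≈-sym (⋆-+i (φ-sa (realPart z)) (φ-sa (imaginaryPart z)))))

      Φ-injective : ∀ {z w} → Φ z ≈ Φ w → z ≈ w
      Φ-injective {z} {w} h = ≈-trans (decomposition z) (≈-trans (+i-cong
          (proj₁ bijective {realPart z} {realPart w} (≈-trans (≈-sym (re-Φ z)) (≈-trans (re-cong h) (re-Φ w))))
          (proj₁ bijective {imaginaryPart z} {imaginaryPart w} (≈-trans (≈-sym (im-Φ z)) (≈-trans (im-cong h) (im-Φ w)))))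
        (≈-sym (decomposition w)))

      Φ-surjective : ∀ w → ∃[ z ] ∀ {v} → v ≈ z → Φ v ≈ w
      Φ-surjective w =
        let ((x , x⋆≈x) , x↦) = proj₂ bijective (realPart w)
            ((y , y⋆≈y) , y↦) = proj₂ bijective (imaginaryPart w)
        in x + i• y , λ {v} h → ≈-trans (+i-cong (x↦ {realPart v} (re-unique x⋆≈x y⋆≈y h))
             (y↦ {imaginaryPart v} (im-unique x⋆≈x y⋆≈y h))) (≈-sym (decomposition w))

      Φ-isStarIsomorphism : CB.IsStarIsomorphism Φ
      Φ-isStarIsomorphism = record
        { isLinear = record
          { +ᴹ-isGroupHomomorphism = record
            { isMonoidHomomorphism = record
              { isMagmaHomomorphism = record { isRelHomomorphism = record { cong = Φ-cong } ; homo = Φ-+ }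
              ; ε-homo = Φ-0
              }
            ; ⁻¹-homo = Φ-neg
            }
          ; *ₗ-homo = Φ-•
          }
        ; *-homo    = Φ-*
        ; ⋆-homo    = Φ-⋆
        ; bijective = Φ-injective , Φ-surjective
        }

      -- The procedure for φ is called twice, once for each part of the point, so `map-transfer`
      -- with its single query does not fit. Each call gets half of the error. The letters are first
      -- rewritten in the parts, because splitting the coefficients is correct for self-adjoint
      -- words.
      Φ-computable : ∀ a a⁺ → IsComputableMap (A.letters (parts a)) (A.letters (parts a⁺)) φ →
        IsComputableMap (CB.letters a) (CB.letters a⁺) Φ
      Φ-computable a a⁺ (e , approximate) = combine.program after pair (run realCoefficients-computable) (run imaginaryCoefficients-computable) , λ p k →
        let (s , run-s , close-s) = approximate (realCoefficients (T.translate p)) (suc k)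
            (t , run-t , close-t) = approximate (imaginaryCoefficients (T.translate p)) (suc k)
        in S.translate s ++ scale (0ℚᵘ , 1ℚᵘ) (S.translate t)
         , after⇓ (pair⇓ (runs realCoefficients-computable p k run-s) (runs imaginaryCoefficients-computable p k run-t)) (combine.correct (s , t))
         , close p k s t close-s close-t
        where
        module X = Letters (CB.letters a)
        module X⁺ = Letters (CB.letters a⁺)
        module Y = Letters (A.letters (parts a))
        module Y⁺ = Letters (A.letters (parts a⁺))
        module Z = Letters (CB.letters (mapPoints proj₁ (parts a)))
        module T = Translation (toParts-translation a)
        module S = Translation (inclusion-translation a⁺)
        module combine = Computable {a = Y⁺.⌜_⌝ ⊗ Y⁺.⌜_⌝} {b = X⁺.⌜_⌝} {f = λ (s , t) → S.translate s ++ scale (0ℚᵘ , 1ℚᵘ) (S.translate t)}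
          (++-computable (S.computable ∘ᶜ fst id-computable) (scale-computable (const-computable (0ℚᵘ , 1ℚᵘ)) (S.computable ∘ᶜ snd id-computable)))
        query : ∀ {f : Polynomial complex Z.Letter → Polynomial real Y.Letter} → Computable Z.⌜_⌝ Y.⌜_⌝ f →
          Computable (X.⌜_⌝ ⊗ ⌜_⌝ℕ) (Y.⌜_⌝ ⊗ ⌜_⌝ℕ) (λ (p , k) → f (T.translate p) , suc k)
        query F = F ∘ᶜ T.computable ∘ᶜ fst id-computable ,ᶜ suc-computable (snd id-computable)
        run : ∀ {f : Polynomial complex Z.Letter → Polynomial real Y.Letter} → Computable Z.⌜_⌝ Y.⌜_⌝ f → Program
        run F = e after Computable.program (query F)
        runs : ∀ {f : Polynomial complex Z.Letter → Polynomial real Y.Letter} (F : Computable Z.⌜_⌝ Y.⌜_⌝ f) p k {u} →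
          e $ Y.⌜ f (T.translate p) ⌝ ∙ ⌜ suc k ⌝ℕ ⇓ u → run F $ X.⌜ p ⌝ ∙ ⌜ k ⌝ℕ ⇓ u
        runs F p k h = after⇓ (Computable.correct (query F) (p , k)) h
        re-p : ∀ p → Y.⟦ realCoefficients (T.translate p) ⟧ A.≈ realPart X.⟦ p ⟧
        re-p p = ≈-trans (Translation.correct (realPart-translation (parts a)) (T.translate p)) (re-cong (T.correct p))
        im-p : ∀ p → Y.⟦ imaginaryCoefficients (T.translate p) ⟧ A.≈ imaginaryPart X.⟦ p ⟧
        im-p p = ≈-trans (Translation.correct (imaginaryPart-translation (parts a)) (T.translate p)) (im-cong (T.correct p))
        value : ∀ s t → X⁺.⟦ S.translate s ++ scale (0ℚᵘ , 1ℚᵘ) (S.translate t) ⟧ ≈ proj₁ Y⁺.⟦ s ⟧ + i• proj₁ Y⁺.⟦ t ⟧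
        value s t = ≈-trans (Values.⟦++⟧ isBanachAlgebra (CB.letters a⁺) (S.translate s) (scale (0ℚᵘ , 1ℚᵘ) (S.translate t)))
          (+-cong (S.correct s) (≈-trans (Products.⟦scale⟧ isBanachAlgebra (CB.letters a⁺) (0ℚᵘ , 1ℚᵘ) (S.translate t))
            (•-cong (pointwise _ _ (λ _ → refl) , pointwise _ _ (λ _ → refl)) (S.correct t))))
        close : ∀ p k s t →
          A.‖ φ Y.⟦ realCoefficients (T.translate p) ⟧ A.- Y⁺.⟦ s ⟧ ‖ <ℝ ratℝ (2^- suc k) →
          A.‖ φ Y.⟦ imaginaryCoefficients (T.translate p) ⟧ A.- Y⁺.⟦ t ⟧ ‖ <ℝ ratℝ (2^- suc k) →
          ‖ Φ X.⟦ p ⟧ - X⁺.⟦ S.translate s ++ scale (0ℚᵘ , 1ℚᵘ) (S.translate t) ⟧ ‖ <ℝ ratℝ (2^- k)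
        close p k s t close-s close-t = begin-strict
          ‖ Φ X.⟦ p ⟧ - X⁺.⟦ S.translate s ++ scale (0ℚᵘ , 1ℚᵘ) (S.translate t) ⟧ ‖
            ≈⟨ ‖‖-cong (≈-trans (+-cong (+i-cong (⟦⟧-cong (≈-sym (re-p p))) (⟦⟧-cong (≈-sym (im-p p))))
                 (≈-trans (-‿cong (value s t)) (+i-neg _ _))) (+i-+ _ _ _ _)) ⟩
          ‖ (u - proj₁ Y⁺.⟦ s ⟧) + i• (v - proj₁ Y⁺.⟦ t ⟧) ‖
            ≤⟨ ‖+i‖≤ (u - proj₁ Y⁺.⟦ s ⟧) (v - proj₁ Y⁺.⟦ t ⟧) ⟩
          ‖ u - proj₁ Y⁺.⟦ s ⟧ ‖ +ℝ ‖ v - proj₁ Y⁺.⟦ t ⟧ ‖       <⟨ +-bound-< k close-s close-t ⟩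
          ratℝ (2^- k)                                           ∎
          where
          open ≤ℝ-Reasoning
          u v : Carrier
          u = φ₁ Y.⟦ realCoefficients (T.translate p) ⟧
          v = φ₁ Y.⟦ imaginaryCoefficients (T.translate p) ⟧

    real⇒complex : A.ComputablyCategorical → CB.ComputablyCategorical
    real⇒complex categorical a a⁺ p p⁺ =
      let (φ , iso , computable) = categorical (parts a) (parts a⁺) (parts-presentation a p) (parts-presentation a⁺ p⁺)
      in Complexified.Φ iso , Complexified.Φ-isStarIsomorphism iso , Complexified.Φ-computable iso a a⁺ computable

theorem4p5 :
    (B : CStarAlgebra complex) (abelian : IsAbelian B) →
    CStar.HasComputablePresentation (CStarAlgebra.rawStarAlgebra B) →
    let rawB = CStarAlgebra.rawStarAlgebra B
        A = selfAdjointPart B abelian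
    in
    IsCStarAlgebra A
    × ((x : Points (RawStarAlgebra.Carrier A)) →
        CStar.IsComputablePresentation A x →
        CStar.IsComputablePresentation rawB (mapPoints proj₁ x))
    × (CStar.ComputablyCategorical rawB ⇔ CStar.ComputablyCategorical A)
    × (CStar.ComputablyCategorical A ⇔ Banach.ComputablyCategorical (RawStarAlgebra.rawNormedAlgebra A))
theorem4p5 B abelian _ =
    isCStarAlgebraᴬ
  , induced-presentation
  , mk⇔ complex⇒real real⇒complex
  , mk⇔ star⇒banach banach⇒star
  where
  open RealScalars.SelfAdjointPart B abelian using (isCStarAlgebraᴬ; algebraᴬ)
  open InducedPresentations.SelfAdjointPresentations B abelian using (induced-presentation; complex⇒real)
  open DoubledPresentations.Doubled B abelian using (real⇒complex)
  -- An element of A carries its proof of self-adjointness, so `proj₂` states that the involution is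
  -- trivial.
  open HermitianCategoricity.HermitianPresentations algebraᴬ proj₂ using (star⇒banach; banach⇒star)
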